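{- Let $\mu=(\mu_1\ge\dots\ge\mu_n\ge0)$ and $\nu=(\nu_1\ge\dots\ge\nu_n\ge0)$ be partitions, each with no three equal parts, let $T$ be a shuffle tableau of shape $\mu\oslash\nu$, and let $i\ge1$. The crystal operators $E_i$ and $F_i$ do not change the Temperley–Lieb type: $\psi(E_iT)=\psi(T)$ whenever $E_iT$ is defined, and $\psi(F_iT)=\psi(T)$ whenever $F_iT$ is defined.
   Context: **Shuffle tableaux.** Put $m=\lceil n/2\rceil$, $\mathrm{start}(r)=2\nu_r+r-2m$, $\mathrm{end}(r)=2\mu_r+r-2m-2$. Positions $(r,c)$ have row $r$ (top to bottom) and column $c\in\mathbb Z$ (left to right). The squares of shape $\mu\oslash\nu$ are the $(r,c)$ with $1\le r\le n$, $c\equiv r \pmod 2$, $\mathrm{start}(r)\le c\le \mathrm{end}(r)$ (row $r$ has $\mu_r-\nu_r$ squares; if $\mu_r<\nu_r$ for some $r$ there are no tableaux of this shape). A shuffle tableau $T$ of shape $\mu\oslash\nu$ is a filling of these squares by positive integers, weakly increasing along each row from left to right and strictly increasing down each column (so the odd rows form a semistandard skew tableau and the even rows form another one). **Temperley–Lieb type $\psi(T)$.** By convention a position $(r,c)$ with $c\equiv r \pmod 2$, $1\le r\le n$, has value $T(r,c)$ if it is a square, $-\infty$ if $c<\mathrm{start}(r)$, $+\infty$ if $c>\mathrm{end}(r)$. Let $p_r=\mathrm{start}(r)-2$ if $r\ge2$ and $\nu_{r-1}=\nu_r$, and $p_r=\mathrm{start}(r)-1$ otherwise; $q_r=\mathrm{end}(r)+2$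 if $r<n$ and $\mu_r=\mu_{r+1}$, and $q_r=\mathrm{end}(r)+1$ otherwise. Take the graph on vertices $(r,c)$, $1\le r\le n$, $p_r\le c\le q_r$, with horizontal edges between consecutive vertices of each row. For every $1\le r<n$ and every $c\equiv r \pmod 2$ with $\mathrm{start}(r)\le c\le\mathrm{end}(r+1)+1$ such that the value at $(r+1,c-1)$ is $\le$ the value at $(r,c)$, replace the two horizontal edges $(r,c-1)\text{–}(r,c)$ and $(r+1,c-1)\text{–}(r+1,c)$ by the two vertical edges $(r,c-1)\text{–}(r+1,c-1)$ and $(r,c)\text{–}(r+1,c)$. Put $R_r$ at $(r,p_r)$ and $L_r$ at $(r,q_r)$. The resulting graph is a disjoint union of closed loops and $n$ strands matching the $2n$ endpoints $L_1,\dots,L_n,R_1,\dots,R_n$ (if $p_r=q_r$, the strand is the single vertex joining $L_r$ and $R_r$); this noncrossing perfect matching is $\psi(T)$ (loops are ignored). **Crystal operators.** For $i\ge1$, an $(i,i+1)$-overlap is a pair of squares in the same column containing $i$ and $i+1$. The word $w_i(T)$ is obtained by taking all squares containing $i$ or $i+1$, discarding those in $(i,i+1)$-overlap pairs, and reading the entries of the remaining squares row by row from the bottom row to the top row, left to right in each row. View each $i+1$ as "(" and each $i$ as ")" and match parentheses as usual. $E_i(T)$ is obtained by changing to $i$ the entry of the square giving the leftmost unmatched $i+1$ in $w_i(T)$ (undefined if there is none); $F_i(T)$ is obtained by changing to $i+1$ the entry of the square giving the rightmost unmatched $i$ (undefined if there is none). -}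

module Defs where

open import Level using (0ℓ)
open import Data.Bool.Base using (if_then_else_)
open import Data.Fin.Base as Fin using (Fin; toℕ)
import Data.Fin.Properties as Fin
open import Data.Integer.Base as ℤ using (ℤ; +_; 1ℤ) renaming (_+_ to _+ᶻ_; _-_ to _-ᶻ_; _≤_ to _≤ᶻ_; _<_ to _<ᶻ_)
open import Data.Integer.Divisibility using (_∣_)
import Data.Integer.Properties as ℤ
open import Data.List.Base using (List; []; _∷_; map; concatMap; filter; reverse; allFin; foldl; head; last)
open import Data.Maybe.Base as Maybe using (Maybe)
open import Data.Nat.Base using (ℕ; suc; _+_; _*_; _∸_; _≤_; _<_; ⌈_/2⌉)
import Data.Nat.Properties as ℕ
open import Data.Product.Base using (Σ; ∃; ∃-syntax; _×_; _,_; proj₁; proj₂)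
import Data.Product.Properties as Product
open import Data.Sum.Base using (_⊎_)
open import Data.Vec.Functional using (Vector)
open import Relation.Binary.Construct.Add.Extrema.NonStrict _≤_ using (_≤±_)
open import Relation.Binary.Construct.Closure.Equivalence using (EqClosure)
open import Relation.Binary.Core using (Rel)
open import Relation.Binary.Definitions using (DecidableEquality)
open import Relation.Binary.PropositionalEquality.Core using (_≡_; _≢_)
open import Relation.Nullary.Construct.Add.Extrema using (_±; ⊥±; ⊤±; [_])
open import Relation.Nullary.Decidable using (Dec; does; ¬?; _×-dec_; _⊎-dec_)
open import Relation.Nullary.Negation using (¬_)

-- Sequences of length n, padded with zero parts if necessary.
IsPartition : ∀ {n} → Vector ℕ n → Set
IsPartition μ = ∀ {r s} → r Fin.≤ s → μ s ≤ μ r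

NoThreeEqual : ∀ {n} → Vector ℕ n → Set
NoThreeEqual μ = ∀ {r s t} → r Fin.< s → s Fin.< t → ¬ (μ r ≡ μ s × μ s ≡ μ t)

-- Rows are numbered from 1.
rowNo : ∀ {n} → Fin n → ℕ
rowNo r = suc (toℕ r)

-- Row s is the row directly below row r.
_⋖_ : ∀ {n} → Fin n → Fin n → Set
r ⋖ s = rowNo s ≡ suc (rowNo r)

_⋖?_ : ∀ {n} (r s : Fin n) → Dec (r ⋖ s)
r ⋖? s = rowNo s ℕ.≟ suc (rowNo r)

-- A vertex of the grid: (row , column).
Position : ℕ → Set
Position n = Fin n × ℤ

data Endpoint (n : ℕ) : Set where
  L R : Fin n → Endpoint n

module Shape {n : ℕ} (μ ν : Vector ℕ n) where

  start end : Fin n → ℤ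
  start r = + (2 * ν r + rowNo r) -ᶻ + (2 * ⌈ n /2⌉)
  end   r = + (2 * μ r + rowNo r) -ᶻ + (2 * ⌈ n /2⌉) -ᶻ + 2

  SameParity : Fin n → ℤ → Set
  SameParity r c = + 2 ∣ (c -ᶻ + rowNo r)

  -- (r , k) is the k-th square of row r from the left, counting from 0.  The
  -- columns c with SameParity r c and start r ≤ c ≤ end r are exactly
  -- start r, start r + 2, …, end r, and there are μ r ∸ ν r of them.
  Square : Set
  Square = Σ (Fin n) λ r → Fin (μ r ∸ ν r)

  row : Square → Fin n
  row = proj₁

  col : Square → ℤ
  col (r , k) = start r +ᶻ + (2 * toℕ k)

  _≟□_ : DecidableEquality Square
  _≟□_ = Product.≡-dec Fin._≟_ Fin._≟_

  Filling : Set
  Filling = Square → ℕ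

  record ShuffleTableau : Set where
    field
      contained : ∀ r → ν r ≤ μ r
      entry     : Filling
      positive  : ∀ s → 1 ≤ entry s
      rows      : ∀ s t → row s ≡ row t → col s ≤ᶻ col t → entry s ≤ entry t
      columns   : ∀ s t → col s ≡ col t → row s Fin.< row t → entry s < entry t

  -- The Temperley–Lieb type.  It depends only on the filling, so the
  -- definitions do not ask for the tableau conditions.

  -- Value T r c v : position (r , c) has value v, where ⊥± is -∞ and ⊤± is +∞.
  data Value (T : Filling) (r : Fin n) (c : ℤ) : ℕ ± → Set where
    square : ∀ k → c ≡ col (r , k) → Value T r c [ T (r , k) ]
    left   : SameParity r c → c <ᶻ start r → Value T r c ⊥±
    right  : SameParity r c → end r <ᶻ c → Value T r c ⊤±

  p q : Fin n → ℤ
  p r = start r -ᶻ (if does (Fin.any? λ s → (s ⋖? r) ×-dec (ν s ℕ.≟ ν r)) then + 2 else + 1)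
  q r = end r +ᶻ (if does (Fin.any? λ s → (r ⋖? s) ×-dec (μ r ℕ.≟ μ s)) then + 2 else + 1)

  -- The two horizontal edges between columns c - 1 and c in the adjacent
  -- rows r and s are replaced by vertical ones.
  record Replaced (T : Filling) (r s : Fin n) (c : ℤ) : Set where
    field
      adjacent : r ⋖ s
      parity   : SameParity r c
      lower    : start r ≤ᶻ c
      upper    : c ≤ᶻ end s +ᶻ 1ℤ
      values   : ∃[ u ] ∃[ v ] (Value T s (c -ᶻ 1ℤ) u × Value T r c v × u ≤± v)

  data Edge (T : Filling) : Rel (Position n) 0ℓ where
    horizontal : ∀ {r c} → p r ≤ᶻ c -ᶻ 1ℤ → c ≤ᶻ q r →
                 ¬ (∃[ s ] (Replaced T r s c ⊎ Replaced T s r c)) →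
                 Edge T (r , c -ᶻ 1ℤ) (r , c)
    verticalˡ  : ∀ {r s c} → Replaced T r s c → Edge T (r , c -ᶻ 1ℤ) (s , c -ᶻ 1ℤ)
    verticalʳ  : ∀ {r s c} → Replaced T r s c → Edge T (r , c) (s , c)

  position : Endpoint n → Position n
  position (L r) = r , q r
  position (R r) = r , p r

  -- The matching as a relation on the 2n endpoints: two distinct endpoints
  -- are matched when they lie in the same connected component of the graph.
  ψ : Filling → Rel (Endpoint n) 0ℓ
  ψ T e f = e ≢ f × EqClosure (Edge T) (position e) (position f)

  -- Crystal operators.

  Overlap : ℕ → Filling → Square → Square → Set
  Overlap i T s t = col s ≡ col t × T s ≡ i × T t ≡ suc i

  InOverlap : ℕ → Filling → Square → Set
  InOverlap i T s = ∃[ r ] ∃[ k ] (Overlap i T s (r , k) ⊎ Overlap i T (r , k) s)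

  overlap? : ∀ i T s t → Dec (Overlap i T s t)
  overlap? i T s t = (col s ℤ.≟ col t) ×-dec ((T s ℕ.≟ i) ×-dec (T t ℕ.≟ suc i))

  inOverlap? : ∀ i T s → Dec (InOverlap i T s)
  inOverlap? i T s = Fin.any? λ r → Fin.any? λ k →
    overlap? i T s (r , k) ⊎-dec overlap? i T (r , k) s

  -- Bottom row first, left to right within each row.
  squares : List Square
  squares = concatMap (λ r → map (r ,_) (allFin (μ r ∸ ν r))) (reverse (allFin n))

  -- The word w_i, recorded through the squares it is read from.
  word : ℕ → Filling → List Square
  word i T = filter (λ s → ((T s ℕ.≟ i) ⊎-dec (T s ℕ.≟ suc i)) ×-dec ¬? (inOverlap? i T s)) squares

  -- The unmatched ")" and the unmatched "(" of the part of the word read so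
  -- far, each list having the most recently read square first.
  Unmatched : Set
  Unmatched = List Square × List Square

  close : Square → Unmatched → Unmatched
  close s (is , [])       = s ∷ is , []
  close s (is , _ ∷ i+1s) = is , i+1s

  read : ℕ → Filling → Unmatched → Square → Unmatched
  read i T (is , i+1s) s =
    if does (T s ℕ.≟ suc i) then (is , s ∷ i+1s) else close s (is , i+1s)

  unmatched : ℕ → Filling → Unmatched
  unmatched i T = foldl (read i T) ([] , []) (word i T)

  _[_≔_] : Filling → Square → ℕ → Filling
  (T [ s ≔ v ]) t = if does (t ≟□ s) then v else T t

  -- The lists are in reverse reading order, so the leftmost unmatched i + 1
  -- comes last and the rightmost unmatched i comes first.
  E F : ℕ → Filling → Maybe Filling
  E i T = Maybe.map (λ s → T [ s ≔ i ]) (last (proj₂ (unmatched i T)))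
  F i T = Maybe.map (λ s → T [ s ≔ suc i ]) (head (proj₁ (unmatched i T)))

{-# OPTIONS --safe #-}

-- Write u_r for a crossing of rows r and r + 1 (a replaced pair of edges), so that the
-- graph is a word in Temperley–Lieb generators read from left to right.  Lowering the
-- square x = (r , c) from i + 1 to i can only remove u_r at c, when (r + 1 , c - 1) is
-- i + 1, and add u_{r-1} at c + 1, when (r - 1 , c + 1) is i.  If the i + 1 at
-- (r + 1 , c - 1) is not in an overlap, then the bracket rule makes it the end of a
-- staircase of i in row r over i + 1 in row r + 1, which starts at an earlier u_r with
-- no neighbouring crossing in between: u_r u_r = u_r up to a loop.  If it is in an
-- overlap, then there is a u_{r-1} at c - 1, and u_r is removed by means of the next
-- crossing, as in u_{r-1} u_r u_{r-1} = u_{r-1} or again u_r u_r = u_r.  Adding u_{r-1}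
-- is the same argument rotated by 180 degrees.
module Submission where

open import Defs
open import Data.Maybe.Base using (just)
open import Data.Nat.Base using (ℕ; _≤_)
open import Data.Product.Base using (_×_)
open import Data.Vec.Functional using (Vector)
open import Relation.Binary.Core using (_⇔_)
open import Relation.Binary.PropositionalEquality.Core using (_≡_)
open import Level using (0ℓ)
open import Data.Bool.Base using (true; false; if_then_else_)
open import Data.Empty using (⊥)
open import Data.Fin.Base as Fin using (Fin; zero; suc; toℕ; fromℕ<)
import Data.Fin.Properties as Fin
open import Data.Integer.Base as ℤ using (ℤ; +_; -[1+_]; 1ℤ) renaming (_+_ to _+ᶻ_; _-_ to _-ᶻ_; _*_ to _*ᶻ_; _≤_ to _≤ᶻ_; _<_ to _<ᶻ_)
import Data.Integer.Divisibility.Signed as Signed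
import Data.Integer.Properties as ℤ
open import Data.Integer.Tactic.RingSolver using (solve-∀)
open import Data.List.Base using (List; []; _∷_; _++_; length; take; drop; concatMap; filter; reverse; tabulate; allFin; foldl; head; last)
open import Data.List.Membership.Propositional using (_∈_; lose)
open import Data.List.Membership.Propositional.Properties using (∈-tabulate⁺; ∈-tabulate⁻; ∈-allFin; ∈-concatMap⁺; ∈-∃++)
import Data.List.Properties as List
open import Data.List.Relation.Binary.Permutation.Propositional using (↭-sym; ↭⇒↭ₛ)
open import Data.List.Relation.Binary.Permutation.Propositional.Properties using (↭-reverse)
import Data.List.Relation.Binary.Permutation.Setoid.Properties as ↭ₛ
open import Data.List.Relation.Unary.All as All using (All; []; _∷_)
import Data.List.Relation.Unary.All.Properties as All
open import Data.List.Relation.Unary.AllPairs as AllPairs using (_∷_)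
import Data.List.Relation.Unary.AllPairs.Properties as AllPairs
import Data.List.Relation.Unary.Any.Properties as Any
open import Data.List.Relation.Unary.Unique.Propositional using (Unique)
import Data.List.Relation.Unary.Unique.Propositional.Properties as Unique
open import Data.Maybe.Base as Maybe using (Maybe)
open import Data.Nat.Base using (zero; suc; pred; _+_; _*_; _∸_; _⊓_; _<_; z≤n; s≤s; s≤s⁻¹; ⌈_/2⌉)
open import Data.Nat.Divisibility using (∣1⇒≡1; _∣?_)
import Data.Nat.Properties as ℕ
import Data.Nat.Tactic.RingSolver as ℕSolver
open import Data.Product.Base using (∃-syntax; _,_; proj₁; proj₂; swap)
open import Data.Sum.Base using (_⊎_; inj₁; inj₂; [_,_]′)
open import Data.Unit.Base using (⊤; tt)
open import Function.Base using (_∘_; id)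
open import Relation.Binary.Construct.Add.Extrema.NonStrict _≤_ as Ext using (_≤±_; ⊥±≤_; _≤⊤±; ≤±-trans; [≤]-injective)
import Relation.Binary.Construct.Add.Supremum.NonStrict as Sup
open import Relation.Binary.Construct.Closure.Equivalence as Eq using (EqClosure; return)
open import Relation.Binary.Construct.Closure.ReflexiveTransitive using (ε; _◅◅_)
open import Relation.Binary.Core using (Rel; _⇒_)
open import Relation.Binary.Definitions using (Tri; tri<; tri≈; tri>)
open import Relation.Binary.PropositionalEquality.Core using (_≢_; refl; sym; trans; cong; cong₂; subst; ≢-sym)
open import Relation.Binary.PropositionalEquality.Properties using (setoid; module ≡-Reasoning)
open import Relation.Nullary.Construct.Add.Extrema using ([_])
open import Relation.Nullary.Decidable as Dec using (Dec; yes; no; does; _×-dec_; _⊎-dec_; _→-dec_; ¬?)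
open import Relation.Nullary.Negation using (¬_; contradiction)
open import Relation.Unary using (Decidable)

-- Both fillings are compared with the set of crossings that they share. Each of the two changes is
-- then the removal of a single crossing from a larger set, and adding needs no separate treatment.
-- Such a removal exchanges two edges for two others on the same four vertices. The matching
-- survives because one side of the exchange closes a loop inside a rectangle that contains no
-- endpoint. The staircases come from counting. The run of i + 1 in row r + 1 is a run of openings
-- read before x, and nothing may be pending when x is reached. So row r must contain, left of x, at
-- least as many closings as the run is long. Were there no crossing at the start of the run, too
-- few squares of row r would be left for them. Entries enter only through the thresholds i, i + 1
-- and i + 2. This treats positions outside the shape like squares and turns overlaps into
-- conditions on the position two rows away. For `F` the raised filling is shown to be a tableau in
-- which the raised square satisfies the same bracket conditions; the statement for `E` is then
-- applied to it.

-- Graphs with crossings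

-- In the next three lemmas the equation is a ring identity in every use.
shift-≤ : ∀ {i j x y} → y -ᶻ x ≡ j -ᶻ i → i ≤ᶻ j → x ≤ᶻ y
shift-≤ eq i≤j = ℤ.0≤i-j⇒j≤i (subst (+ 0 ≤ᶻ_) (sym eq) (ℤ.i≤j⇒0≤j-i i≤j))

<⇒shift-≤ : ∀ {i j x y} → y -ᶻ x ≡ j -ᶻ (1ℤ +ᶻ i) → i <ᶻ j → x ≤ᶻ y
<⇒shift-≤ eq i<j = shift-≤ eq (ℤ.i<j⇒suc[i]≤j i<j)

≤⇒shift-< : ∀ {i j x y} → y -ᶻ (1ℤ +ᶻ x) ≡ j -ᶻ i → i ≤ᶻ j → x <ᶻ y
≤⇒shift-< eq i≤j = ℤ.suc[i]≤j⇒i<j (shift-≤ eq i≤j)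

<⇒≤-1 : ∀ {i j} → i <ᶻ j → i ≤ᶻ j -ᶻ 1ℤ
<⇒≤-1 {i} {j} = <⇒shift-≤ (eq i j)
  where
  eq : ∀ i j → j -ᶻ 1ℤ -ᶻ i ≡ j -ᶻ (1ℤ +ᶻ i)
  eq = solve-∀

≤-1⇒< : ∀ {i j} → i ≤ᶻ j -ᶻ 1ℤ → i <ᶻ j
≤-1⇒< {i} {j} = ≤⇒shift-< (eq i j)
  where
  eq : ∀ i j → j -ᶻ (1ℤ +ᶻ i) ≡ j -ᶻ 1ℤ -ᶻ i
  eq = solve-∀

i-1<i : ∀ i → i -ᶻ 1ℤ <ᶻ i
i-1<i i = ≤-1⇒< ℤ.≤-refl

i-1<j⇒i≤j : ∀ {i j} → i -ᶻ 1ℤ <ᶻ j → i ≤ᶻ j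
i-1<j⇒i≤j {i} {j} = <⇒shift-≤ (eq i j)
  where
  eq : ∀ i j → j -ᶻ i ≡ j -ᶻ (1ℤ +ᶻ (i -ᶻ 1ℤ))
  eq = solve-∀

along : {A B : Set} {Q : Rel A 0ℓ} {S : Rel B 0ℓ} (h : A → B) →
        (∀ {u v} → Q u v → EqClosure S (h u) (h v)) →
        ∀ {u v} → EqClosure Q u v → EqClosure S (h u) (h v)
along {S = S} h = Eq.gfold (Eq.isEquivalence S) h

inverse : {A : Set} {S : Rel A 0ℓ} {u v : A} → EqClosure S u v → EqClosure S v u
inverse = Eq.symmetric _

-- Exchanging two edges of a graph

data Add {V : Set} (C : Rel V 0ℓ) (w x y z : V) : Rel V 0ℓ where
  base   : ∀ {u v} → C u v → Add C w x y z u v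
  first  : Add C w x y z w x
  second : Add C w x y z y z

-- A component K that meets wx but no endpoint is a loop once wx is added;
-- trading wx, yz for wy, xz merely splices this loop into the strand through yz.
module Splice {V : Set} (C : Rel V 0ℓ) (w x y z : V) {K : V → Set} (K? : Decidable K)
  (closed : ∀ {u v} → C u v → (K u → K v) × (K v → K u))
  (Kw : K w) (Kx : K x) (w~x : EqClosure C w x) where

  -- Contracting `K` to `y` turns the edge from `w` to `y` into a point and the edge from `x` to `z`
  -- into the one from `y` to `z`, or into a point if `z` lies in `K`. A path of the spliced graph
  -- may wander through `K`; its image under `collapse` is a path of the other graph with the same
  -- ends, if these lie outside `K`.
  collapse : V → V
  collapse v with K? v
  ... | yes _ = y
  ... | no  _ = v

  collapse-in : ∀ {v} → K v → collapse v ≡ y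
  collapse-in {v} Kv with K? v
  ... | yes _  = refl
  ... | no ¬Kv = contradiction Kv ¬Kv

  collapse-out : ∀ {v} → ¬ K v → collapse v ≡ v
  collapse-out {v} ¬Kv with K? v
  ... | yes Kv = contradiction Kv ¬Kv
  ... | no _   = refl

  collapse-y : collapse y ≡ y
  collapse-y with K? y
  ... | yes _ = refl
  ... | no _  = refl

  merge : EqClosure (Add C w x y z) ⇒ EqClosure (Add C w y x z)
  merge = along id λ where
    (base e) → return (base e)
    first    → Eq.map base w~x
    second   → inverse (return first) ◅◅ Eq.map base w~x ◅◅ return second

  split : ∀ {u v} → ¬ K u → ¬ K v → EqClosure (Add C w y x z) u v → EqClosure (Add C w x y z) u v
  split ¬Ku ¬Kv path = subst₂′ (collapse-out ¬Ku) (collapse-out ¬Kv) (along collapse step path)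
    where
    _~_ : Rel V 0ℓ
    _~_ = EqClosure (Add C w x y z)
    subst₂′ : ∀ {u u′ v v′} → u ≡ u′ → v ≡ v′ → u ~ v → u′ ~ v′
    subst₂′ refl refl e = e
    step : ∀ {u v} → Add C w y x z u v → collapse u ~ collapse v
    step first = subst₂′ (sym (collapse-in Kw)) (sym collapse-y) ε
    step second with K? z
    ... | yes _ = subst₂′ (sym (collapse-in Kx)) refl ε
    ... | no  _ = subst₂′ (sym (collapse-in Kx)) refl (return second)
    step {u} {v} (base e) with K? u | K? v
    ... | yes _  | yes _  = ε
    ... | no _   | no _   = return (base e)
    ... | yes Ku | no ¬Kv = contradiction (proj₁ (closed e) Ku) ¬Kv
    ... | no ¬Ku | yes Kv = contradiction (proj₂ (closed e) Kv) ¬Ku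

⋖-irrefl : ∀ {n} {r : Fin n} {A : Set} → r ⋖ r → A
⋖-irrefl r⋖r = contradiction (sym r⋖r) ℕ.1+n≢n

module _ {n : ℕ} {r s : Fin n} where

  ⋖-functional : ∀ {t} → r ⋖ s → r ⋖ t → s ≡ t
  ⋖-functional r⋖s r⋖t = Fin.toℕ-injective (ℕ.suc-injective (trans r⋖s (sym r⋖t)))

  ⋖-injective : ∀ {t} → r ⋖ t → s ⋖ t → r ≡ s
  ⋖-injective r⋖t s⋖t = Fin.toℕ-injective (ℕ.suc-injective (ℕ.suc-injective (trans (sym r⋖t) s⋖t)))

  ⋖-asym : r ⋖ s → ¬ s ⋖ r
  ⋖-asym r⋖s s⋖r = ℕ.m≢1+n+m (rowNo r) {1} (trans s⋖r (cong suc r⋖s))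

  ⋖⇒< : r ⋖ s → r Fin.< s
  ⋖⇒< r⋖s = ℕ.≤-reflexive (sym (ℕ.suc-injective r⋖s))

-- Removing one crossing from a graph of crossings

module Strands {n : ℕ} (μ ν : Vector ℕ n) where
  open Shape μ ν

  parity-⋖ : ∀ {r s} c → r ⋖ s → SameParity r c → ¬ SameParity s c
  parity-⋖ {r} {s} c r⋖s rc sc = contradiction (∣1⇒≡1 (Signed.∣⇒∣ᵤ 2∣1)) λ ()
    where
    eq : ∀ c x → c -ᶻ x -ᶻ (c -ᶻ (1ℤ +ᶻ x)) ≡ 1ℤ
    eq = solve-∀
    2∣1 : (+ 2) Signed.∣ 1ℤ
    2∣1 = subst (+ 2 Signed.∣_) (trans (cong (λ x → c -ᶻ + rowNo r -ᶻ (c -ᶻ + x)) r⋖s) (eq c (+ rowNo r)))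
      (Signed.∣m∣n⇒∣m-n (Signed.∣ᵤ⇒∣ {+ 2} {c -ᶻ + rowNo r} rc) (Signed.∣ᵤ⇒∣ {+ 2} {c -ᶻ + rowNo s} sc))

  -- Edge with an arbitrary set of crossings in place of Replaced: the graph with
  -- only one of the two changed crossings need not come from a filling.
  Crossings : Set₁
  Crossings = Fin n → Fin n → ℤ → Set

  data EdgeOf (U : Crossings) : Rel (Position n) 0ℓ where
    horizontal : ∀ {r c} → p r ≤ᶻ c -ᶻ 1ℤ → c ≤ᶻ q r →
                 ¬ (∃[ s ] (U r s c ⊎ U s r c)) →
                 EdgeOf U (r , c -ᶻ 1ℤ) (r , c)
    verticalˡ  : ∀ {r s c} → U r s c → EdgeOf U (r , c -ᶻ 1ℤ) (s , c -ᶻ 1ℤ)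
    verticalʳ  : ∀ {r s c} → U r s c → EdgeOf U (r , c) (s , c)

  Joins : Rel (Position n) 0ℓ → Rel (Endpoint n) 0ℓ
  Joins G e f = EqClosure G (position e) (position f)

  record Site (r s : Fin n) (c : ℤ) : Set where
    field
      adjacent : r ⋖ s
      parity   : SameParity r c
      p-upper  : p r ≤ᶻ c -ᶻ 1ℤ
      q-upper  : c ≤ᶻ q r
      p-lower  : p s ≤ᶻ c -ᶻ 1ℤ
      q-lower  : c ≤ᶻ q s

  Sites : Crossings → Set
  Sites U = ∀ {r s c} → U r s c → Site r s c

  -- The admissible columns alternate in parity from row to row, so two crossings in one column
  -- never meet in a common middle row. Hence at most one crossing decides about a given horizontal
  -- edge.
  parity-clash : ∀ {U} → Sites U → ∀ {r s t c} → U r s c → ¬ U s t c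
  parity-clash sites {c = c} u v = parity-⋖ c (Site.adjacent (sites u)) (Site.parity (sites u)) (Site.parity (sites v))

  record Remove (U⁺ U⁻ : Crossings) (r₀ s₀ : Fin n) (c₀ : ℤ) : Set where
    field
      present : U⁺ r₀ s₀ c₀
      absent  : ¬ U⁻ r₀ s₀ c₀
      weaken  : ∀ {r s c} → U⁻ r s c → U⁺ r s c
      others  : ∀ {r s c} → U⁺ r s c → U⁻ r s c ⊎ (r ≡ r₀ × s ≡ s₀ × c ≡ c₀)

  -- The rectangle of rows a, b and columns l, …, h - 1 is cut off by two crossings
  -- of rows a and b, so that its boundary carries a single strand or loop.
  record Frame (U⁺ U⁻ : Crossings) (a b : Fin n) (l h : ℤ) : Set where
    field
      l<h    : l <ᶻ h
      barˡ   : U⁺ a b l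
      barʳ   : U⁺ a b h
      middle : ∀ {e} → l <ᶻ e → e <ᶻ h → ¬ U⁺ a b e
      above  : ∀ {e t} → l <ᶻ e → e <ᶻ h → ¬ U⁻ t a e
      below  : ∀ {e t} → l <ᶻ e → e <ᶻ h → ¬ U⁻ b t e

  module Removal {U⁺ U⁻ : Crossings} (sites : Sites U⁺) {r₀ s₀ c₀} (rem : Remove U⁺ U⁻ r₀ s₀ c₀) where
    open Remove rem

    nw ne sw se : Position n
    nw = r₀ , c₀ -ᶻ 1ℤ
    ne = r₀ , c₀
    sw = s₀ , c₀ -ᶻ 1ℤ
    se = s₀ , c₀

    site₀ : Site r₀ s₀ c₀
    site₀ = sites present
    open Site site₀ using () renaming (adjacent to r₀⋖s₀)

    -- What both graphs have in common: the graph of `U⁺` adds the vertical sides of the square at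
    -- the removed crossing, the graph of `U⁻` its horizontal sides.
    data Common : Rel (Position n) 0ℓ where
      horizontal : ∀ {r c} → p r ≤ᶻ c -ᶻ 1ℤ → c ≤ᶻ q r →
                   ¬ (∃[ s ] (U⁺ r s c ⊎ U⁺ s r c)) → Common (r , c -ᶻ 1ℤ) (r , c)
      verticalˡ  : ∀ {r s c} → U⁻ r s c → Common (r , c -ᶻ 1ℤ) (s , c -ᶻ 1ℤ)
      verticalʳ  : ∀ {r s c} → U⁻ r s c → Common (r , c) (s , c)

    toAdd⁺ : EdgeOf U⁺ ⇒ Add Common nw sw ne se
    toAdd⁺ (horizontal a b c) = base (horizontal a b c)
    toAdd⁺ (verticalˡ u) with others u
    ... | inj₁ v                    = base (verticalˡ v)
    ... | inj₂ (refl , refl , refl) = first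
    toAdd⁺ (verticalʳ u) with others u
    ... | inj₁ v                    = base (verticalʳ v)
    ... | inj₂ (refl , refl , refl) = second

    fromAdd⁺ : Add Common nw sw ne se ⇒ EdgeOf U⁺
    fromAdd⁺ (base (horizontal a b c)) = horizontal a b c
    fromAdd⁺ (base (verticalˡ u))      = verticalˡ (weaken u)
    fromAdd⁺ (base (verticalʳ u))      = verticalʳ (weaken u)
    fromAdd⁺ first                     = verticalˡ present
    fromAdd⁺ second                    = verticalʳ present

    toAdd⁻ : EdgeOf U⁻ ⇒ Add Common nw ne sw se
    toAdd⁻ (verticalˡ u) = base (verticalˡ u)
    toAdd⁻ (verticalʳ u) = base (verticalʳ u)
    toAdd⁻ (horizontal {r} {c} a b ¬u) with c ℤ.≟ c₀ | r Fin.≟ r₀ | r Fin.≟ s₀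
    ... | yes refl | yes refl | _        = first
    ... | yes refl | no _     | yes refl = second
    ... | yes refl | no r≢r₀  | no r≢s₀  = base (horizontal a b λ where
      (s , inj₁ u) → [ (λ v → ¬u (s , inj₁ v)) , (λ eqs → r≢r₀ (proj₁ eqs)) ]′ (others u)
      (s , inj₂ u) → [ (λ v → ¬u (s , inj₂ v)) , (λ eqs → r≢s₀ (proj₁ (proj₂ eqs))) ]′ (others u))
    ... | no c≢c₀  | _        | _        = base (horizontal a b λ where
      (s , inj₁ u) → [ (λ v → ¬u (s , inj₁ v)) , (λ eqs → c≢c₀ (proj₂ (proj₂ eqs))) ]′ (others u)
      (s , inj₂ u) → [ (λ v → ¬u (s , inj₂ v)) , (λ eqs → c≢c₀ (proj₂ (proj₂ eqs))) ]′ (others u))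

    fromAdd⁻ : Add Common nw ne sw se ⇒ EdgeOf U⁻
    fromAdd⁻ (base (horizontal a b c)) = horizontal a b λ where
      (s , inj₁ u) → c (s , inj₁ (weaken u))
      (s , inj₂ u) → c (s , inj₂ (weaken u))
    fromAdd⁻ (base (verticalˡ u)) = verticalˡ u
    fromAdd⁻ (base (verticalʳ u)) = verticalʳ u
    -- In `U⁻` the side must be untouched: a crossing with the same neighbour row would be the
    -- absent one, and one with the opposite neighbour has the wrong parity.
    fromAdd⁻ first = horizontal (Site.p-upper site₀) (Site.q-upper site₀) λ where
      (s , inj₁ u) → absent (subst (λ s → U⁻ r₀ s c₀) (⋖-functional (Site.adjacent (sites (weaken u))) r₀⋖s₀) u)
      (s , inj₂ u) → parity-clash sites (weaken u) present
    fromAdd⁻ second = horizontal (Site.p-lower site₀) (Site.q-lower site₀) λ where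
      (s , inj₁ u) → parity-clash sites present (weaken u)
      (s , inj₂ u) → absent (subst (λ r → U⁻ r s₀ c₀) (⋖-injective (Site.adjacent (sites (weaken u))) r₀⋖s₀) u)

    swap-Add : ∀ {w x y z} → Add Common w x y z ⇒ Add Common y z w x
    swap-Add (base e) = base e
    swap-Add first    = second
    swap-Add second   = first

    flip-Add : ∀ {w x y z} → Add Common w x y z ⇒ EqClosure (Add Common x w z y)
    flip-Add (base e) = return (base e)
    flip-Add first    = inverse (return first)
    flip-Add second   = inverse (return second)

    row-path : ∀ {r} d {u v} → v ≡ u +ᶻ + d →
               (∀ {e} → u <ᶻ e → e ≤ᶻ v → Common (r , e -ᶻ 1ℤ) (r , e)) →
               EqClosure Common (r , u) (r , v)
    row-path {r} zero {u} refl edge = subst (λ v → EqClosure Common (r , u) (r , v)) (sym (ℤ.+-identityʳ u)) ε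
    row-path {r} (suc d) {u} refl edge =
      row-path d refl (λ u<e e≤v → edge u<e (ℤ.≤-trans e≤v (ℤ.+-monoʳ-≤ u (ℤ.+≤+ (ℕ.n≤1+n d))))) ◅◅
      subst (λ v → EqClosure Common (r , v) (r , u +ᶻ + suc d)) (eq u (+ d))
        (return (edge (≤⇒shift-< (eq′ u (+ d)) (ℤ.+≤+ (z≤n {d}))) ℤ.≤-refl))
      where
      eq : ∀ u d → u +ᶻ (1ℤ +ᶻ d) -ᶻ 1ℤ ≡ u +ᶻ d
      eq = solve-∀
      eq′ : ∀ u d → u +ᶻ (1ℤ +ᶻ d) -ᶻ (1ℤ +ᶻ u) ≡ d -ᶻ + 0
      eq′ = solve-∀

    path-≤ : ∀ {r u v} → u ≤ᶻ v →
             (∀ {e} → u <ᶻ e → e ≤ᶻ v → Common (r , e -ᶻ 1ℤ) (r , e)) →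
             EqClosure Common (r , u) (r , v)
    path-≤ {r} {u} {v} u≤v edge = row-path ℤ.∣ v -ᶻ u ∣ (sym eq) edge
      where
      eq′ : ∀ u v → u +ᶻ (v -ᶻ u) ≡ v
      eq′ = solve-∀
      eq : u +ᶻ + ℤ.∣ v -ᶻ u ∣ ≡ v
      eq = trans (cong (u +ᶻ_) (ℤ.0≤i⇒+∣i∣≡i (ℤ.i≤j⇒0≤j-i u≤v))) (eq′ u v)

    module Framed {a b l h} (frame : Frame U⁺ U⁻ a b l h) where
      open Frame frame

      siteˡ : Site a b l
      siteˡ = sites barˡ

      siteʳ : Site a b h
      siteʳ = sites barʳ

      a⋖b : a ⋖ b
      a⋖b = Site.adjacent siteˡ

      K : Position n → Set
      K (r , c) = (r ≡ a ⊎ r ≡ b) × l ≤ᶻ c × c <ᶻ h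

      K? : Decidable K
      K? (r , c) = (r Fin.≟ a ⊎-dec r Fin.≟ b) ×-dec (l ℤ.≤? c ×-dec c ℤ.<? h)

      bar-horizontal : ∀ {r c} → r ≡ a ⊎ r ≡ b → U⁺ a b c → ∃[ s ] (U⁺ r s c ⊎ U⁺ s r c)
      bar-horizontal (inj₁ refl) u = b , inj₁ u
      bar-horizontal (inj₂ refl) u = a , inj₂ u

      -- The bounds are weak because a vertical edge inside the rectangle may belong to a crossing
      -- at column `l` or `h`. There parity excludes it, since `a` and `b` themselves cross in these
      -- columns.
      inner-above : ∀ {t c} → U⁻ t a c → l ≤ᶻ c → ¬ c ≤ᶻ h
      inner-above u l≤c c≤h = above
        (ℤ.≤∧≢⇒< l≤c λ { refl → parity-clash sites (weaken u) barˡ })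
        (ℤ.≤∧≢⇒< c≤h λ { refl → parity-clash sites (weaken u) barʳ }) u

      inner-below : ∀ {t c} → U⁻ b t c → l ≤ᶻ c → ¬ c ≤ᶻ h
      inner-below u l≤c c≤h = below
        (ℤ.≤∧≢⇒< l≤c λ { refl → parity-clash sites barˡ (weaken u) })
        (ℤ.≤∧≢⇒< c≤h λ { refl → parity-clash sites barʳ (weaken u) }) u

      -- Serves both vertical edges of a crossing at `c`: the column `e` is `c - 1` or `c`, and the
      -- two implications convert the bounds.
      closed-vertical : ∀ {r s c e} → U⁻ r s c → (l ≤ᶻ e → l ≤ᶻ c) → (e <ᶻ h → c ≤ᶻ h) →
                        (K (r , e) → K (s , e)) × (K (s , e) → K (r , e))
      closed-vertical {r} {s} {c} {e} u lower upper = down , up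
        where
        down : K (r , e) → K (s , e)
        down (inj₁ refl , l≤e , e<h) = inj₂ (⋖-functional (Site.adjacent (sites (weaken u))) a⋖b) , l≤e , e<h
        down (inj₂ refl , l≤e , e<h) = contradiction (upper e<h) (inner-below u (lower l≤e))
        up : K (s , e) → K (r , e)
        up (inj₁ refl , l≤e , e<h) = contradiction (upper e<h) (inner-above u (lower l≤e))
        up (inj₂ refl , l≤e , e<h) = inj₁ (⋖-injective (Site.adjacent (sites (weaken u))) a⋖b) , l≤e , e<h

      closed : ∀ {u v} → Common u v → (K u → K v) × (K v → K u)
      closed (horizontal {r} {c} _ _ ¬u) = rightwards , leftwards
        where
        rightwards : K (r , c -ᶻ 1ℤ) → K (r , c)
        rightwards (r∈ , l≤ , <h) = r∈ , ℤ.≤-trans l≤ (ℤ.<⇒≤ (i-1<i c)) ,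
          ℤ.≤∧≢⇒< (i-1<j⇒i≤j <h) λ { refl → ¬u (bar-horizontal r∈ barʳ) }
        leftwards : K (r , c) → K (r , c -ᶻ 1ℤ)
        leftwards (r∈ , l≤ , <h) = r∈ ,
          <⇒≤-1 (ℤ.≤∧≢⇒< l≤ λ { refl → ¬u (bar-horizontal r∈ barˡ) }) , ℤ.<-trans (i-1<i c) <h
      closed (verticalˡ {c = c} u) = closed-vertical u (λ l≤ → ℤ.≤-trans l≤ (ℤ.<⇒≤ (i-1<i c))) i-1<j⇒i≤j
      closed (verticalʳ u) = closed-vertical u id ℤ.<⇒≤

      -- The bars need room between `p` and `q` in both rows: this puts the `R` endpoints of these
      -- rows left of `l` and the `L` endpoints at `h` or beyond.
      endpoint-outside : ∀ e → ¬ K (position e)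
      endpoint-outside (L _) (inj₁ refl , _ , q<h) = ℤ.<⇒≱ q<h (Site.q-upper siteʳ)
      endpoint-outside (L _) (inj₂ refl , _ , q<h) = ℤ.<⇒≱ q<h (Site.q-lower siteʳ)
      endpoint-outside (R _) (inj₁ refl , l≤p , _) = ℤ.<⇒≱ (≤-1⇒< (Site.p-upper siteˡ)) l≤p
      endpoint-outside (R _) (inj₂ refl , l≤p , _) = ℤ.<⇒≱ (≤-1⇒< (Site.p-lower siteˡ)) l≤p

      -- `Frame` forbids crossings with the row above only in `U⁻`, since the removed crossing
      -- itself may reach into the frame from there; `Common` wants them absent from `U⁺`. The
      -- hypothesis on `s₀` and `c₀` bridges the gap.
      horizontal-a : ∀ {e} → ¬ (s₀ ≡ a × e ≡ c₀) → l <ᶻ e → e <ᶻ h → Common (a , e -ᶻ 1ℤ) (a , e)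
      horizontal-a {e} away l<e e<h = horizontal
        (ℤ.≤-trans (Site.p-upper siteˡ) (ℤ.+-monoˡ-≤ _ (ℤ.<⇒≤ l<e)))
        (ℤ.≤-trans (ℤ.<⇒≤ e<h) (Site.q-upper siteʳ)) λ where
          (t , inj₁ u) → middle l<e e<h
            (subst (λ t → U⁺ a t e) (⋖-functional (Site.adjacent (sites u)) a⋖b) u)
          (t , inj₂ u) → [ above l<e e<h , (λ eqs → away (sym (proj₁ (proj₂ eqs)) , proj₂ (proj₂ eqs))) ]′ (others u)

      horizontal-b : ∀ {e} → ¬ (r₀ ≡ b × e ≡ c₀) → l <ᶻ e → e <ᶻ h → Common (b , e -ᶻ 1ℤ) (b , e)
      horizontal-b {e} away l<e e<h = horizontal
        (ℤ.≤-trans (Site.p-lower siteˡ) (ℤ.+-monoˡ-≤ _ (ℤ.<⇒≤ l<e)))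
        (ℤ.≤-trans (ℤ.<⇒≤ e<h) (Site.q-lower siteʳ)) λ where
          (t , inj₂ u) → middle l<e e<h
            (subst (λ t → U⁺ t b e) (⋖-injective (Site.adjacent (sites u)) a⋖b) u)
          (t , inj₁ u) → [ below l<e e<h , (λ eqs → away (sym (proj₁ eqs) , proj₂ (proj₂ eqs))) ]′ (others u)

      inside-K : ∀ {r c} → r ≡ a ⊎ r ≡ b → l <ᶻ c → c <ᶻ h → K (r , c -ᶻ 1ℤ) × K (r , c)
      inside-K {c = c} r∈ l<c c<h =
        (r∈ , <⇒≤-1 l<c , ℤ.<-trans (i-1<i c) c<h) , (r∈ , ℤ.<⇒≤ l<c , c<h)

    Preserved : Set
    Preserved = Joins (EdgeOf U⁺) ⇔ Joins (EdgeOf U⁻)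

    -- u_a u_a = u_a up to a loop.
    remove-barʳ : ∀ {l} → Frame U⁺ U⁻ r₀ s₀ l c₀ → Preserved
    remove-barʳ {l} frame =
      (λ path → Eq.map fromAdd⁻ (S.merge (Eq.map toAdd⁺ path))) ,
      (λ {e} {f} path → Eq.map fromAdd⁺ (S.split (endpoint-outside e) (endpoint-outside f) (Eq.map toAdd⁻ path)))
      where
      open Frame frame
      open Framed frame
      left-bar : U⁻ r₀ s₀ l
      left-bar = [ id , (λ eqs → contradiction (proj₂ (proj₂ eqs)) (ℤ.<⇒≢ l<h)) ]′ (others barˡ)
      away : ∀ {e} → e ≤ᶻ c₀ -ᶻ 1ℤ → e ≢ c₀
      away e≤ = ℤ.<⇒≢ (≤-1⇒< e≤)
      loop : EqClosure Common nw sw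
      loop =
        inverse (path-≤ (<⇒≤-1 l<h) λ l<e e≤ → horizontal-a (away e≤ ∘ proj₂) l<e (≤-1⇒< e≤)) ◅◅
        return (verticalʳ left-bar) ◅◅
        path-≤ (<⇒≤-1 l<h) λ l<e e≤ → horizontal-b (away e≤ ∘ proj₂) l<e (≤-1⇒< e≤)
      in-K : ∀ {r} → r ≡ r₀ ⊎ r ≡ s₀ → K (r , c₀ -ᶻ 1ℤ)
      in-K r∈ = r∈ , <⇒≤-1 l<h , i-1<i c₀
      module S = Splice Common nw sw ne se {K = K} K? closed (in-K (inj₁ refl)) (in-K (inj₂ refl)) loop

    -- The mirror image of `remove-barʳ`: the loop now passes through `ne` and `se`, so `swap-Add`
    -- and `flip-Add` reorder and reverse the two edges to fit `Splice`.
    remove-barˡ : ∀ {h} → Frame U⁺ U⁻ r₀ s₀ c₀ h → Preserved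
    remove-barˡ {h} frame =
      (λ path → Eq.map fromAdd⁻ (along id flip-Add (S.merge (Eq.map (swap-Add ∘ toAdd⁺) path)))) ,
      (λ {e} {f} path → Eq.map (fromAdd⁺ ∘ swap-Add)
        (S.split (endpoint-outside e) (endpoint-outside f) (along id (flip-Add ∘ toAdd⁻) path)))
      where
      open Frame frame
      open Framed frame
      right-bar : U⁻ r₀ s₀ h
      right-bar = [ id , (λ eqs → contradiction (sym (proj₂ (proj₂ eqs))) (ℤ.<⇒≢ l<h)) ]′ (others barʳ)
      away : ∀ {e} → c₀ <ᶻ e → e ≢ c₀
      away c₀<e refl = ℤ.<-irrefl refl c₀<e
      loop : EqClosure Common ne se
      loop =
        (path-≤ (<⇒≤-1 l<h) λ l<e e≤ → horizontal-a (away l<e ∘ proj₂) l<e (≤-1⇒< e≤)) ◅◅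
        return (verticalˡ right-bar) ◅◅
        inverse (path-≤ (<⇒≤-1 l<h) λ l<e e≤ → horizontal-b (away l<e ∘ proj₂) l<e (≤-1⇒< e≤))
      in-K : ∀ {r} → r ≡ r₀ ⊎ r ≡ s₀ → K (r , c₀)
      in-K r∈ = r∈ , ℤ.≤-refl , l<h
      module S = Splice Common ne se nw sw {K = K} K? closed (in-K (inj₁ refl)) (in-K (inj₂ refl)) loop

    -- u_a u_b u_a = u_a for b = a ± 1, and then u_a u_a = u_a up to a loop.
    remove-below : ∀ {a l h} → Frame U⁺ U⁻ a r₀ l h → l <ᶻ c₀ → c₀ <ᶻ h → Preserved
    remove-below {a} {l} {h} frame l<c₀ c₀<h =
      -- Here the graph without the crossing carries the loop, and the crossing splices it into row
      -- `s₀`; so `split` and `merge` change places.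
      (λ {e} {f} path → Eq.map fromAdd⁻ (S.split (endpoint-outside e) (endpoint-outside f) (Eq.map toAdd⁺ path))) ,
      (λ path → Eq.map fromAdd⁺ (S.merge (Eq.map toAdd⁻ path)))
      where
      open Frame frame
      open Framed frame
      other : ∀ {c} → U⁺ a r₀ c → U⁻ a r₀ c
      other u = [ id , (λ eqs → ⋖-irrefl (subst (_⋖ r₀) (proj₁ eqs) a⋖b)) ]′ (others u)
      row-a : ∀ {e} → l <ᶻ e → e <ᶻ h → Common (a , e -ᶻ 1ℤ) (a , e)
      row-a = horizontal-a λ eqs → ⋖-asym a⋖b (subst (r₀ ⋖_) (proj₁ eqs) r₀⋖s₀)
      loop : EqClosure Common nw ne
      loop =
        -- Around the frame from `nw`: left along row `r₀`, up the left bar, right along row `a`,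
        -- down the right bar, and back along row `r₀` to `ne`.
        inverse (path-≤ (<⇒≤-1 l<c₀) λ l<e e≤ →
          horizontal-b (ℤ.<⇒≢ (≤-1⇒< e≤) ∘ proj₂) l<e (ℤ.<-trans (≤-1⇒< e≤) c₀<h)) ◅◅
        inverse (return (verticalʳ (other barˡ))) ◅◅
        (path-≤ (<⇒≤-1 l<h) λ l<e e≤ → row-a l<e (≤-1⇒< e≤)) ◅◅
        return (verticalˡ (other barʳ)) ◅◅
        inverse (path-≤ (<⇒≤-1 c₀<h) λ c₀<e e≤ →
          horizontal-b ((λ { refl → ℤ.<-irrefl refl c₀<e }) ∘ proj₂) (ℤ.<-trans l<c₀ c₀<e) (≤-1⇒< e≤))
      in-K : K nw × K ne
      in-K = inside-K (inj₂ refl) l<c₀ c₀<h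
      module S = Splice Common nw ne sw se {K = K} K? closed (proj₁ in-K) (proj₂ in-K) loop

    remove-above : ∀ {b l h} → Frame U⁺ U⁻ s₀ b l h → l <ᶻ c₀ → c₀ <ᶻ h → Preserved
    remove-above {b} {l} {h} frame l<c₀ c₀<h =
      (λ {e} {f} path → Eq.map fromAdd⁻ (along id (return ∘ swap-Add)
        (S.split (endpoint-outside e) (endpoint-outside f) (along id (flip-Add ∘ toAdd⁺) path)))) ,
      (λ path → Eq.map fromAdd⁺ (along id flip-Add (S.merge (Eq.map (swap-Add ∘ toAdd⁻) path))))
      where
      open Frame frame
      open Framed frame
      other : ∀ {c} → U⁺ s₀ b c → U⁻ s₀ b c
      other u = [ id , (λ eqs → ⋖-irrefl (subst (r₀ ⋖_) (proj₁ eqs) r₀⋖s₀)) ]′ (others u)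
      row-b : ∀ {e} → l <ᶻ e → e <ᶻ h → Common (b , e -ᶻ 1ℤ) (b , e)
      row-b = horizontal-b λ eqs → ⋖-asym a⋖b (subst (_⋖ s₀) (proj₁ eqs) r₀⋖s₀)
      loop : EqClosure Common sw se
      loop =
        inverse (path-≤ (<⇒≤-1 l<c₀) λ l<e e≤ →
          horizontal-a (ℤ.<⇒≢ (≤-1⇒< e≤) ∘ proj₂) l<e (ℤ.<-trans (≤-1⇒< e≤) c₀<h)) ◅◅
        return (verticalʳ (other barˡ)) ◅◅
        (path-≤ (<⇒≤-1 l<h) λ l<e e≤ → row-b l<e (≤-1⇒< e≤)) ◅◅
        inverse (return (verticalˡ (other barʳ))) ◅◅
        inverse (path-≤ (<⇒≤-1 c₀<h) λ c₀<e e≤ →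
          horizontal-a ((λ { refl → ℤ.<-irrefl refl c₀<e }) ∘ proj₂) (ℤ.<-trans l<c₀ c₀<e) (≤-1⇒< e≤))
      in-K : K sw × K se
      in-K = inside-K (inj₁ refl) l<c₀ c₀<h
      module S = Splice Common sw se nw ne {K = K} K? closed (proj₁ in-K) (proj₂ in-K) loop

-- Shape and values

x-2<x : ∀ x → x -ᶻ + 2 <ᶻ x
x-2<x x = ℤ.≤-<-trans (ℤ.+-monoʳ-≤ x (ℤ.-≤- z≤n)) (i-1<i x)

x-2k≤x-2 : ∀ x k → x +ᶻ + 2 *ᶻ -[1+ k ] ≤ᶻ x -ᶻ + 2
x-2k≤x-2 x k = ℤ.+-monoʳ-≤ x (ℤ.*-monoˡ-≤-nonNeg (+ 2) (ℤ.-≤- {k} {0} z≤n))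

module Values {n : ℕ} (μ ν : Vector ℕ n)
  (μ↓ : IsPartition μ) (μ₃ : NoThreeEqual μ) (ν↓ : IsPartition ν) (ν₃ : NoThreeEqual ν)
  (contained : ∀ r → ν r ≤ μ r) where
  open Shape μ ν
  open Strands μ ν

  private
    M : ℤ
    M = + (2 * ⌈ n /2⌉)

  start≤start : ∀ {r s} a b → a + (2 * ν s + rowNo s) ≤ b + (2 * ν r + rowNo r) → + a +ᶻ start s ≤ᶻ + b +ᶻ start r
  start≤start {r} {s} a b le = shift-≤ (eq (+ a) (+ b) (+ (2 * ν s + rowNo s)) (+ (2 * ν r + rowNo r)) M) (ℤ.+≤+ le)
    where
    eq : ∀ a b x y m → b +ᶻ (y -ᶻ m) -ᶻ (a +ᶻ (x -ᶻ m)) ≡ b +ᶻ y -ᶻ (a +ᶻ x)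
    eq = solve-∀

  end≤end : ∀ {r s} a b → a + (2 * μ s + rowNo s) ≤ b + (2 * μ r + rowNo r) → + a +ᶻ end s ≤ᶻ + b +ᶻ end r
  end≤end {r} {s} a b le = shift-≤ (eq (+ a) (+ b) (+ (2 * μ s + rowNo s)) (+ (2 * μ r + rowNo r)) M) (ℤ.+≤+ le)
    where
    eq : ∀ a b x y m → b +ᶻ (y -ᶻ m -ᶻ + 2) -ᶻ (a +ᶻ (x -ᶻ m -ᶻ + 2)) ≡ b +ᶻ y -ᶻ (a +ᶻ x)
    eq = solve-∀

  start-⋖-≡ : ∀ {r s} → r ⋖ s → ν s ≡ ν r → start s ≡ 1ℤ +ᶻ start r
  start-⋖-≡ {r} {s} r⋖s ν≡ rewrite r⋖s | ν≡ | ℕ.+-suc (2 * ν r) (rowNo r) = ℤ.+-assoc 1ℤ (+ (2 * ν r + rowNo r)) (ℤ.- M)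

  start-⋖-≢ : ∀ {r s} → r ⋖ s → ν s ≢ ν r → 1ℤ +ᶻ start s ≤ᶻ start r
  start-⋖-≢ {r} {s} r⋖s ν≢ = ℤ.≤-trans (start≤start {r} {s} 1 0 le) (ℤ.≤-reflexive (ℤ.+-identityˡ _))
    where
    eq : ∀ x y → 1 + (2 * x + suc y) ≡ 2 * suc x + y
    eq = ℕSolver.solve-∀
    le : 1 + (2 * ν s + rowNo s) ≤ 2 * ν r + rowNo r
    le rewrite r⋖s | eq (ν s) (rowNo r) =
      ℕ.+-monoˡ-≤ (rowNo r) (ℕ.*-monoʳ-≤ 2 (ℕ.≤∧≢⇒< (ν↓ (ℕ.<⇒≤ (⋖⇒< r⋖s))) ν≢))

  end-⋖-≡ : ∀ {r s} → r ⋖ s → μ r ≡ μ s → end s ≡ 1ℤ +ᶻ end r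
  end-⋖-≡ {r} {s} r⋖s μ≡ rewrite r⋖s | μ≡ | ℕ.+-suc (2 * μ s) (rowNo r) = eq (+ (2 * μ s + rowNo r)) M
    where
    eq : ∀ x m → 1ℤ +ᶻ x -ᶻ m -ᶻ + 2 ≡ 1ℤ +ᶻ (x -ᶻ m -ᶻ + 2)
    eq = solve-∀

  end-⋖-≢ : ∀ {r s} → r ⋖ s → μ r ≢ μ s → 1ℤ +ᶻ end s ≤ᶻ end r
  end-⋖-≢ {r} {s} r⋖s μ≢ = ℤ.≤-trans (end≤end {r} {s} 1 0 le) (ℤ.≤-reflexive (ℤ.+-identityˡ _))
    where
    eq : ∀ x y → 1 + (2 * x + suc y) ≡ 2 * suc x + y
    eq = ℕSolver.solve-∀
    le : 1 + (2 * μ s + rowNo s) ≤ 2 * μ r + rowNo r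
    le rewrite r⋖s | eq (μ s) (rowNo r) =
      ℕ.+-monoˡ-≤ (rowNo r) (ℕ.*-monoʳ-≤ 2 (ℕ.≤∧≢⇒< (μ↓ (ℕ.<⇒≤ (⋖⇒< r⋖s))) (μ≢ ∘ sym)))

  private
    two-rows : ∀ {x y z} → x ≤ y → ¬ (y ≡ z × z ≡ x) → z ≤ y → x ≤ z → ∀ k → 2 * x + suc (suc k) ≤ 2 * y + k
    two-rows {x} {y} {z} x≤y not-all z≤y x≤z k = ℕ.≤-trans (ℕ.≤-reflexive (eq x k)) (ℕ.+-monoˡ-≤ k (ℕ.*-monoʳ-≤ 2 (ℕ.≤∧≢⇒< x≤y x≢y)))
      where
      eq : ∀ x y → 2 * x + suc (suc y) ≡ 2 * suc x + y
      eq = ℕSolver.solve-∀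
      x≢y : x ≢ y
      x≢y refl = not-all (ℕ.≤-antisym x≤z z≤y , ℕ.≤-antisym z≤y x≤z)

  -- Without three equal parts ν drops by at least 1 over two rows. Doubled, this makes up for the
  -- row number growing by 2, so rows of equal parity form a skew shape.
  start-⋖⋖ : ∀ {r s u} → r ⋖ s → s ⋖ u → start u ≤ᶻ start r
  start-⋖⋖ {r} {s} {u} r⋖s s⋖u = shift-≤ refl′ (start≤start {r} {u} 0 0 le)
    where
    refl′ : start r -ᶻ start u ≡ + 0 +ᶻ start r -ᶻ (+ 0 +ᶻ start u)
    refl′ = sym (cong₂ _-ᶻ_ (ℤ.+-identityˡ (start r)) (ℤ.+-identityˡ (start u)))
    le : 2 * ν u + rowNo u ≤ 2 * ν r + rowNo r
    le = subst (λ k → 2 * ν u + k ≤ 2 * ν r + rowNo r) (sym (trans s⋖u (cong suc r⋖s))) (two-rows (ν↓ (ℕ.<⇒≤ (ℕ.<-trans (⋖⇒< r⋖s) (⋖⇒< s⋖u)))) (ν₃ (⋖⇒< r⋖s) (⋖⇒< s⋖u))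
      (ν↓ (ℕ.<⇒≤ (⋖⇒< r⋖s))) (ν↓ (ℕ.<⇒≤ (⋖⇒< s⋖u))) (rowNo r))

  end-⋖⋖ : ∀ {r s u} → r ⋖ s → s ⋖ u → end u ≤ᶻ end r
  end-⋖⋖ {r} {s} {u} r⋖s s⋖u = shift-≤ refl′ (end≤end {r} {u} 0 0 le)
    where
    refl′ : end r -ᶻ end u ≡ + 0 +ᶻ end r -ᶻ (+ 0 +ᶻ end u)
    refl′ = sym (cong₂ _-ᶻ_ (ℤ.+-identityˡ (end r)) (ℤ.+-identityˡ (end u)))
    le : 2 * μ u + rowNo u ≤ 2 * μ r + rowNo r
    le = subst (λ k → 2 * μ u + k ≤ 2 * μ r + rowNo r) (sym (trans s⋖u (cong suc r⋖s))) (two-rows (μ↓ (ℕ.<⇒≤ (ℕ.<-trans (⋖⇒< r⋖s) (⋖⇒< s⋖u)))) (μ₃ (⋖⇒< r⋖s) (⋖⇒< s⋖u))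
      (μ↓ (ℕ.<⇒≤ (⋖⇒< r⋖s))) (μ↓ (ℕ.<⇒≤ (⋖⇒< s⋖u))) (rowNo r))

  p-cases : ∀ r → ((∃[ s ] (s ⋖ r × ν s ≡ ν r)) × p r ≡ start r -ᶻ + 2) ⊎
                  (¬ (∃[ s ] (s ⋖ r × ν s ≡ ν r)) × p r ≡ start r -ᶻ + 1)
  p-cases r with Fin.any? (λ s → (s ⋖? r) ×-dec (ν s ℕ.≟ ν r))
  ... | yes y = inj₁ (y , refl)
  ... | no ¬y = inj₂ (¬y , refl)

  q-cases : ∀ r → ((∃[ s ] (r ⋖ s × μ r ≡ μ s)) × q r ≡ end r +ᶻ + 2) ⊎
                  (¬ (∃[ s ] (r ⋖ s × μ r ≡ μ s)) × q r ≡ end r +ᶻ + 1)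
  q-cases r with Fin.any? (λ s → (r ⋖? s) ×-dec (μ r ℕ.≟ μ s))
  ... | yes y = inj₁ (y , refl)
  ... | no ¬y = inj₂ (¬y , refl)

  p≤start-1 : ∀ r → p r ≤ᶻ start r -ᶻ 1ℤ
  p≤start-1 r with p-cases r
  ... | inj₁ (_ , eq) = ℤ.≤-trans (ℤ.≤-reflexive eq) (ℤ.+-monoʳ-≤ (start r) (ℤ.-≤- z≤n))
  ... | inj₂ (_ , eq) = ℤ.≤-reflexive eq

  end+1≤q : ∀ r → end r +ᶻ 1ℤ ≤ᶻ q r
  end+1≤q r with q-cases r
  ... | inj₁ (_ , eq) = ℤ.≤-trans (ℤ.+-monoʳ-≤ (end r) (ℤ.+≤+ (s≤s z≤n))) (ℤ.≤-reflexive (sym eq))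
  ... | inj₂ (_ , eq) = ℤ.≤-reflexive (sym eq)

  -- If ν does not drop from `r` to `s`, row `s` starts one column to the right of row `r`. The
  -- second extra column that `p s` then has is exactly what a crossing at `start r` needs. The same
  -- happens with `q r` when μ does not drop.
  replaced-site : ∀ {T r s c} → Replaced T r s c → Site r s c
  replaced-site {T} {r} {s} {c} u = record
    { adjacent = adjacent
    ; parity   = parity
    ; p-upper  = ℤ.≤-trans (p≤start-1 r) start-1≤
    ; q-upper  = ℤ.≤-trans upper (end+1≤q-upper (μ r ℕ.≟ μ s))
    ; p-lower  = ℤ.≤-trans (p≤start-1-upper (ν s ℕ.≟ ν r)) start-1≤
    ; q-lower  = ℤ.≤-trans upper (end+1≤q s)
    }
    where
    open Replaced u
    start-1≤ : start r -ᶻ 1ℤ ≤ᶻ c -ᶻ 1ℤ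
    start-1≤ = ℤ.+-monoˡ-≤ _ lower
    p≤start-1-upper : Dec (ν s ≡ ν r) → p s ≤ᶻ start r -ᶻ 1ℤ
    p≤start-1-upper (no ν≢) = ℤ.≤-trans (p≤start-1 s)
      (ℤ.+-monoˡ-≤ _ (ℤ.≤-trans (ℤ.i≤suc[i] (start s)) (start-⋖-≢ adjacent ν≢)))
    p≤start-1-upper (yes ν≡) with p-cases s
    ... | inj₂ (¬y , _) = contradiction (r , adjacent , sym ν≡) ¬y
    ... | inj₁ (_ , eq) = ℤ.≤-reflexive (trans eq (trans (cong (_-ᶻ + 2) (start-⋖-≡ adjacent ν≡)) (eq′ (start r))))
      where
      eq′ : ∀ x → 1ℤ +ᶻ x -ᶻ + 2 ≡ x -ᶻ 1ℤ
      eq′ = solve-∀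
    end+1≤q-upper : Dec (μ r ≡ μ s) → end s +ᶻ 1ℤ ≤ᶻ q r
    end+1≤q-upper (no μ≢) = ℤ.≤-trans
      (ℤ.+-monoˡ-≤ _ (ℤ.≤-trans (ℤ.i≤suc[i] (end s)) (end-⋖-≢ adjacent μ≢))) (end+1≤q r)
    end+1≤q-upper (yes μ≡) with q-cases r
    ... | inj₂ (¬y , _) = contradiction (s , adjacent , μ≡) ¬y
    ... | inj₁ (_ , eq) = ℤ.≤-reflexive (trans (cong (_+ᶻ 1ℤ) (end-⋖-≡ adjacent μ≡)) (trans (eq′ (end r)) (sym eq)))
      where
      eq′ : ∀ x → 1ℤ +ᶻ x +ᶻ 1ℤ ≡ x +ᶻ + 2
      eq′ = solve-∀

  start-≡ : ∀ r → start r ≡ + 2 *ᶻ + ν r +ᶻ + rowNo r -ᶻ + 2 *ᶻ + ⌈ n /2⌉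
  start-≡ r = cong₂ _-ᶻ_ (trans (ℤ.pos-+ (2 * ν r) (rowNo r)) (cong (_+ᶻ + rowNo r) (ℤ.pos-* 2 (ν r)))) (ℤ.pos-* 2 ⌈ n /2⌉)

  end-≡ : ∀ r → end r ≡ start r +ᶻ + (2 * (μ r ∸ ν r)) -ᶻ + 2
  end-≡ r = cong (_-ᶻ + 2) (trans (cong (λ m → + (2 * m + rowNo r) -ᶻ M) (sym (ℕ.m+[n∸m]≡n (contained r))))
    (trans (cong (λ m → + m -ᶻ M) (eq (ν r) (μ r ∸ ν r) (rowNo r)))
      (eq′ (+ (2 * ν r + rowNo r)) (+ (2 * (μ r ∸ ν r))) M)))
    where
    eq : ∀ x y z → 2 * (x + y) + z ≡ (2 * x + z) + 2 * y
    eq = ℕSolver.solve-∀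
    eq′ : ∀ x y m → x +ᶻ y -ᶻ m ≡ x -ᶻ m +ᶻ y
    eq′ = solve-∀

  -- With half the change of `c - rowNo r` given as `k`, every transfer of parity becomes a ring
  -- identity.
  parity-shift : ∀ {r s c e} k → e -ᶻ + rowNo s ≡ (c -ᶻ + rowNo r) +ᶻ k *ᶻ + 2 → SameParity r c → SameParity s e
  parity-shift {r} {s} {c} {e} k eq rc = Signed.∣⇒∣ᵤ {+ 2} {e -ᶻ + rowNo s} (subst (+ 2 Signed.∣_) (sym eq)
    (Signed.∣m∣n⇒∣m+n (Signed.∣ᵤ⇒∣ {+ 2} {c -ᶻ + rowNo r} rc) (Signed.divides k refl)))

  parity-below : ∀ {r s c} → r ⋖ s → SameParity r c → SameParity s (c -ᶻ 1ℤ)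
  parity-below {r} {s} {c} r⋖s = parity-shift {r} {s} {c} {c -ᶻ 1ℤ} ℤ.-1ℤ
    (trans (cong (λ x → c -ᶻ 1ℤ -ᶻ + x) r⋖s) (eq c (+ rowNo r)))
    where
    eq : ∀ c x → c -ᶻ 1ℤ -ᶻ (1ℤ +ᶻ x) ≡ c -ᶻ x +ᶻ ℤ.-1ℤ *ᶻ + 2
    eq = solve-∀

  parity-⋖⋖ : ∀ {r s u c} → r ⋖ s → s ⋖ u → SameParity r c → SameParity u c
  parity-⋖⋖ {r} {s} {u} {c} r⋖s s⋖u = parity-shift {r} {u} {c} {c} ℤ.-1ℤ
    (trans (cong (λ x → c -ᶻ + x) (trans s⋖u (cong suc r⋖s))) (eq c (+ rowNo r)))
    where
    eq : ∀ c x → c -ᶻ (+ 2 +ᶻ x) ≡ c -ᶻ x +ᶻ ℤ.-1ℤ *ᶻ + 2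
    eq = solve-∀

  parity-coordinate : ∀ {r c} → SameParity r c → ∃[ z ] c ≡ start r +ᶻ + 2 *ᶻ z
  parity-coordinate {r} {c} rc with Signed.∣ᵤ⇒∣ {+ 2} {c -ᶻ + rowNo r} rc
  ... | Signed.divides k eq = k -ᶻ + ν r +ᶻ + ⌈ n /2⌉ ,
    trans (eq₁ c (+ rowNo r)) (trans (cong (_+ᶻ + rowNo r) eq)
      (trans (eq₂ k (+ rowNo r) (+ ν r) (+ ⌈ n /2⌉)) (cong (_+ᶻ + 2 *ᶻ (k -ᶻ + ν r +ᶻ + ⌈ n /2⌉)) (sym (start-≡ r)))))
    where
    eq₁ : ∀ c x → c ≡ c -ᶻ x +ᶻ x
    eq₁ = solve-∀
    eq₂ : ∀ k x v m → k *ᶻ + 2 +ᶻ x ≡ + 2 *ᶻ v +ᶻ x -ᶻ + 2 *ᶻ m +ᶻ + 2 *ᶻ (k -ᶻ v +ᶻ m)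
    eq₂ = solve-∀

  coordinate-parity : ∀ {r} k → SameParity r (start r +ᶻ + (2 * k))
  coordinate-parity {r} k = Signed.∣⇒∣ᵤ {+ 2} {start r +ᶻ + (2 * k) -ᶻ + rowNo r} (Signed.divides (+ ν r -ᶻ + ⌈ n /2⌉ +ᶻ + k)
    (trans (cong₂ (λ x y → x +ᶻ y -ᶻ + rowNo r) (start-≡ r) (ℤ.pos-* 2 k)) (eq (+ rowNo r) (+ ν r) (+ ⌈ n /2⌉) (+ k))))
    where
    eq : ∀ x v m k → + 2 *ᶻ v +ᶻ x -ᶻ + 2 *ᶻ m +ᶻ + 2 *ᶻ k -ᶻ x ≡ (v -ᶻ m +ᶻ k) *ᶻ + 2
    eq = solve-∀

  square-parity : ∀ s → SameParity (row s) (col s)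
  square-parity (r , k) = coordinate-parity (toℕ k)

  start≤col : ∀ s → start (row s) ≤ᶻ col s
  start≤col (r , k) = ℤ.i≤i+j (start r) (+ (2 * toℕ k))

  col≤ : ∀ {r k} {l : ℕ} → toℕ k ≤ l → col (r , k) ≤ᶻ start r +ᶻ + (2 * l)
  col≤ {r} k≤l = ℤ.+-monoʳ-≤ (start r) (ℤ.+≤+ (ℕ.*-monoʳ-≤ 2 k≤l))

  col≤⁻¹ : ∀ {r k l} → col (r , k) ≤ᶻ col (r , l) → toℕ k ≤ toℕ l
  col≤⁻¹ {r} {k} {l} le = ℕ.*-cancelˡ-≤ 2 (ℤ.drop‿+≤+ (shift-≤ (eq (start r) (+ (2 * toℕ k)) (+ (2 * toℕ l))) le))
    where
    eq : ∀ s x y → y -ᶻ x ≡ s +ᶻ y -ᶻ (s +ᶻ x)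
    eq = solve-∀

  col-injective : ∀ {r k l} → col (r , k) ≡ col (r , l) → k ≡ l
  col-injective eq = Fin.toℕ-injective (ℕ.≤-antisym (col≤⁻¹ (ℤ.≤-reflexive eq)) (col≤⁻¹ (ℤ.≤-reflexive (sym eq))))

  col≤end : ∀ s → col s ≤ᶻ end (row s)
  col≤end (r , k) = ℤ.≤-trans
    (shift-≤ (eq (start r) (+ (2 * toℕ k)) (+ (2 * (μ r ∸ ν r)))) (ℤ.+-monoʳ-≤ (start r) (ℤ.+≤+ (ℕ.≤-trans (ℕ.≤-reflexive (sym (ℕ.*-suc 2 (toℕ k)))) (ℕ.*-monoʳ-≤ 2 (Fin.toℕ<n k))))))
    (ℤ.≤-reflexive (sym (end-≡ r)))
    where
    eq : ∀ s k e → s +ᶻ e -ᶻ + 2 -ᶻ (s +ᶻ k) ≡ s +ᶻ e -ᶻ (s +ᶻ (+ 2 +ᶻ k))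
    eq = solve-∀

  -- The second inequalities keep the outer cases apart even in an empty row. There `end r` is
  -- `start r - 2`, and no column of the right parity lies strictly between the two.
  data Location (r : Fin n) (c : ℤ) : Set where
    before : c <ᶻ start r → c ≤ᶻ end r → Location r c
    within : ∀ k → c ≡ col (r , k) → Location r c
    after  : end r <ᶻ c → start r ≤ᶻ c → Location r c

  start-2≤end : ∀ r → start r -ᶻ + 2 ≤ᶻ end r
  start-2≤end r = ℤ.≤-trans (ℤ.+-monoˡ-≤ _ (ℤ.i≤i+j (start r) (+ (2 * (μ r ∸ ν r))))) (ℤ.≤-reflexive (sym (end-≡ r)))

  locate : ∀ {r c} → SameParity r c → Location r c
  locate {r} {c} rc = go (proj₁ (parity-coordinate {r} {c} rc)) (proj₂ (parity-coordinate {r} {c} rc))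
    where
    go : ∀ z → c ≡ start r +ᶻ + 2 *ᶻ z → Location r c
    go -[1+ k ] eq = before (ℤ.≤-<-trans c≤start-2 (x-2<x (start r))) (ℤ.≤-trans c≤start-2 (start-2≤end r))
      where
      c≤start-2 : c ≤ᶻ start r -ᶻ + 2
      c≤start-2 = ℤ.≤-trans (ℤ.≤-reflexive eq) (x-2k≤x-2 (start r) k)
    go (+ k) eq = go′ (k ℕ.<? (μ r ∸ ν r))
      where
      eq′ : c ≡ start r +ᶻ + (2 * k)
      eq′ = trans eq (cong (start r +ᶻ_) (sym (ℤ.pos-* 2 k)))
      go′ : Dec (k < μ r ∸ ν r) → Location r c
      go′ (yes k<) = within (fromℕ< k<) (trans eq′ (cong (λ x → start r +ᶻ + (2 * x)) (sym (Fin.toℕ-fromℕ< k<))))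
      go′ (no k≮)  = after
        (ℤ.≤-<-trans (ℤ.≤-reflexive (end-≡ r)) (ℤ.<-≤-trans (x-2<x (start r +ᶻ + (2 * (μ r ∸ ν r))))
          (ℤ.≤-trans (ℤ.+-monoʳ-≤ (start r) (ℤ.+≤+ (ℕ.*-monoʳ-≤ 2 (ℕ.≮⇒≥ k≮)))) (ℤ.≤-reflexive (sym eq′)))))
        (ℤ.≤-trans (ℤ.i≤i+j (start r) (+ (2 * k))) (ℤ.≤-reflexive (sym eq′)))

  -- Replaced T r s c holds exactly when some t has (r , c) at least t and
  -- (s , c - 1) not at least t + 1; this avoids computing with values ±∞.
  data AtLeast (T : Filling) (t : ℕ) (r : Fin n) (c : ℤ) : Set where
    inside : ∀ k → c ≡ col (r , k) → t ≤ T (r , k) → AtLeast T t r c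
    beyond : SameParity r c → end r <ᶻ c → AtLeast T t r c

  atLeast? : ∀ T t r c → Dec (AtLeast T t r c)
  atLeast? T t r c = Dec.map′ to from
    (Fin.any? (λ k → (c ℤ.≟ col (r , k)) ×-dec (t ℕ.≤? T (r , k))) ⊎-dec
     ((2 ∣? ℤ.∣ c -ᶻ + rowNo r ∣) ×-dec (end r ℤ.<? c)))
    where
    to : (∃[ k ] (c ≡ col (r , k) × t ≤ T (r , k))) ⊎ (SameParity r c × end r <ᶻ c) → AtLeast T t r c
    to (inj₁ (k , eq , le)) = inside k eq le
    to (inj₂ (par , lt))    = beyond par lt
    from : AtLeast T t r c → (∃[ k ] (c ≡ col (r , k) × t ≤ T (r , k))) ⊎ (SameParity r c × end r <ᶻ c)
    from (inside k eq le) = inj₁ (k , eq , le)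
    from (beyond par lt)  = inj₂ (par , lt)

  module _ {T : Filling} where

    at-parity : ∀ {t r c} → AtLeast T t r c → SameParity r c
    at-parity {r = r} (inside k refl _) = square-parity (r , k)
    at-parity (beyond par _)    = par

    start≤at : ∀ {t r c} → AtLeast T t r c → start r ≤ᶻ c
    start≤at {r = r} (inside k refl _) = start≤col (r , k)
    start≤at {r = r} {c} (beyond par lt) with locate {r} {c} par
    ... | before _ c≤end = contradiction c≤end (ℤ.<⇒≱ lt)
    ... | within k refl = start≤col (r , k)
    ... | after _ le     = le

    lower-threshold : ∀ {t t′ r c} → t ≤ t′ → AtLeast T t′ r c → AtLeast T t r c
    lower-threshold t≤t′ (inside k eq le) = inside k eq (ℕ.≤-trans t≤t′ le)
    lower-threshold t≤t′ (beyond par lt)  = beyond par lt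

    at-square : ∀ {t r k} → AtLeast T t r (col (r , k)) → t ≤ T (r , k)
    at-square {r = r} {k} (inside l eq le) with col-injective {r} {k} {l} eq
    ... | refl = le
    at-square {r = r} {k} (beyond _ lt) = contradiction (col≤end (r , k)) (ℤ.<⇒≱ lt)

    -- The value +∞ passes every threshold, so failing the next one leaves only a square with that
    -- entry.
    exact : ∀ {t r c} → AtLeast T t r c → ¬ AtLeast T (suc t) r c → ∃[ k ] (c ≡ col (r , k) × T (r , k) ≡ t)
    exact (beyond par lt)  ¬at = contradiction (beyond par lt) ¬at
    exact {t} {r} {c} (inside k eq le) ¬at with ℕ.m≤n⇒m<n∨m≡n le
    ... | inj₁ t<T = contradiction (inside k eq t<T) ¬at
    ... | inj₂ t≡T = k , eq , sym t≡T

    value-at-least : ∀ {t r c v} → AtLeast T t r c → Value T r c v → [ t ] ≤± v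
    value-at-least at (square k refl)  = Ext.[ at-square at ]
    value-at-least at (left _ c<start) = contradiction (start≤at at) (ℤ.<⇒≱ c<start)
    value-at-least at (right _ _)      = _ ≤⊤±

    at-least-value : ∀ {t r c v} → Value T r c v → [ t ] ≤± v → AtLeast T t r c
    at-least-value (square k eq)     le = inside k eq ([≤]-injective le)
    at-least-value (left _ _)              Sup.[ () ]
    at-least-value (right par end<c)       le = beyond par end<c

    value-of : ∀ {t r c} → AtLeast T t r c → ∃[ v ] (Value T r c v × [ t ] ≤± v)
    value-of (inside k eq le) = _ , square k eq , Ext.[ le ]
    value-of (beyond par lt)  = _ , right par lt , _ ≤⊤±

    value-below : ∀ {t r c} → SameParity r c → ¬ AtLeast T (suc t) r c → c ≤ᶻ end r × ∃[ v ] (Value T r c v × v ≤± [ t ])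
    value-below {t} {r} {c} par ¬at with locate {r} {c} par
    ... | before lt le = le , _ , left par lt , ⊥±≤ _
    ... | within k refl = col≤end (r , k) , _ , square k refl ,
                         Ext.[ ℕ.≮⇒≥ (λ t<T → ¬at (inside k refl t<T)) ]
    ... | after lt _   = contradiction (beyond par lt) ¬at

    -- The two bounds in `Replaced` come for free: reaching a threshold rules out -∞ at `(r , c)`,
    -- and missing one rules out +∞ at `(s , c - 1)`. The column `e` is kept apart from `c - 1` for
    -- crossings at `c + 1`, where it is `c` only up to a ring identity.
    cross : ∀ {t r s c e} → r ⋖ s → e ≡ c -ᶻ 1ℤ → AtLeast T t r c → ¬ AtLeast T (suc t) s e → Replaced T r s c
    cross {t} {r} {s} {c} r⋖s refl at ¬at = go (value-of at) (value-below (parity-below {r} {s} {c} r⋖s (at-parity at)) ¬at)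
      where
      eq : ∀ c x → x +ᶻ 1ℤ -ᶻ c ≡ x -ᶻ (c -ᶻ 1ℤ)
      eq = solve-∀
      go : ∃[ v ] (Value T r c v × [ t ] ≤± v) →
           c -ᶻ 1ℤ ≤ᶻ end s × ∃[ u ] (Value T s (c -ᶻ 1ℤ) u × u ≤± [ t ]) → Replaced T r s c
      go (v , upper , t≤v) (le , u , lower , u≤t) = record
        { adjacent = r⋖s
        ; parity   = at-parity at
        ; lower    = start≤at at
        ; upper    = shift-≤ {i = c -ᶻ 1ℤ} {j = end s} {x = c} {y = end s +ᶻ 1ℤ} (eq c (end s)) le
        ; values   = u , v , lower , upper , ≤±-trans ℕ.≤-trans u≤t t≤v
        }

    no-cross : ∀ {t r s c e} → e ≡ c -ᶻ 1ℤ → AtLeast T t s e → ¬ AtLeast T t r c → ¬ Replaced T r s c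
    no-cross refl at ¬at u with Replaced.values u
    ... | _ , _ , lower , upper , le = ¬at (at-least-value upper (≤±-trans ℕ.≤-trans (value-at-least at lower) le))

  module Monotone (tableau : ShuffleTableau) where
    open ShuffleTableau tableau using (rows; columns) renaming (entry to T)

    rightward : ∀ {t r c e} → AtLeast T t r c → c ≤ᶻ e → SameParity r e → AtLeast T t r e
    rightward (beyond _ lt) c≤e par = beyond par (ℤ.<-≤-trans lt c≤e)
    rightward {t} {r} {c} {e} at@(inside k refl le) c≤e par with locate {r} {e} par
    ... | before lt _ = contradiction (ℤ.≤-trans (start≤at at) c≤e) (ℤ.<⇒≱ lt)
    ... | within l refl   = inside l refl (ℕ.≤-trans le (rows (r , k) (r , l) refl c≤e))
    ... | after lt _  = beyond par lt

    -- Between squares this is strictness in the column. If `(u , c)` is not a square, `start-⋖⋖`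
    -- and `end-⋖⋖` leave only the side to the right of row `u`, where the value is +∞.
    downward : ∀ {t r s u c} → r ⋖ s → s ⋖ u → AtLeast T t r c → AtLeast T (suc t) u c
    downward {t} {r} {s} {u} {c} r⋖s s⋖u at = go at (locate {u} {c} par)
      where
      par : SameParity u c
      par = parity-⋖⋖ {r} {s} {u} {c} r⋖s s⋖u (at-parity at)
      r<u : toℕ r < toℕ u
      r<u = ℕ.<-trans {toℕ r} {toℕ s} {toℕ u} (⋖⇒< r⋖s) (⋖⇒< s⋖u)
      go : AtLeast T t r c → Location u c → AtLeast T (suc t) u c
      go (beyond _ end<c) _ = beyond par (ℤ.≤-<-trans (end-⋖⋖ {r} {s} {u} r⋖s s⋖u) end<c)
      go (inside _ _ _) (before c<start _) = contradiction (ℤ.≤-trans (start-⋖⋖ {r} {s} {u} r⋖s s⋖u) (start≤at at)) (ℤ.<⇒≱ c<start)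
      go (inside k eq t≤) (within l eq′)   = inside l eq′ (ℕ.≤-<-trans t≤ (columns (r , k) (u , l) (trans (sym eq) eq′) r<u))
      go (inside _ _ _) (after end<c _)    = beyond par end<c

-- Bracket words

-- Squares outside the word become `neither` instead of being filtered out. The bracket words of all
-- fillings then run over the one list `squares`, which splits into rows and does not depend on the
-- filling.
data Letter : Set where
  opening closing neither : Letter

letterOf : {P Q : Set} → Dec P → Dec Q → Letter
letterOf p? q? = if does p? then (if does q? then opening else closing) else neither

letterOf-opening : ∀ {P Q : Set} (p? : Dec P) (q? : Dec Q) → P → Q → letterOf p? q? ≡ opening
letterOf-opening (yes _) (yes _) p q = refl
letterOf-opening (yes _) (no ¬q) p q = contradiction q ¬q
letterOf-opening (no ¬p) _       p q = contradiction p ¬p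

letterOf-closing : ∀ {P Q : Set} (p? : Dec P) (q? : Dec Q) → P → ¬ Q → letterOf p? q? ≡ closing
letterOf-closing (yes _) (yes q) p ¬q = contradiction q ¬q
letterOf-closing (yes _) (no _)  p ¬q = refl
letterOf-closing (no ¬p) _       p ¬q = contradiction p ¬p

opening-letterOf : ∀ {P Q : Set} (p? : Dec P) (q? : Dec Q) → letterOf p? q? ≡ opening → P × Q
opening-letterOf (yes p) (yes q) refl = p , q

closing-letterOf : ∀ {P Q : Set} (p? : Dec P) (q? : Dec Q) → letterOf p? q? ≡ closing → P × ¬ Q
closing-letterOf (yes p) (no ¬q) refl = p , ¬q

letterOf-⇔ : ∀ {P Q P′ Q′ : Set} (p? : Dec P) (q? : Dec Q) (p′? : Dec P′) (q′? : Dec Q′) →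
             (P → P′) × (P′ → P) → (Q → Q′) × (Q′ → Q) → letterOf p? q? ≡ letterOf p′? q′?
letterOf-⇔ (yes _) (yes _) (yes _) (yes _) _ _ = refl
letterOf-⇔ (yes _) (no _)  (yes _) (no _)  _ _ = refl
letterOf-⇔ (yes _) (yes q) (yes _) (no ¬q) _ (to , _)   = contradiction (to q) ¬q
letterOf-⇔ (yes _) (no ¬q) (yes _) (yes q) _ (_ , from) = contradiction (from q) ¬q
letterOf-⇔ (no _)  _       (no _)  _       _ _ = refl
letterOf-⇔ (yes p) _       (no ¬p) _       (to , _) _   = contradiction (to p) ¬p
letterOf-⇔ (no ¬p) _       (yes p) _       (_ , from) _ = contradiction (from p) ¬p

module Brackets {A : Set} (letter : A → Letter) where

  Stacks : Set
  Stacks = List A × List A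

  act : Letter → A → Stacks → Stacks
  act opening x (cs , os)     = cs , x ∷ os
  act closing x (cs , [])     = x ∷ cs , []
  act closing x (cs , _ ∷ os) = cs , os
  act neither x st            = st

  step : Stacks → A → Stacks
  step st x = act (letter x) x st

  shift-depth : Letter → ℕ → ℕ
  shift-depth opening d = suc d
  shift-depth closing d = pred d
  shift-depth neither d = d

  depth : ℕ → List A → ℕ
  depth d []       = d
  depth d (x ∷ xs) = depth (shift-depth (letter x) d) xs

  -- Started with d pending openings, every closing finds a partner.
  Closes : Letter → ℕ → Set
  Closes closing zero = ⊥
  Closes _       _    = ⊤

  NoUnderflow : ℕ → List A → Set
  NoUnderflow d []       = ⊤
  NoUnderflow d (x ∷ xs) = Closes (letter x) d × NoUnderflow (shift-depth (letter x) d) xs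

  length-step : ∀ st x → length (proj₂ (step st x)) ≡ shift-depth (letter x) (length (proj₂ st))
  length-step (cs , os) x with letter x
  ... | opening = refl
  ... | neither = refl
  length-step (cs , [])     x | closing = refl
  length-step (cs , _ ∷ os) x | closing = refl

  length-foldl : ∀ st xs → length (proj₂ (foldl step st xs)) ≡ depth (length (proj₂ st)) xs
  length-foldl st []       = refl
  length-foldl st (x ∷ xs) = trans (length-foldl (step st x) xs) (cong (λ d → depth d xs) (length-step st x))

  depth-++ : ∀ d xs ys → depth d (xs ++ ys) ≡ depth (depth d xs) ys
  depth-++ d []       ys = refl
  depth-++ d (x ∷ xs) ys = depth-++ (shift-depth (letter x) d) xs ys

  depth-opening : ∀ {d xs} → All (λ x → letter x ≡ opening) xs → depth d xs ≡ length xs + d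
  depth-opening []                    = refl
  depth-opening {d} {x ∷ xs} (eq ∷ h) rewrite eq = trans (depth-opening h) (ℕ.+-suc (length xs) d)

  ≤-depth : ∀ {d} xs → d ≤ depth d xs + length xs
  ≤-depth {d} []       = ℕ.m≤m+n d 0
  ≤-depth {d} (x ∷ xs) = ℕ.≤-trans (drop-≤ (letter x)) (ℕ.≤-trans (s≤s (≤-depth xs)) (ℕ.≤-reflexive (sym (ℕ.+-suc _ _))))
    where
    drop-≤ : ∀ l → d ≤ suc (shift-depth l d)
    drop-≤ opening = ℕ.m≤n+m d 2
    drop-≤ closing = ℕ.m≤n+m∸n d 1
    drop-≤ neither = ℕ.n≤1+n d

  depth-no-closing : ∀ {d xs} → All (λ x → letter x ≢ closing) xs → d ≤ depth d xs
  depth-no-closing []                = ℕ.≤-refl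
  depth-no-closing {d} {x ∷ xs} (l≢ ∷ h) = ℕ.≤-trans (grow (letter x) l≢) (depth-no-closing h)
    where
    grow : ∀ l → l ≢ closing → d ≤ shift-depth l d
    grow opening _  = ℕ.n≤1+n d
    grow closing l≢ = contradiction refl l≢
    grow neither _  = ℕ.≤-refl

  depth-no-opening : ∀ {d xs} → All (λ x → letter x ≢ opening) xs → depth d xs ≤ d
  depth-no-opening []                = ℕ.≤-refl
  depth-no-opening {d} {x ∷ xs} (l≢ ∷ h) = ℕ.≤-trans (depth-no-opening h) (shrink (letter x) l≢)
    where
    shrink : ∀ l → l ≢ opening → shift-depth l d ≤ d
    shrink opening l≢ = contradiction refl l≢
    shrink closing _  = ℕ.pred[n]≤n
    shrink neither _  = ℕ.≤-refl

  depth-≤ : ∀ {d} xs → depth d xs ≤ length xs + d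
  depth-≤ {d} []       = ℕ.≤-refl
  depth-≤ {d} (x ∷ xs) = ℕ.≤-trans (depth-≤ xs)
    (ℕ.≤-trans (ℕ.+-monoʳ-≤ (length xs) (grow (letter x))) (ℕ.≤-reflexive (ℕ.+-suc (length xs) d)))
    where
    grow : ∀ l → shift-depth l d ≤ suc d
    grow opening = ℕ.≤-refl
    grow closing = ℕ.≤-trans ℕ.pred[n]≤n (ℕ.n≤1+n d)
    grow neither = ℕ.n≤1+n d

  no-underflow-++ˡ : ∀ {d} xs {ys} → NoUnderflow d (xs ++ ys) → NoUnderflow d xs
  no-underflow-++ˡ []       _       = tt
  no-underflow-++ˡ (x ∷ xs) (c , h) = c , no-underflow-++ˡ xs h

  no-underflow-++ʳ : ∀ {d} xs {ys} → NoUnderflow d (xs ++ ys) → NoUnderflow (depth d xs) ys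
  no-underflow-++ʳ []       h       = h
  no-underflow-++ʳ (x ∷ xs) (_ , h) = no-underflow-++ʳ xs h

  no-underflow-closing : ∀ {d xs} → All (λ x → letter x ≡ closing) xs → NoUnderflow d xs → length xs ≤ d
  no-underflow-closing [] _ = z≤n
  no-underflow-closing {zero}  (eq ∷ _) (c , _) rewrite eq = contradiction c id
  no-underflow-closing {suc d} (eq ∷ h) (_ , n) rewrite eq = s≤s (no-underflow-closing h n)

  last-∷-≢ : ∀ {x y : A} {ys} → y ≢ x → last ys ≢ just x → last (y ∷ ys) ≢ just x
  last-∷-≢ {ys = []}     y≢x _  refl = y≢x refl
  last-∷-≢ {ys = _ ∷ ys} _   ≢x eq   = ≢x eq

  last-tail-≢ : ∀ {x y : A} ys → last (y ∷ ys) ≢ just x → last ys ≢ just x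
  last-tail-≢ []      _  ()
  last-tail-≢ (_ ∷ _) ≢x eq = ≢x eq

  step-last-≢ : ∀ {x} st {y} → y ≢ x → last (proj₂ st) ≢ just x → last (proj₂ (step st y)) ≢ just x
  step-last-≢ (cs , os) {y} y≢x ≢x with letter y
  ... | opening = last-∷-≢ {ys = os} y≢x ≢x
  ... | neither = ≢x
  step-last-≢ (cs , [])     y≢x ≢x | closing = ≢x
  step-last-≢ (cs , _ ∷ os) y≢x ≢x | closing = last-tail-≢ os ≢x

  foldl-last-≢ : ∀ {x} st ys → All (_≢ x) ys → last (proj₂ st) ≢ just x → last (proj₂ (foldl step st ys)) ≢ just x
  foldl-last-≢ st []       []           ≢x = ≢x
  foldl-last-≢ st (y ∷ ys) (y≢x ∷ ys≢x) ≢x = foldl-last-≢ (step st y) ys ys≢x (step-last-≢ st y≢x ≢x)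

  -- If a closing consumed the bottom opening, the stack would be rebuilt from later letters only,
  -- none of which is `x`. So closings have just the `length os` openings above the bottom at their
  -- disposal.
  last-no-underflow : ∀ {x} cs o os ys → All (_≢ x) ys → last (proj₂ (foldl step (cs , o ∷ os) ys)) ≡ just x →
                      NoUnderflow (length os) ys
  last-no-underflow cs o os [] _ _ = tt
  last-no-underflow cs o os (y ∷ ys) (y≢x ∷ ys≢x) eq with letter y
  ... | opening = tt , last-no-underflow cs y (o ∷ os) ys ys≢x eq
  ... | neither = tt , last-no-underflow cs o os ys ys≢x eq
  last-no-underflow cs o [] (y ∷ ys) (y≢x ∷ ys≢x) eq | closing =
    contradiction eq (foldl-last-≢ (cs , []) ys ys≢x λ ())
  last-no-underflow cs o (o′ ∷ os) (y ∷ ys) (y≢x ∷ ys≢x) eq | closing =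
    tt , last-no-underflow cs o′ os ys ys≢x eq

  -- No opening before x and no closing after x has to be matched across x.
  record Isolated (x : A) (u v : List A) : Set where
    field
      exhausted    : depth 0 u ≡ 0
      no-underflow : NoUnderflow 0 v

  -- To end at the bottom of the stack, `x` must be pushed onto an empty one: unless it is at the
  -- bottom right after being read, later letters never bring it there.
  leftmost-opening : ∀ {x} u v → All (_≢ x) u → All (_≢ x) v →
    last (proj₂ (foldl step ([] , []) (u ++ x ∷ v))) ≡ just x → letter x ≡ opening × Isolated x u v
  leftmost-opening {x} u v u≢x v≢x eq with foldl step ([] , []) u | foldl-last-≢ ([] , []) u u≢x (λ ()) | length-foldl ([] , []) u | List.foldl-++ step ([] , []) u (x ∷ v)
  ... | cs , os | ≢x | len | split rewrite split with letter x in letter≡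
  leftmost-opening {x} u v u≢x v≢x eq | cs , os | ≢x | len | split | neither =
    contradiction eq (foldl-last-≢ (cs , os) v v≢x ≢x)
  leftmost-opening {x} u v u≢x v≢x eq | cs , [] | ≢x | len | split | closing =
    contradiction eq (foldl-last-≢ (x ∷ cs , []) v v≢x ≢x)
  leftmost-opening {x} u v u≢x v≢x eq | cs , o ∷ os | ≢x | len | split | closing =
    contradiction eq (foldl-last-≢ (cs , os) v v≢x (last-tail-≢ os ≢x))
  leftmost-opening {x} u v u≢x v≢x eq | cs , o ∷ os | ≢x | len | split | opening =
    contradiction eq (foldl-last-≢ (cs , x ∷ o ∷ os) v v≢x ≢x)
  leftmost-opening {x} u v u≢x v≢x eq | cs , [] | ≢x | len | split | opening =
    refl , record { exhausted = sym len ; no-underflow = last-no-underflow cs x [] v v≢x eq }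

  step-head-≢ : ∀ {x} st {y} → y ≢ x → head (proj₁ st) ≢ just x → head (proj₁ (step st y)) ≢ just x
  step-head-≢ (cs , os) {y} y≢x ≢x with letter y
  ... | opening = ≢x
  ... | neither = ≢x
  step-head-≢ (cs , [])     y≢x ≢x | closing = λ { refl → y≢x refl }
  step-head-≢ (cs , _ ∷ os) y≢x ≢x | closing = ≢x

  foldl-head-≢ : ∀ {x} st ys → All (_≢ x) ys → head (proj₁ st) ≢ just x → head (proj₁ (foldl step st ys)) ≢ just x
  foldl-head-≢ st []       []           ≢x = ≢x
  foldl-head-≢ st (y ∷ ys) (y≢x ∷ ys≢x) ≢x = foldl-head-≢ (step st y) ys ys≢x (step-head-≢ st y≢x ≢x)

  -- The stack of unmatched closings never shrinks, so an unmatched closing after `x` would cover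
  -- `x` for good.
  head-no-underflow : ∀ {x} cs os ys → All (_≢ x) ys → head (proj₁ (foldl step (cs , os) ys)) ≡ just x →
                      NoUnderflow (length os) ys
  head-no-underflow cs os [] _ _ = tt
  head-no-underflow cs os (y ∷ ys) (y≢x ∷ ys≢x) eq with letter y
  ... | opening = tt , head-no-underflow cs (y ∷ os) ys ys≢x eq
  ... | neither = tt , head-no-underflow cs os ys ys≢x eq
  head-no-underflow cs [] (y ∷ ys) (y≢x ∷ ys≢x) eq | closing =
    contradiction eq (foldl-head-≢ (y ∷ cs , []) ys ys≢x λ { refl → y≢x refl })
  head-no-underflow cs (o ∷ os) (y ∷ ys) (y≢x ∷ ys≢x) eq | closing =
    tt , head-no-underflow cs os ys ys≢x eq

  rightmost-closing : ∀ {x} u v → All (_≢ x) u → All (_≢ x) v →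
    head (proj₁ (foldl step ([] , []) (u ++ x ∷ v))) ≡ just x → letter x ≡ closing × Isolated x u v
  rightmost-closing {x} u v u≢x v≢x eq with foldl step ([] , []) u | foldl-head-≢ ([] , []) u u≢x (λ ()) | length-foldl ([] , []) u | List.foldl-++ step ([] , []) u (x ∷ v)
  ... | cs , os | ≢x | len | split rewrite split with letter x in letter≡
  rightmost-closing {x} u v u≢x v≢x eq | cs , os | ≢x | len | split | neither =
    contradiction eq (foldl-head-≢ (cs , os) v v≢x ≢x)
  rightmost-closing {x} u v u≢x v≢x eq | cs , os | ≢x | len | split | opening =
    contradiction eq (foldl-head-≢ (cs , x ∷ os) v v≢x ≢x)
  rightmost-closing {x} u v u≢x v≢x eq | cs , o ∷ os | ≢x | len | split | closing =
    contradiction eq (foldl-head-≢ (cs , os) v v≢x ≢x)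
  rightmost-closing {x} u v u≢x v≢x eq | cs , [] | ≢x | len | split | closing =
    refl , record { exhausted = sym len ; no-underflow = head-no-underflow (x ∷ cs) [] v v≢x eq }

  -- The openings in `b` are still pending after `c` and `d`, which contain no closing; to reach
  -- depth 0 they must all be consumed in `e`, at most one per letter.
  exhausted-count : ∀ pre a {b c d e} → depth 0 (pre ++ (a ++ b ++ c) ++ d ++ e) ≡ 0 →
    All (λ x → letter x ≡ opening) b → All (λ x → letter x ≢ closing) c → All (λ x → letter x ≢ closing) d →
    length b ≤ length e
  exhausted-count pre a {b} {c} {d} {e} eq ob nc nd = begin
    length b                                        ≤⟨ ℕ.m≤m+n (length b) d₀ ⟩
    length b + d₀                                   ≡⟨ depth-opening ob ⟨
    depth d₀ b                                      ≤⟨ depth-no-closing nc ⟩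
    depth (depth d₀ b) c                            ≤⟨ depth-no-closing nd ⟩
    depth (depth (depth d₀ b) c) d                  ≤⟨ ≤-depth e ⟩
    depth (depth (depth (depth d₀ b) c) d) e + length e ≡⟨ cong (_+ length e) eq′ ⟩
    length e                                        ∎
    where
    open ℕ.≤-Reasoning
    d₀ : ℕ
    d₀ = depth (depth 0 pre) a
    eq′ : depth (depth (depth (depth d₀ b) c) d) e ≡ 0
    eq′ = trans (sym (trans (depth-++ 0 pre _) (trans (depth-++ _ (a ++ b ++ c) (d ++ e))
      (trans (cong (λ k → depth k (d ++ e)) (trans (depth-++ _ a (b ++ c)) (depth-++ _ b c))) (depth-++ _ d e))))) eq

  -- Counting starts at depth 0, so the closings in `b` can only consume openings from `e`.
  no-underflow-count : ∀ {e d a b rest} → NoUnderflow 0 ((e ++ d) ++ (a ++ b) ++ rest) →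
    All (λ x → letter x ≢ opening) d → All (λ x → letter x ≢ opening) a → All (λ x → letter x ≡ closing) b →
    length b ≤ length e
  no-underflow-count {e} {d} {a} {b} {rest} n nd na cb = begin
    length b                               ≤⟨ no-underflow-closing cb (no-underflow-++ʳ a (no-underflow-++ˡ (a ++ b) (no-underflow-++ʳ (e ++ d) n))) ⟩
    depth (depth 0 (e ++ d)) a             ≤⟨ depth-no-opening na ⟩
    depth 0 (e ++ d)                       ≡⟨ depth-++ 0 e d ⟩
    depth (depth 0 e) d                    ≤⟨ depth-no-opening nd ⟩
    depth 0 e                              ≤⟨ depth-≤ e ⟩
    length e + 0                           ≡⟨ ℕ.+-identityʳ (length e) ⟩
    length e                               ∎
    where open ℕ.≤-Reasoning

module _ {A : Set} {P Q : A → Set} (P? : Decidable P) (Q? : Decidable Q) where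
  open Brackets (λ x → letterOf (P? x) (Q? x))

  foldl-filter : ∀ {f} → (∀ st x → f st x ≡ act (if does (Q? x) then opening else closing) x st) →
                 ∀ st xs → foldl f st (filter P? xs) ≡ foldl step st xs
  foldl-filter f≗ st []       = refl
  foldl-filter {f} f≗ st (x ∷ xs) with f≗ st x | does (P? x)
  ... | _  | false = foldl-filter f≗ st xs
  ... | eq | true  = trans (cong (λ st → foldl f st (filter P? xs)) eq) (foldl-filter f≗ _ xs)

-- Slices of tabulated lists

module _ {A : Set} {P : A → Set} where

  slice-tabulate : ∀ {N} k m (f : Fin N → A) → (∀ i → k ≤ toℕ i → toℕ i < m → P (f i)) →
                   All P (drop k (take m (tabulate f)))
  slice-tabulate {zero}  zero    zero    f h = []
  slice-tabulate {zero}  zero    (suc m) f h = []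
  slice-tabulate {zero}  (suc k) zero    f h = []
  slice-tabulate {zero}  (suc k) (suc m) f h = []
  slice-tabulate {suc N} zero    zero    f h = []
  slice-tabulate {suc N} (suc k) zero    f h = []
  slice-tabulate {suc N} zero    (suc m) f h = h zero z≤n (s≤s z≤n) ∷
    slice-tabulate zero m (f ∘ suc) λ i _ i<m → h (suc i) z≤n (s≤s i<m)
  slice-tabulate {suc N} (suc k) (suc m) f h =
    slice-tabulate k m (f ∘ suc) λ i k≤i i<m → h (suc i) (s≤s k≤i) (s≤s i<m)

  drop-tabulate : ∀ {N} k (f : Fin N → A) → (∀ i → k ≤ toℕ i → P (f i)) → All P (drop k (tabulate f))
  drop-tabulate {zero}  zero    f h = []
  drop-tabulate {zero}  (suc k) f h = []
  drop-tabulate {suc N} zero    f h = h zero z≤n ∷ drop-tabulate zero (f ∘ suc) λ i _ → h (suc i) z≤n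
  drop-tabulate {suc N} (suc k) f h = drop-tabulate k (f ∘ suc) λ i k≤i → h (suc i) (s≤s k≤i)

drop-tabulate-∷ : ∀ {A : Set} {N} (f : Fin N → A) k → drop (toℕ k) (tabulate f) ≡ f k ∷ drop (suc (toℕ k)) (tabulate f)
drop-tabulate-∷ f zero    = refl
drop-tabulate-∷ f (suc k) = drop-tabulate-∷ (f ∘ suc) k

split-tabulate-⋖ : ∀ {A : Set} {N} (f : Fin N → A) {r s} → r ⋖ s →
  ∃[ as ] ∃[ bs ] tabulate f ≡ as ++ f r ∷ f s ∷ bs
split-tabulate-⋖ f {zero}  {suc zero} refl = [] , _ , refl
split-tabulate-⋖ f {suc r} {suc s} r⋖s with split-tabulate-⋖ (f ∘ suc) (ℕ.suc-injective r⋖s)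
... | as , bs , eq = f zero ∷ as , bs , cong (f zero ∷_) eq

-- The reading word as a bracket word

module Words {n : ℕ} (μ ν : Vector ℕ n) where
  open Shape μ ν

  InWord : ℕ → Filling → Square → Set
  InWord i T s = (T s ≡ i ⊎ T s ≡ suc i) × ¬ InOverlap i T s

  inWord? : ∀ i T s → Dec (InWord i T s)
  inWord? i T s = ((T s ℕ.≟ i) ⊎-dec (T s ℕ.≟ suc i)) ×-dec ¬? (inOverlap? i T s)

  letter : ℕ → Filling → Square → Letter
  letter i T s = letterOf (inWord? i T s) (T s ℕ.≟ suc i)

  letter-opening : ∀ {i T s} → T s ≡ suc i → ¬ InOverlap i T s → letter i T s ≡ opening
  letter-opening {i} {T} {s} eq ¬o = letterOf-opening (inWord? i T s) (T s ℕ.≟ suc i) (inj₂ eq , ¬o) eq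

  letter-closing : ∀ {i T s} → T s ≡ i → ¬ InOverlap i T s → letter i T s ≡ closing
  letter-closing {i} {T} {s} eq ¬o = letterOf-closing (inWord? i T s) (T s ℕ.≟ suc i) (inj₁ eq , ¬o)
    λ eq′ → ℕ.1+n≢n (trans (sym eq′) eq)

  opening-letter : ∀ {i T s} → letter i T s ≡ opening → T s ≡ suc i × ¬ InOverlap i T s
  opening-letter {i} {T} {s} eq with opening-letterOf (inWord? i T s) (T s ℕ.≟ suc i) eq
  ... | (_ , ¬o) , eq′ = eq′ , ¬o

  closing-letter : ∀ {i T s} → letter i T s ≡ closing → T s ≡ i × ¬ InOverlap i T s
  closing-letter {i} {T} {s} eq with closing-letterOf (inWord? i T s) (T s ℕ.≟ suc i) eq
  ... | (inj₁ eq′ , ¬o) , _ = eq′ , ¬o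
  ... | (inj₂ eq′ , _)  , ≢ = contradiction eq′ ≢

  private module B i T = Brackets (letter i T)

  foldl-word : ∀ i T st → foldl (read i T) st (word i T) ≡ foldl (B.step i T) st squares
  foldl-word i T st = foldl-filter (inWord? i T) (λ s → T s ℕ.≟ suc i)
    (λ st s → read-act st s (does (T s ℕ.≟ suc i))) st squares
    where
    read-act : ∀ st s b → (if b then (proj₁ st , s ∷ proj₂ st) else close s st) ≡
                          B.act i T (if b then opening else closing) s st
    read-act st            s true  = refl
    read-act (cs , [])     s false = refl
    read-act (cs , _ ∷ os) s false = refl

  rowSquares : ∀ r → List Square
  rowSquares r = tabulate {n = μ r ∸ ν r} (r ,_)

  squares-rows : squares ≡ concatMap rowSquares (reverse (allFin n))
  squares-rows = List.concatMap-cong (λ r → List.map-tabulate id (r ,_)) (reverse (allFin n))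

  squares-unique : Unique squares
  squares-unique = subst Unique (sym squares-rows) (Unique.concat⁺
    (All.map⁺ (All.universal (λ r → Unique.tabulate⁺ λ { refl → refl }) _))
    (AllPairs.map⁺ (AllPairs.map disjoint rows-unique)))
    where
    rows-unique : Unique (reverse (allFin n))
    rows-unique = ↭ₛ.Unique-resp-↭ (setoid _) (↭⇒↭ₛ (↭-sym (↭-reverse (allFin n)))) (Unique.allFin⁺ n)
    disjoint : ∀ {r s} → r ≢ s → ∀ {x} → ¬ (x ∈ rowSquares r × x ∈ rowSquares s)
    disjoint r≢s (x∈r , x∈s) = r≢s (trans (sym (cong proj₁ (proj₂ (∈-tabulate⁻ x∈r)))) (cong proj₁ (proj₂ (∈-tabulate⁻ x∈s))))

  unique-split : ∀ {A : Set} {x : A} u v → Unique (u ++ x ∷ v) → All (_≢ x) u × All (_≢ x) v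
  unique-split []      v (x≢ ∷ _) = [] , All.map ≢-sym x≢
  unique-split (y ∷ u) v (y≢ ∷ h) with unique-split u v h | All.++⁻ʳ u y≢
  ... | u≢ , v≢ | y≢x ∷ _ = y≢x ∷ u≢ , v≢

  split-unique : ∀ {x u v} → squares ≡ u ++ x ∷ v → All (_≢ x) u × All (_≢ x) v
  split-unique {u = u} {v} eq = unique-split u v (subst Unique eq squares-unique)

  -- Quantified over all splittings of `squares` at `x`, so that each count may use the one adapted
  -- to its rows; since `squares` has no repetition, the splitting is in fact unique.
  IsolatedIn : ℕ → Filling → Square → Set
  IsolatedIn i T x = ∀ u v → squares ≡ u ++ x ∷ v → B.Isolated i T x u v

  map-just : ∀ {A B : Set} {f : A → B} (m : Maybe A) {y} → Maybe.map f m ≡ just y → ∃[ x ] (y ≡ f x × m ≡ just x)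
  map-just (just x) refl = x , refl , refl

  raised : ∀ {i T T′} → E i T ≡ just T′ →
    ∃[ x ] (T′ ≡ T [ x ≔ i ] × last (proj₂ (foldl (B.step i T) ([] , []) squares)) ≡ just x)
  raised {i} {T} eq with map-just (last (proj₂ (unmatched i T))) eq
  ... | x , T′≡ , last≡ = x , T′≡ , trans (cong (last ∘ proj₂) (sym (foldl-word i T ([] , [])))) last≡

  lowered : ∀ {i T T′} → F i T ≡ just T′ →
    ∃[ x ] (T′ ≡ T [ x ≔ suc i ] × head (proj₁ (foldl (B.step i T) ([] , []) squares)) ≡ just x)
  lowered {i} {T} eq with map-just (head (proj₁ (unmatched i T))) eq
  ... | x , T′≡ , head≡ = x , T′≡ , trans (cong (head ∘ proj₁) (sym (foldl-word i T ([] , [])))) head≡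

  squares-⋖ : ∀ {r s} → r ⋖ s → ∃[ pre ] ∃[ post ] squares ≡ pre ++ rowSquares s ++ rowSquares r ++ post
  squares-⋖ {r} {s} r⋖s with split-tabulate-⋖ id r⋖s
  ... | as , bs , eq = concatMap rowSquares (reverse bs) , concatMap rowSquares (reverse as) , (begin
    squares                                                     ≡⟨ squares-rows ⟩
    concatMap rowSquares (reverse (allFin n))                   ≡⟨ cong (concatMap rowSquares ∘ reverse) eq ⟩
    concatMap rowSquares (reverse (as ++ r ∷ s ∷ bs))           ≡⟨ cong (concatMap rowSquares) (List.reverse-++ as (r ∷ s ∷ bs)) ⟩
    concatMap rowSquares (reverse (r ∷ s ∷ bs) ++ reverse as)   ≡⟨ cong (λ xs → concatMap rowSquares (xs ++ reverse as)) (List.reverse-++ (r ∷ s ∷ []) bs) ⟩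
    concatMap rowSquares ((reverse bs ++ s ∷ r ∷ []) ++ reverse as) ≡⟨ cong (concatMap rowSquares) (List.++-assoc (reverse bs) _ _) ⟩
    concatMap rowSquares (reverse bs ++ s ∷ r ∷ reverse as)     ≡⟨ List.concatMap-++ rowSquares (reverse bs) _ ⟩
    concatMap rowSquares (reverse bs) ++ rowSquares s ++ rowSquares r ++ concatMap rowSquares (reverse as) ∎)
    where open ≡-Reasoning

  reassociateˡ : ∀ (a b c d e f : List Square) → a ++ b ++ (c ++ d ++ e) ++ f ≡ (a ++ b ++ c ++ d) ++ e ++ f
  reassociateˡ a b c d e f = begin
    a ++ b ++ (c ++ d ++ e) ++ f    ≡⟨ cong (λ z → a ++ b ++ z ++ f) (List.++-assoc c d e) ⟨
    a ++ b ++ ((c ++ d) ++ e) ++ f  ≡⟨ cong (λ z → a ++ b ++ z) (List.++-assoc (c ++ d) e f) ⟩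
    a ++ b ++ (c ++ d) ++ e ++ f    ≡⟨ cong (a ++_) (List.++-assoc b (c ++ d) (e ++ f)) ⟨
    a ++ (b ++ c ++ d) ++ e ++ f    ≡⟨ List.++-assoc a (b ++ c ++ d) (e ++ f) ⟨
    (a ++ b ++ c ++ d) ++ e ++ f    ∎
    where open ≡-Reasoning

  reassociateʳ : ∀ (a b c d e f g : List Square) → a ++ (b ++ c) ++ (d ++ e ++ f) ++ g ≡ (a ++ b) ++ c ++ (d ++ e) ++ (f ++ g)
  reassociateʳ a b c d e f g = begin
    a ++ (b ++ c) ++ (d ++ e ++ f) ++ g    ≡⟨ cong (λ z → a ++ (b ++ c) ++ z ++ g) (List.++-assoc d e f) ⟨
    a ++ (b ++ c) ++ ((d ++ e) ++ f) ++ g  ≡⟨ cong (λ z → a ++ (b ++ c) ++ z) (List.++-assoc (d ++ e) f g) ⟩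
    a ++ (b ++ c) ++ (d ++ e) ++ f ++ g    ≡⟨ cong (a ++_) (List.++-assoc b c _) ⟩
    a ++ b ++ c ++ (d ++ e) ++ f ++ g      ≡⟨ List.++-assoc a b _ ⟨
    (a ++ b) ++ c ++ (d ++ e) ++ (f ++ g)  ∎
    where open ≡-Reasoning

  length-slice : ∀ {A : Set} k {m} (xs : List A) → m ≤ length xs → length (drop k (take m xs)) ≡ m ∸ k
  length-slice k {m} xs m≤ = trans (List.length-drop k (take m xs)) (cong (_∸ k) (trans (List.length-take m xs) (ℕ.m≤n⇒m⊓n≡m m≤)))

  split-slice : ∀ {A : Set} k m (xs : List A) → k ≤ m → xs ≡ take k xs ++ drop k (take m xs) ++ drop m xs
  split-slice zero    m       xs       _         = sym (List.take++drop≡id m xs)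
  split-slice (suc k) (suc m) []       _         = refl
  split-slice (suc k) (suc m) (x ∷ xs) (s≤s k≤m) = cong (x ∷_) (split-slice k m xs k≤m)

  index-≤ : ∀ {r} (k : Fin (μ r ∸ ν r)) → suc (toℕ k) ≤ length (rowSquares r)
  index-≤ {r} k = ℕ.≤-trans (Fin.toℕ<n k) (ℕ.≤-reflexive (sym (List.length-tabulate (r ,_))))

  module _ {i : ℕ} {T : Filling} where
    private module Bᵢ = Brackets (letter i T)

    -- Row `s` is read immediately before row `r`. Openings `lo` to `hi` of row `s` must be consumed
    -- before `(r , k)`, and closings are possible only at the indices from `y` up to `k` of row
    -- `r`.
    count-left : ∀ {r s k} → IsolatedIn i T (r , k) → r ⋖ s → ∀ lo (hi : Fin (μ s ∸ ν s)) y → lo ≤ toℕ hi → y ≤ toℕ k →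
      (∀ l → lo ≤ toℕ l → toℕ l ≤ toℕ hi → letter i T (s , l) ≡ opening) →
      (∀ l → toℕ hi < toℕ l → letter i T (s , l) ≢ closing) →
      (∀ l → toℕ l < y → letter i T (r , l) ≢ closing) →
      suc (toℕ hi) ∸ lo ≤ toℕ k ∸ y
    count-left {r} {s} {k} isolated r⋖s lo hi y lo≤hi y≤k opens inert-s inert-r with squares-⋖ r⋖s
    ... | pre , post , eq = begin
      hi′ ∸ lo                        ≡⟨ length-slice lo rs (index-≤ hi) ⟨
      length (drop lo (take hi′ rs))  ≤⟨ Bᵢ.exhausted-count pre (take lo rs)
        (Bᵢ.Isolated.exhausted (isolated _ (drop (suc k′) rr ++ post) (trans eq split)))
        (slice-tabulate lo hi′ (s ,_) λ l lo≤l l<hi → opens l lo≤l (s≤s⁻¹ l<hi))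
        (drop-tabulate hi′ (s ,_) inert-s)
        (slice-tabulate 0 y (r ,_) λ l _ → inert-r l) ⟩
      length (drop y (take k′ rr))    ≡⟨ length-slice y rr (ℕ.<⇒≤ (index-≤ k)) ⟩
      k′ ∸ y                          ∎
      where
      open ℕ.≤-Reasoning
      rs rr : List Square
      rs = rowSquares s
      rr = rowSquares r
      hi′ k′ : ℕ
      hi′ = suc (toℕ hi)
      k′ = toℕ k
      split : pre ++ rs ++ rr ++ post ≡
              (pre ++ (take lo rs ++ drop lo (take hi′ rs) ++ drop hi′ rs) ++ take y rr ++ drop y (take k′ rr)) ++
              (r , k) ∷ drop (suc k′) rr ++ post
      split = trans (cong₂ (λ xs ys → pre ++ xs ++ ys ++ post)
          (split-slice lo hi′ rs (ℕ.m≤n⇒m≤1+n lo≤hi))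
          (trans (split-slice y k′ rr y≤k) (cong (λ zs → take y rr ++ drop y (take k′ rr) ++ zs) (drop-tabulate-∷ (r ,_) k))))
        (reassociateˡ pre (take lo rs ++ drop lo (take hi′ rs) ++ drop hi′ rs) (take y rr) (drop y (take k′ rr)) _ post)

    -- The closings `lo` to `hi` of row `r` cannot use openings from before `(s , k)`. What can
    -- supply them are the `z` squares directly after it in row `s`, as the rest of that row and the
    -- start of row `r` have no openings.
    count-right : ∀ {r s k} → IsolatedIn i T (s , k) → r ⋖ s → ∀ lo (hi : Fin (μ r ∸ ν r)) z → lo ≤ toℕ hi →
      (∀ l → lo ≤ toℕ l → toℕ l ≤ toℕ hi → letter i T (r , l) ≡ closing) →
      (∀ l → toℕ l < lo → letter i T (r , l) ≢ opening) →
      (∀ l → suc (toℕ k) + z ≤ toℕ l → letter i T (s , l) ≢ opening) →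
      suc (toℕ hi) ∸ lo ≤ z
    count-right {r} {s} {k} isolated r⋖s lo hi z lo≤hi closes inert-r inert-s with squares-⋖ r⋖s
    ... | pre , post , eq = begin
      hi′ ∸ lo                        ≡⟨ length-slice lo rr (index-≤ hi) ⟨
      length (drop lo (take hi′ rr))  ≤⟨ Bᵢ.no-underflow-count {e = take z rest}
        (Bᵢ.Isolated.no-underflow (isolated (pre ++ take k′ rs) _ (trans eq split)))
        (subst (All _) (sym (List.drop-drop (suc k′) z rs)) (drop-tabulate (suc k′ + z) (s ,_) inert-s))
        (slice-tabulate 0 lo (r ,_) λ l _ → inert-r l)
        (slice-tabulate lo hi′ (r ,_) λ l lo≤l l<hi → closes l lo≤l (s≤s⁻¹ l<hi)) ⟩
      length (take z rest)            ≡⟨ List.length-take z rest ⟩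
      z ⊓ length rest                 ≤⟨ ℕ.m⊓n≤m z (length rest) ⟩
      z                               ∎
      where
      open ℕ.≤-Reasoning
      rs rr rest : List Square
      rs = rowSquares s
      rr = rowSquares r
      hi′ k′ : ℕ
      hi′ = suc (toℕ hi)
      k′ = toℕ k
      rest = drop (suc k′) rs
      split : pre ++ rs ++ rr ++ post ≡
              (pre ++ take k′ rs) ++ (s , k) ∷ (take z rest ++ drop z rest) ++
              (take lo rr ++ drop lo (take hi′ rr)) ++ (drop hi′ rr ++ post)
      split = trans (cong₂ (λ xs ys → pre ++ xs ++ ys ++ post)
          (trans (sym (List.take++drop≡id k′ rs)) (cong (take k′ rs ++_)
            (trans (drop-tabulate-∷ (s ,_) k) (cong ((s , k) ∷_) (sym (List.take++drop≡id z rest))))))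
          (split-slice lo hi′ rr (ℕ.m≤n⇒m≤1+n lo≤hi)))
        (reassociateʳ pre (take k′ rs) ((s , k) ∷ take z rest ++ drop z rest) (take lo rr) (drop lo (take hi′ rr)) (drop hi′ rr) post)

-- Overlaps

firstIndex : ∀ {N} {P : Fin N → Set} → Decidable P → ∀ k → P k → ∃[ f ] (P f × (∀ l → toℕ l < toℕ f → ¬ P l))
firstIndex {suc N} P? k Pk with P? zero
... | yes P0 = zero , P0 , λ _ ()
firstIndex {suc N} P? zero    Pk | no ¬P0 = contradiction Pk ¬P0
firstIndex {suc N} P? (suc k) Pk | no ¬P0 with firstIndex (P? ∘ suc) k Pk
... | f , Pf , least = suc f , Pf , λ where
  zero    _         → ¬P0
  (suc l) (s≤s l<f) → least l l<f

lastIndex : ∀ {N} {P : Fin N → Set} → Decidable P → ∀ k → P k → ∃[ f ] (P f × (∀ l → toℕ f < toℕ l → ¬ P l))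
lastIndex {suc N} P? k Pk with Fin.any? (P? ∘ suc)
... | yes (l , Pl) = let f , Pf , greatest = lastIndex (P? ∘ suc) l Pl in suc f , Pf , λ where
  (suc m) (s≤s f<m) → greatest m f<m
lastIndex {suc N} P? zero    Pk | no ¬P = zero , Pk , λ { (suc l) _ Pl → ¬P (l , Pl) }
lastIndex {suc N} P? (suc k) Pk | no ¬P = contradiction (k , Pk) ¬P

rows-above : ∀ {n} (u : Fin n) → 2 ≤ toℕ u → ∃[ r ] ∃[ s ] (r ⋖ s × s ⋖ u)
rows-above (suc zero)    (s≤s ())
rows-above (suc (suc u)) _ = fromℕ< u<n , fromℕ< 1+u<n ,
  cong suc (trans (Fin.toℕ-fromℕ< 1+u<n) (cong suc (sym (Fin.toℕ-fromℕ< u<n)))) ,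
  cong suc (cong suc (sym (Fin.toℕ-fromℕ< 1+u<n)))
  where
  1+u<n = ℕ.m≤n⇒m≤1+n (s≤s (Fin.toℕ<n u))
  u<n   = ℕ.m≤n⇒m≤1+n (ℕ.m≤n⇒m≤1+n (Fin.toℕ<n u))

row-below : ∀ {n} {r u : Fin n} → r Fin.< u → ∃[ s ] (r ⋖ s)
row-below {n} {r} {u} r<u = fromℕ< 1+r<n , cong suc (Fin.toℕ-fromℕ< 1+r<n)
  where
  1+r<n : suc (toℕ r) < n
  1+r<n = ℕ.≤-<-trans r<u (Fin.toℕ<n u)

module Tableau {n : ℕ} (μ ν : Vector ℕ n)
  (μ↓ : IsPartition μ) (μ₃ : NoThreeEqual μ) (ν↓ : IsPartition ν) (ν₃ : NoThreeEqual ν)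
  (tableau : Shape.ShuffleTableau μ ν) (i : ℕ) where
  open Shape μ ν
  open ShuffleTableau tableau using (contained; rows; columns) renaming (entry to T)
  open Strands μ ν
  open Values μ ν μ↓ μ₃ ν↓ ν₃ contained
  open Monotone tableau
  open Words μ ν

  At : ℕ → Fin n → ℤ → Set
  At = AtLeast T

  not-before : ∀ {t r e e′} → ¬ At t r e′ → SameParity r e′ → e ≤ᶻ e′ → ¬ At t r e
  not-before ¬at par e≤e′ at = ¬at (rightward at e≤e′ par)

  parity-above : ∀ {r s u c} → r ⋖ s → s ⋖ u → SameParity u c → SameParity r c
  parity-above {r} {s} {u} {c} r⋖s s⋖u = parity-shift {u} {r} {c} {c} 1ℤ
    (trans (eq c (+ rowNo r)) (cong (λ x → c -ᶻ + x +ᶻ 1ℤ *ᶻ + 2) (sym (trans s⋖u (cong suc r⋖s)))))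
    where
    eq : ∀ c x → c -ᶻ x ≡ c -ᶻ (+ 2 +ᶻ x) +ᶻ 1ℤ *ᶻ + 2
    eq = solve-∀

  two-apart : ∀ {r u c} → SameParity r c → SameParity u c → r Fin.< u → 2 + toℕ r ≤ toℕ u
  two-apart {r} {u} {c} rc uc r<u = ℕ.≤∧≢⇒< r<u λ eq → parity-⋖ c (cong suc (sym eq)) rc uc

  -- An overlap only asks for equal columns, not for neighbouring rows of equal parity. Moving a
  -- threshold down two rows at a time brings the overlap to a distance of two; the bound `m` makes
  -- the recursion structural.
  descend : ∀ m {t q r c} → toℕ r ≤ m → At t q c → q Fin.≤ r → SameParity r c → At t r c
  descend m {t} {q} {r} {c} r≤m at q≤r par with ℕ.m≤n⇒m<n∨m≡n q≤r
  ... | inj₂ q≡r = subst (λ r → At t r c) (Fin.toℕ-injective q≡r) at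
  descend zero r≤m at q≤r par | inj₁ q<r = contradiction (ℕ.≤-trans q<r r≤m) λ ()
  descend (suc m) {t} {q} {r} {c} r≤m at q≤r par | inj₁ q<r =
    go (rows-above r (ℕ.≤-trans (s≤s (s≤s z≤n)) far))
    where
    far : 2 + toℕ q ≤ toℕ r
    far = two-apart {q} {r} {c} (at-parity at) par q<r
    go : ∃[ a ] ∃[ b ] (a ⋖ b × b ⋖ r) → At t r c
    go (a , b , a⋖b , b⋖r) = lower-threshold (ℕ.n≤1+n t) (downward a⋖b b⋖r
      (descend m (s≤s⁻¹ (ℕ.≤-trans (ℕ.≤-trans (ℕ.n≤1+n _) (ℕ.≤-reflexive eq)) r≤m)) at
        (s≤s⁻¹ (s≤s⁻¹ (ℕ.≤-trans far (ℕ.≤-reflexive (sym eq))))) (parity-above {a} {b} {r} {c} a⋖b b⋖r par)))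
      where
      eq : 2 + toℕ a ≡ toℕ r
      eq = ℕ.suc-injective (sym (trans b⋖r (cong suc a⋖b)))

  at-col : ∀ {t r k} → t ≤ T (r , k) → At t r (col (r , k))
  at-col {k = k} t≤ = inside k refl t≤

  overlap-rows : ∀ {s t} → Overlap i T s t → row s Fin.< row t
  overlap-rows {r , k} {u , l} (c≡ , Ts , Tt) with ℕ.<-cmp (toℕ r) (toℕ u)
  ... | tri< r<u _ _ = r<u
  ... | tri> _ _ u<r = contradiction (columns (u , l) (r , k) (sym c≡) u<r) (ℕ.<-asym (ℕ.≤-reflexive (trans (cong suc Ts) (sym Tt))))
  ... | tri≈ _ r≡u _ with Fin.toℕ-injective r≡u
  ...   | refl with col-injective {r} {k} {l} c≡
  ...     | refl = contradiction (trans (sym Tt) Ts) ℕ.1+n≢n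

  -- Together with `opening-free`: an i + 1 is overlapped exactly when the position two rows above
  -- it reaches i. Likewise, by `overlapped-below` and `closing-free`, an i is overlapped exactly
  -- when the position two rows below exists and misses i + 2.
  overlapped-above : ∀ {u l} → T (u , l) ≡ suc i → InOverlap i T (u , l) →
                     ∃[ r ] ∃[ s ] (r ⋖ s × s ⋖ u × At i r (col (u , l)))
  overlapped-above {u} {l} Tu (q , k , inj₁ (_ , Tu′ , _)) = contradiction (trans (sym Tu) Tu′) ℕ.1+n≢n
  overlapped-above {u} {l} Tu (q , k , inj₂ o@(c≡ , Tq , _)) = go (rows-above u (ℕ.≤-trans (s≤s (s≤s z≤n)) far))
    where
    at : At i q (col (u , l))
    at = inside k (sym c≡) (ℕ.≤-reflexive (sym Tq))
    far : 2 + toℕ q ≤ toℕ u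
    far = two-apart {q} {u} {col (u , l)} (at-parity at) (square-parity (u , l)) (overlap-rows {q , k} {u , l} o)
    go : ∃[ r ] ∃[ s ] (r ⋖ s × s ⋖ u) → ∃[ r ] ∃[ s ] (r ⋖ s × s ⋖ u × At i r (col (u , l)))
    go (r , s , r⋖s , s⋖u) = r , s , r⋖s , s⋖u , descend (toℕ r) ℕ.≤-refl at
      (s≤s⁻¹ (s≤s⁻¹ (ℕ.≤-trans far (ℕ.≤-reflexive (ℕ.suc-injective (trans s⋖u (cong suc r⋖s)))))))
      (parity-above {r} {s} {u} {col (u , l)} r⋖s s⋖u (square-parity (u , l)))

  overlapped-below : ∀ {r k} → T (r , k) ≡ i → InOverlap i T (r , k) →
                     ∃[ s ] ∃[ u ] (r ⋖ s × s ⋖ u × ¬ At (2 + i) u (col (r , k)))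
  overlapped-below {r} {k} Tr (q , l , inj₂ (_ , _ , Tr′)) = contradiction (trans (sym Tr′) Tr) ℕ.1+n≢n
  overlapped-below {r} {k} Tr (q , l , inj₁ o@(c≡ , _ , Tq)) = go (row-below r<q)
    where
    r<q : r Fin.< q
    r<q = overlap-rows {r , k} {q , l} o
    par : SameParity q (col (r , k))
    par = subst (SameParity q) (sym c≡) (square-parity (q , l))
    far : 2 + toℕ r ≤ toℕ q
    far = two-apart {r} {q} {col (r , k)} (square-parity (r , k)) par r<q
    go : ∃[ s ] (r ⋖ s) → ∃[ s ] ∃[ u ] (r ⋖ s × s ⋖ u × ¬ At (2 + i) u (col (r , k)))
    go (s , r⋖s) = go′ (row-below s<q)
      where
      s<q : s Fin.< q
      s<q = ℕ.≤-trans (ℕ.≤-reflexive r⋖s) far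
      go′ : ∃[ u ] (s ⋖ u) → ∃[ s ] ∃[ u ] (r ⋖ s × s ⋖ u × ¬ At (2 + i) u (col (r , k)))
      go′ (u , s⋖u) = s , u , r⋖s , s⋖u , λ at → ℕ.<⇒≱ (ℕ.n<1+n (suc i)) (ℕ.≤-trans
        (at-square (subst (At (2 + i) q) c≡ (descend (toℕ q) ℕ.≤-refl at (ℕ.≤-trans (ℕ.≤-reflexive (ℕ.suc-injective s⋖u)) s<q) par)))
        (ℕ.≤-reflexive Tq))

  closing-free : ∀ {r k s u} → T (r , k) ≡ i → ¬ InOverlap i T (r , k) → r ⋖ s → s ⋖ u → At (2 + i) u (col (r , k))
  closing-free {r} {k} {s} {u} Tr ¬o r⋖s s⋖u = go (atLeast? T (2 + i) u (col (r , k)))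
    where
    at : At (suc i) u (col (r , k))
    at = downward r⋖s s⋖u (at-col (ℕ.≤-reflexive (sym Tr)))
    clash : ¬ (∃[ l ] (col (r , k) ≡ col (u , l) × T (u , l) ≡ suc i))
    clash (l , c≡ , Tu) = ¬o (u , l , inj₁ (c≡ , Tr , Tu))
    go : Dec (At (2 + i) u (col (r , k))) → At (2 + i) u (col (r , k))
    go (yes at⁺) = at⁺
    go (no ¬at⁺) = contradiction (exact at ¬at⁺) clash

  opening-free : ∀ {u l r s} → T (u , l) ≡ suc i → ¬ InOverlap i T (u , l) → r ⋖ s → s ⋖ u → ¬ At i r (col (u , l))
  opening-free {u} {l} {r} {s} Tu ¬o r⋖s s⋖u at = go (exact at λ at′ →
      ℕ.<⇒≱ (ℕ.n<1+n (suc i)) (ℕ.≤-trans (at-square (downward r⋖s s⋖u at′)) (ℕ.≤-reflexive Tu)))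
    where
    go : ¬ (∃[ k ] (col (u , l) ≡ col (r , k) × T (r , k) ≡ i))
    go (k , c≡ , Tr) = ¬o (r , k , inj₂ (sym c≡ , Tr , Tu))

  is-closing : ∀ {r k} → T (r , k) ≡ i → (∀ {s u} → r ⋖ s → s ⋖ u → At (2 + i) u (col (r , k))) → letter i T (r , k) ≡ closing
  is-closing Tr free = letter-closing Tr λ o → let _ , _ , r⋖s , s⋖u , ¬at = overlapped-below Tr o in ¬at (free r⋖s s⋖u)

  is-opening : ∀ {u l} → T (u , l) ≡ suc i → (∀ {r s} → r ⋖ s → s ⋖ u → ¬ At i r (col (u , l))) → letter i T (u , l) ≡ opening
  is-opening Tu free = letter-opening Tu λ o → let _ , _ , r⋖s , s⋖u , at = overlapped-above Tu o in free r⋖s s⋖u at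

  -- What the bracket rule gives about the changed square x, stated for the filling
  -- in which x has entry i + 1: the result of F and the argument of E.
  record Lowerable (r₀ : Fin n) (k₀ : Fin (μ r₀ ∸ ν r₀)) : Set where
    field
      Tx       : T (r₀ , k₀) ≡ suc i
      free     : ¬ InOverlap i T (r₀ , k₀)
      leftmost : ∀ l → toℕ l < toℕ k₀ → T (r₀ , l) ≤ i
      isolated : IsolatedIn i T (r₀ , k₀)

-- Staircases

i<i+1 : ∀ c → c <ᶻ c +ᶻ 1ℤ
i<i+1 c = ≤⇒shift-< (eq c) (ℤ.≤-refl {+ 0})
  where
  eq : ∀ c → c +ᶻ 1ℤ -ᶻ (1ℤ +ᶻ c) ≡ + 0 -ᶻ + 0
  eq = solve-∀

<⇒+1≤ : ∀ {x y} → x <ᶻ y → x +ᶻ 1ℤ ≤ᶻ y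
<⇒+1≤ {x} {y} = <⇒shift-≤ (eq x y)
  where
  eq : ∀ x y → y -ᶻ (x +ᶻ 1ℤ) ≡ y -ᶻ (1ℤ +ᶻ x)
  eq = solve-∀

<+1⇒≤ : ∀ {x y} → x <ᶻ y +ᶻ 1ℤ → x ≤ᶻ y
<+1⇒≤ {x} {y} = <⇒shift-≤ (eq x y)
  where
  eq : ∀ x y → y -ᶻ x ≡ y +ᶻ 1ℤ -ᶻ (1ℤ +ᶻ x)
  eq = solve-∀

i+1-1≡i : ∀ c → c +ᶻ 1ℤ -ᶻ 1ℤ ≡ c
i+1-1≡i = solve-∀

i-1+1≡i : ∀ c → c -ᶻ 1ℤ +ᶻ 1ℤ ≡ c
i-1+1≡i = solve-∀

-- Translates indices into columns, with `x` and `y` the starts of two adjacent rows: the equation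
-- relates the two rows at one place, and going `d` squares to the left in both preserves this
-- relation.
staircase-≤ˡ : ∀ x y {a b d l} → x +ᶻ + (2 * a) -ᶻ 1ℤ ≡ y +ᶻ + (2 * (b + d)) → suc (l + d) ≤ a →
               x +ᶻ + (2 * l) ≤ᶻ y +ᶻ + (2 * b) -ᶻ 1ℤ
staircase-≤ˡ x y {a} {b} {d} {l} eq le = shift-≤ eq′ (ℤ.+≤+ (ℕ.≤-trans (ℕ.≤-reflexive (double l d)) (ℕ.*-monoʳ-≤ 2 le)))
  where
  double : ∀ l d → 2 + (2 * l + 2 * d) ≡ 2 * suc (l + d)
  double = ℕSolver.solve-∀
  ring₁ : ∀ x y b l d → y +ᶻ b -ᶻ 1ℤ -ᶻ (x +ᶻ l) ≡ (y +ᶻ (b +ᶻ d)) -ᶻ d -ᶻ 1ℤ -ᶻ x -ᶻ l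
  ring₁ = solve-∀
  ring₂ : ∀ x a l d → (x +ᶻ a -ᶻ 1ℤ) -ᶻ d -ᶻ 1ℤ -ᶻ x -ᶻ l ≡ a -ᶻ (+ 2 +ᶻ (l +ᶻ d))
  ring₂ = solve-∀
  eq′ : y +ᶻ + (2 * b) -ᶻ 1ℤ -ᶻ (x +ᶻ + (2 * l)) ≡ + (2 * a) -ᶻ + (2 + (2 * l + 2 * d))
  eq′ = trans (ring₁ x y (+ (2 * b)) (+ (2 * l)) (+ (2 * d)))
    (trans (cong (λ z → z -ᶻ + (2 * d) -ᶻ 1ℤ -ᶻ x -ᶻ + (2 * l)) (trans (cong (λ z → y +ᶻ + z) (sym (ℕ.*-distribˡ-+ 2 b d))) (sym eq)))
      (ring₂ x (+ (2 * a)) (+ (2 * l)) (+ (2 * d))))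

staircase-≤ʳ : ∀ x y {a b d l} → x +ᶻ + (2 * a) +ᶻ 1ℤ ≡ y +ᶻ + (2 * b) → suc a + d ≤ l →
               y +ᶻ + (2 * (b + d)) +ᶻ 1ℤ ≤ᶻ x +ᶻ + (2 * l)
staircase-≤ʳ x y {a} {b} {d} {l} eq le = shift-≤ eq′ (ℤ.+≤+ (ℕ.≤-trans (ℕ.≤-reflexive (double a d)) (ℕ.*-monoʳ-≤ 2 le)))
  where
  double : ∀ l d → 2 + (2 * l + 2 * d) ≡ 2 * (suc l + d)
  double = ℕSolver.solve-∀
  ring₁ : ∀ x y b l d → (x +ᶻ l) -ᶻ (y +ᶻ (b +ᶻ d) +ᶻ 1ℤ) ≡ x +ᶻ l -ᶻ (y +ᶻ b) -ᶻ d -ᶻ 1ℤ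
  ring₁ = solve-∀
  ring₂ : ∀ x a l d → x +ᶻ l -ᶻ (x +ᶻ a +ᶻ 1ℤ) -ᶻ d -ᶻ 1ℤ ≡ l -ᶻ (+ 2 +ᶻ (a +ᶻ d))
  ring₂ = solve-∀
  eq′ : x +ᶻ + (2 * l) -ᶻ (y +ᶻ + (2 * (b + d)) +ᶻ 1ℤ) ≡ + (2 * l) -ᶻ + (2 + (2 * a + 2 * d))
  eq′ = trans (cong (λ z → x +ᶻ + (2 * l) -ᶻ (y +ᶻ + z +ᶻ 1ℤ)) (ℕ.*-distribˡ-+ 2 b d))
    (trans (ring₁ x y (+ (2 * b)) (+ (2 * l)) (+ (2 * d)))
    (trans (cong (λ z → x +ᶻ + (2 * l) -ᶻ z -ᶻ + (2 * d) -ᶻ 1ℤ) (sym eq))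
      (ring₂ x (+ (2 * a)) (+ (2 * l)) (+ (2 * d)))))

m∸[m∸n]≤n : ∀ m n → m ∸ (m ∸ n) ≤ n
m∸[m∸n]≤n m n = ℕ.m≤n+o⇒m∸n≤o m (m ∸ n) (ℕ.≤-trans (ℕ.m≤n+m∸n m n) (ℕ.≤-reflexive (ℕ.+-comm n (m ∸ n))))

m<n∸o⇒m+o<n : ∀ {m n o} → m < n ∸ o → m + o < n
m<n∸o⇒m+o<n {m} {n} {o} m< = ℕ.≤-trans (ℕ.+-monoˡ-≤ o m<) (ℕ.≤-reflexive (ℕ.m∸n+n≡m {n} {o} (ℕ.<⇒≤ (ℕ.≰⇒> λ n≤o → ℕ.n≮0 (ℕ.≤-trans m< (ℕ.≤-reflexive (ℕ.m≤n⇒m∸n≡0 n≤o)))))))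

module Change {n : ℕ} (μ ν : Vector ℕ n)
  (μ↓ : IsPartition μ) (μ₃ : NoThreeEqual μ) (ν↓ : IsPartition ν) (ν₃ : NoThreeEqual ν)
  (tableau : Shape.ShuffleTableau μ ν) (i : ℕ) (r₀ : Fin n) (k₀ : Fin (μ r₀ ∸ ν r₀))
  (lowerable : Tableau.Lowerable μ ν μ↓ μ₃ ν↓ ν₃ tableau i r₀ k₀) where
  open Shape μ ν
  open ShuffleTableau tableau using (contained; rows; columns) renaming (entry to T)
  open Strands μ ν
  open Values μ ν μ↓ μ₃ ν↓ ν₃ contained
  open Monotone tableau
  open Words μ ν
  open Tableau μ ν μ↓ μ₃ ν↓ ν₃ tableau i
  open Lowerable lowerable

  c : ℤ
  c = col (r₀ , k₀)

  c-parity : SameParity r₀ c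
  c-parity = square-parity (r₀ , k₀)

  at-x : At (suc i) r₀ c
  at-x = at-col (ℕ.≤-reflexive (sym Tx))

  ¬at-x : ¬ At (2 + i) r₀ c
  ¬at-x at = ℕ.<⇒≱ (ℕ.n<1+n (suc i)) (ℕ.≤-trans (at-square at) (ℕ.≤-reflexive Tx))

  ¬above-x : ∀ {r s} → r ⋖ s → s ⋖ r₀ → ¬ At i r c
  ¬above-x = opening-free Tx free

  below-x : ∀ {s u} → r₀ ⋖ s → s ⋖ u → At (2 + i) u c
  below-x r₀⋖s s⋖u = downward r₀⋖s s⋖u at-x

  col<⁻¹ : ∀ {r k l} → col (r , k) <ᶻ col (r , l) → toℕ k < toℕ l
  col<⁻¹ {r} {k} {l} lt = ℕ.≰⇒> λ l≤k → ℤ.<⇒≱ lt (col≤ {r} {l} l≤k)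

  ¬before-x : ∀ {e} → e <ᶻ c → ¬ At (suc i) r₀ e
  ¬before-x {e} e<c (inside l e≡ i<T) = ℕ.<⇒≱ i<T (leftmost l (col<⁻¹ {r₀} {l} {k₀} (subst (_<ᶻ c) e≡ e<c)))
  ¬before-x {e} e<c (beyond _ end<e)  = ℤ.<⇒≱ (ℤ.<-trans end<e e<c) (col≤end (r₀ , k₀))

  -- Column l carries a crossing of rows r₀ and s after which neither they nor their
  -- neighbours have one before x; for l = c the crossing is the one at x itself.
  record LeftEnd (s : Fin n) (l : ℤ) : Set where
    field
      l≤c   : l ≤ᶻ c
      at-l  : At i r₀ l
      low   : ¬ At (suc i) s (l -ᶻ 1ℤ)
      mid   : ∀ {e} → l <ᶻ e → e ≤ᶻ c → SameParity s (e -ᶻ 1ℤ) → At (suc i) s (e -ᶻ 1ℤ)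
      floor : ∀ {t} → s ⋖ t → At (2 + i) t l
      roof  : ∀ {t} → t ⋖ r₀ → l <ᶻ c → ¬ At i t (c -ᶻ 1ℤ)

  -- LeftEnd rotated by 180 degrees, with the roles of i and i + 1 exchanged.
  record RightEnd (r : Fin n) (h : ℤ) : Set where
    field
      c<h   : c <ᶻ h
      at-h  : At (suc i) r h
      high  : ¬ At (2 + i) r₀ (h -ᶻ 1ℤ)
      mid   : ∀ {e} → c <ᶻ e → e <ᶻ h → ¬ At (suc i) r e
      roof  : ∀ {t} → t ⋖ r → ¬ At i t (h -ᶻ 1ℤ)
      floor : ∀ {t} → r₀ ⋖ t → c +ᶻ 1ℤ <ᶻ h → At (2 + i) t (c +ᶻ 1ℤ)

  -- The i + 1 at (s , c - 1) is read before x, so it is matched with an i to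
  -- the left of x in row r₀; hence the run of i + 1 ending there is at most as long
  -- as the run of unoverlapped i ending next to x.
  left-staircase : ∀ {s} → r₀ ⋖ s → At (suc i) s (c -ᶻ 1ℤ) → ¬ At (2 + i) s (c -ᶻ 1ℤ) →
                   (∀ {t} → t ⋖ r₀ → ¬ At i t (c -ᶻ 1ℤ)) → ∃[ l ] (l <ᶻ c × LeftEnd s l)
  left-staircase {s} r₀⋖s at ¬at roof = go (exact at ¬at)
    where
    s-parity : SameParity s (c -ᶻ 1ℤ)
    s-parity = at-parity at
    go : ∃[ k ] (c -ᶻ 1ℤ ≡ col (s , k) × T (s , k) ≡ suc i) → ∃[ l ] (l <ᶻ c × LeftEnd s l)
    go (kA , c≡ , TA) = go′ (firstIndex (λ l → suc i ℕ.≤? T (s , l)) kA (ℕ.≤-reflexive (sym TA)))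
      where
      go′ : ∃[ k ] (suc i ≤ T (s , k) × (∀ l → toℕ l < toℕ k → ¬ suc i ≤ T (s , l))) → ∃[ l ] (l <ᶻ c × LeftEnd s l)
      go′ (k , T≥ , least) = decide (atLeast? T i r₀ l ×-dec Fin.all? (λ t → (s ⋖? t) →-dec atLeast? T (2 + i) t l))
        where
        m l : ℤ
        m = col (s , k)
        l = m -ᶻ 1ℤ
        k≤kA : toℕ k ≤ toℕ kA
        k≤kA = ℕ.≮⇒≥ λ kA<k → least kA kA<k (ℕ.≤-reflexive (sym TA))
        m≤ : m ≤ᶻ c -ᶻ 1ℤ
        m≤ = ℤ.≤-trans (col≤ {s} {k} k≤kA) (ℤ.≤-reflexive (sym c≡))
        l<c : l <ᶻ c
        l<c = ℤ.<-trans (i-1<i m) (≤-1⇒< m≤)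
        -- The run of i + 1 has `d + 1` squares, and `y` is the index of the first square of row r₀
        -- to the right of column `l`. Truncation at 0 is right too: then no square of the row lies
        -- at or left of `l`.
        d y : ℕ
        d = toℕ kA ∸ toℕ k
        y = toℕ k₀ ∸ d
        ¬before-m : ∀ {e} → e <ᶻ m → ¬ At (suc i) s e
        ¬before-m {e} e<m (inside l e≡ T≥) = least l (col<⁻¹ {s} {l} {k} (subst (_<ᶻ m) e≡ e<m)) T≥
        ¬before-m {e} e<m (beyond _ end<e) = ℤ.<⇒≱ (ℤ.<-trans end<e e<m) (col≤end (s , k))
        at-m : At (suc i) s m
        at-m = at-col T≥
        within-run : ∀ j → toℕ k ≤ toℕ j → toℕ j ≤ toℕ kA → letter i T (s , j) ≡ opening
        within-run j k≤j j≤kA = is-opening {s} {j}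
          (ℕ.≤-antisym (ℕ.≤-trans (rows (s , j) (s , kA) refl (col≤ {s} {j} j≤kA)) (ℕ.≤-reflexive TA))
                       (ℕ.≤-trans T≥ (rows (s , k) (s , j) refl (col≤ {s} {k} k≤j))))
          -- No member of the run is overlapped: what `roof` says at `c - 1` holds at all earlier
          -- columns of the same parity.
          λ {t} {r} t⋖r r⋖s → not-before {e = col (s , j)} {e′ = c -ᶻ 1ℤ}
            (roof (subst (t ⋖_) (⋖-injective r⋖s r₀⋖s) t⋖r))
            (parity-above {t} {r} {s} {c -ᶻ 1ℤ} t⋖r r⋖s s-parity)
            (ℤ.≤-trans (col≤ {s} {j} j≤kA) (ℤ.≤-reflexive (sym c≡)))
        right-of-run : ∀ j → toℕ kA < toℕ j → letter i T (s , j) ≢ closing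
        right-of-run j kA<j eq = ℕ.<⇒≱ (ℕ.≤-reflexive (cong suc (proj₁ (closing-letter {i} {T} {s , j} eq))))
          (ℕ.≤-trans (ℕ.≤-reflexive (sym TA)) (rows (s , kA) (s , j) refl (col≤ {s} {kA} (ℕ.<⇒≤ kA<j))))
        decide : Dec (At i r₀ l × (∀ t → s ⋖ t → At (2 + i) t l)) → ∃[ l ] (l <ᶻ c × LeftEnd s l)
        decide (yes (at-l , floor)) = l , l<c , record
          { l≤c   = ℤ.<⇒≤ l<c
          ; at-l  = at-l
          ; low   = ¬before-m (ℤ.<-trans (i-1<i l) (i-1<i m))
          ; mid   = λ {e} l<e _ par → rightward at-m
              (<⇒≤-1 (ℤ.≤∧≢⇒< (i-1<j⇒i≤j l<e) λ { refl → parity-⋖ l r₀⋖s (at-parity at-l) par })) par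
          ; floor = λ {t} → floor t
          ; roof  = λ t⋖r₀ _ → roof t⋖r₀
          }
        -- A closing at or left of column `l` in row r₀ would give both halves of `end`, by moving
        -- right to `l`. So only `d` squares remain to close the `d + 1` openings of the run.
        decide (no ¬end) = contradiction
          (ℕ.≤-trans (count-left {i} {T} {r₀} {s} {k₀} isolated r₀⋖s (toℕ k) kA y k≤kA (ℕ.m∸n≤m (toℕ k₀) d) within-run right-of-run inert)
            (m∸[m∸n]≤n (toℕ k₀) d))
          (ℕ.<⇒≱ (ℕ.≤-reflexive (sym (ℕ.+-∸-assoc 1 k≤kA))))
          where
          inert : ∀ j → toℕ j < y → letter i T (r₀ , j) ≢ closing
          inert j j<y eq = ¬end (at-l , λ t s⋖t → rightward (closing-free {r₀} {j} Tj ¬o r₀⋖s s⋖t) j≤l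
            (parity-t t s⋖t))
            where
            Tj : T (r₀ , j) ≡ i
            Tj = proj₁ (closing-letter {i} {T} {r₀ , j} eq)
            ¬o : ¬ InOverlap i T (r₀ , j)
            ¬o = proj₂ (closing-letter {i} {T} {r₀ , j} eq)
            j≤l : col (r₀ , j) ≤ᶻ l
            j≤l = staircase-≤ˡ (start r₀) (start s) {toℕ k₀} {toℕ k} {d} {toℕ j}
              (trans c≡ (cong (λ z → start s +ᶻ + (2 * z)) (sym (ℕ.m+[n∸m]≡n k≤kA)))) (m<n∸o⇒m+o<n {toℕ j} j<y)
            l-parity : SameParity r₀ l
            l-parity = parity-shift {s} {r₀} {m} {l} (+ 0) l-eq (square-parity (s , k))
              where
              ring : ∀ m x → m -ᶻ 1ℤ -ᶻ x ≡ m -ᶻ (1ℤ +ᶻ x) +ᶻ + 0 *ᶻ + 2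
              ring = solve-∀
              l-eq : m -ᶻ 1ℤ -ᶻ + rowNo r₀ ≡ m -ᶻ + rowNo s +ᶻ + 0 *ᶻ + 2
              l-eq = trans (ring m (+ rowNo r₀)) (cong (λ x → m -ᶻ + x +ᶻ + 0 *ᶻ + 2) (sym r₀⋖s))
            parity-t : ∀ t → s ⋖ t → SameParity t l
            parity-t t s⋖t = parity-⋖⋖ {r₀} {s} {t} {l} r₀⋖s s⋖t l-parity
            at-l : At i r₀ l
            at-l = rightward (at-col (ℕ.≤-reflexive (sym Tj))) j≤l l-parity

  -- `left-staircase` rotated: the run of unoverlapped i starting at `(r , c + 1)` is read after
  -- `x`, and no bracket may be matched across `x`, so its partners are openings right of `x` in row
  -- r₀.
  right-staircase : ∀ {r} → r ⋖ r₀ → At i r (c +ᶻ 1ℤ) → ¬ At (suc i) r (c +ᶻ 1ℤ) →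
                    (∀ {t} → r₀ ⋖ t → At (2 + i) t (c +ᶻ 1ℤ)) → ∃[ h ] (c +ᶻ 1ℤ <ᶻ h × RightEnd r h)
  right-staircase {r} r⋖r₀ at ¬at floor = go (exact at ¬at)
    where
    go : ∃[ k ] (c +ᶻ 1ℤ ≡ col (r , k) × T (r , k) ≡ i) → ∃[ h ] (c +ᶻ 1ℤ <ᶻ h × RightEnd r h)
    go (kB , c≡ , TB) = go′ (lastIndex (λ l → T (r , l) ℕ.≤? i) kB (ℕ.≤-reflexive TB))
      where
      go′ : ∃[ k ] (T (r , k) ≤ i × (∀ l → toℕ k < toℕ l → ¬ T (r , l) ≤ i)) → ∃[ h ] (c +ᶻ 1ℤ <ᶻ h × RightEnd r h)
      go′ (k , T≤ , greatest) = decide (¬? (atLeast? T (2 + i) r₀ (m +ᶻ 1ℤ)) ×-dec Fin.all? (λ t → (t ⋖? r) →-dec ¬? (atLeast? T i t (m +ᶻ 1ℤ))))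
        where
        m h : ℤ
        m = col (r , k)
        h = m +ᶻ 1ℤ +ᶻ 1ℤ
        kB≤k : toℕ kB ≤ toℕ k
        kB≤k = ℕ.≮⇒≥ λ k<kB → greatest kB k<kB (ℕ.≤-reflexive TB)
        ≤m : c +ᶻ 1ℤ ≤ᶻ m
        ≤m = ℤ.≤-trans (ℤ.≤-reflexive c≡) (col≤ {r} {kB} kB≤k)
        m<h : m <ᶻ h
        m<h = ℤ.<-trans (i<i+1 m) (i<i+1 (m +ᶻ 1ℤ))
        c+1<h : c +ᶻ 1ℤ <ᶻ h
        c+1<h = ℤ.≤-<-trans ≤m m<h
        d : ℕ
        d = toℕ k ∸ toℕ kB
        ¬at-m : ¬ At (suc i) r m
        ¬at-m at = ℕ.<⇒≱ (at-square at) T≤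
        h-parity : SameParity r h
        h-parity = parity-shift {r} {r} {m} {h} 1ℤ (ring m (+ rowNo r)) (square-parity (r , k))
          where
          ring : ∀ m x → m +ᶻ 1ℤ +ᶻ 1ℤ -ᶻ x ≡ m -ᶻ x +ᶻ 1ℤ *ᶻ + 2
          ring = solve-∀
        at-h : Location r h → At (suc i) r h
        at-h (before h<start _) = contradiction (start≤col (r , k)) (ℤ.<⇒≱ (ℤ.<-trans m<h h<start))
        at-h (within l h≡)      = inside l h≡ (ℕ.≰⇒> (greatest l (col<⁻¹ {r} {k} {l} (ℤ.<-≤-trans m<h (ℤ.≤-reflexive h≡)))))
        at-h (after end<h _)    = beyond h-parity end<h
        r₀-parity : SameParity r₀ (m +ᶻ 1ℤ)
        r₀-parity = parity-shift {r} {r₀} {m} {m +ᶻ 1ℤ} (+ 0)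
          (trans (cong (λ x → m +ᶻ 1ℤ -ᶻ + x) r⋖r₀) (ring m (+ rowNo r))) (square-parity (r , k))
          where
          ring : ∀ m x → m +ᶻ 1ℤ -ᶻ (1ℤ +ᶻ x) ≡ m -ᶻ x +ᶻ + 0 *ᶻ + 2
          ring = solve-∀
        within-run : ∀ j → toℕ kB ≤ toℕ j → toℕ j ≤ toℕ k → letter i T (r , j) ≡ closing
        within-run j kB≤j j≤k = is-closing {r} {j}
          (ℕ.≤-antisym (ℕ.≤-trans (rows (r , j) (r , k) refl (col≤ {r} {j} j≤k)) T≤)
                       (ℕ.≤-trans (ℕ.≤-reflexive (sym TB)) (rows (r , kB) (r , j) refl (col≤ {r} {kB} kB≤j))))
          λ {s} {t} r⋖s s⋖t → rightward (floor (subst (_⋖ t) (⋖-functional r⋖s r⋖r₀) s⋖t))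
            (ℤ.≤-trans (ℤ.≤-reflexive c≡) (col≤ {r} {kB} kB≤j))
            (parity-⋖⋖ {r} {s} {t} {col (r , j)} r⋖s s⋖t (square-parity (r , j)))
        left-of-run : ∀ j → toℕ j < toℕ kB → letter i T (r , j) ≢ opening
        left-of-run j j<kB eq = ℕ.<⇒≱ (ℕ.≤-reflexive (sym (proj₁ (opening-letter {i} {T} {r , j} eq))))
          (ℕ.≤-trans (rows (r , j) (r , kB) refl (col≤ {r} {j} (ℕ.<⇒≤ j<kB))) (ℕ.≤-reflexive TB))
        decide : Dec (¬ At (2 + i) r₀ (m +ᶻ 1ℤ) × (∀ t → t ⋖ r → ¬ At i t (m +ᶻ 1ℤ))) → ∃[ h ] (c +ᶻ 1ℤ <ᶻ h × RightEnd r h)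
        decide (yes (high , roof)) = h , c+1<h , record
          { c<h   = ℤ.<-trans (i<i+1 c) c+1<h
          ; at-h  = at-h (locate {r} {h} h-parity)
          ; high  = subst (λ e → ¬ At (2 + i) r₀ e) (sym (i+1-1≡i (m +ᶻ 1ℤ))) high
          ; mid   = λ {e} _ e<h at → not-before ¬at-m (square-parity (r , k))
              (<+1⇒≤ (ℤ.≤∧≢⇒< (<+1⇒≤ e<h) λ e≡ → parity-⋖ e r⋖r₀ (at-parity at) (subst (SameParity r₀) (sym e≡) r₀-parity))) at
          ; roof  = λ {t} t⋖r → subst (λ e → ¬ At i t e) (sym (i+1-1≡i (m +ᶻ 1ℤ))) (roof t t⋖r)
          ; floor = λ r₀⋖t _ → floor r₀⋖t
          }
        -- An opening at or right of column `m + 1` in row r₀ would give `high` by its entry and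
        -- `roof` by its freeness. So only the `d` squares next to `x` could match the `d + 1`
        -- closings.
        decide (no ¬end) = contradiction
          (count-right {i} {T} {r} {r₀} {k₀} isolated r⋖r₀ (toℕ kB) k d kB≤k within-run left-of-run inert)
          (ℕ.<⇒≱ (ℕ.≤-reflexive (sym (ℕ.+-∸-assoc 1 kB≤k))))
          where
          inert : ∀ j → suc (toℕ k₀) + d ≤ toℕ j → letter i T (r₀ , j) ≢ opening
          inert j far eq = ¬end ((λ at → ℕ.<⇒≱ (ℕ.n<1+n (suc i)) (ℕ.≤-trans (at-square (rightward at ≤j (square-parity (r₀ , j)))) (ℕ.≤-reflexive Tj))) ,
            λ t t⋖r at → opening-free {r₀} {j} Tj ¬o t⋖r r⋖r₀
              (rightward at ≤j (parity-above {t} {r} {r₀} {col (r₀ , j)} t⋖r r⋖r₀ (square-parity (r₀ , j)))))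
            where
            Tj : T (r₀ , j) ≡ suc i
            Tj = proj₁ (opening-letter {i} {T} {r₀ , j} eq)
            ¬o : ¬ InOverlap i T (r₀ , j)
            ¬o = proj₂ (opening-letter {i} {T} {r₀ , j} eq)
            ≤j : m +ᶻ 1ℤ ≤ᶻ col (r₀ , j)
            ≤j = ℤ.≤-trans (ℤ.≤-reflexive (cong (λ z → start r +ᶻ + (2 * z) +ᶻ 1ℤ) (sym (ℕ.m+[n∸m]≡n kB≤k))))
              (staircase-≤ʳ (start r₀) (start r) {toℕ k₀} {toℕ kB} {d} {toℕ j} c≡ far)

-- Lowering one square

-- The lower filling is given by its values rather than as an update: for `E` it is the updated
-- filling, while for `F` it is the original one and the tableau is the update.
module Invariance {n : ℕ} (μ ν : Vector ℕ n)
  (μ↓ : IsPartition μ) (μ₃ : NoThreeEqual μ) (ν↓ : IsPartition ν) (ν₃ : NoThreeEqual ν)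
  (tableau : Shape.ShuffleTableau μ ν) (i : ℕ) (r₀ : Fin n) (k₀ : Fin (μ r₀ ∸ ν r₀))
  (lowerable : Tableau.Lowerable μ ν μ↓ μ₃ ν↓ ν₃ tableau i r₀ k₀)
  (T′ : Shape.Filling μ ν) (T′x : T′ (r₀ , k₀) ≡ i)
  (same : ∀ s → s ≢ (r₀ , k₀) → T′ s ≡ Shape.ShuffleTableau.entry tableau s) where
  open Shape μ ν
  open ShuffleTableau tableau using (contained; rows; columns) renaming (entry to T)
  open Strands μ ν
  open Values μ ν μ↓ μ₃ ν↓ ν₃ contained
  open Monotone tableau
  open Tableau μ ν μ↓ μ₃ ν↓ ν₃ tableau i
  open Lowerable lowerable
  open Change μ ν μ↓ μ₃ ν↓ ν₃ tableau i r₀ k₀ lowerable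

  At′ : ℕ → Fin n → ℤ → Set
  At′ = AtLeast T′

  T′≤T : ∀ s → T′ s ≤ T s
  T′≤T s with s ≟□ (r₀ , k₀)
  ... | yes refl = ℕ.≤-trans (ℕ.≤-reflexive T′x) (ℕ.≤-trans (ℕ.n≤1+n i) (ℕ.≤-reflexive (sym Tx)))
  ... | no s≢x   = ℕ.≤-reflexive (same s s≢x)

  down : ∀ {t r e} → At′ t r e → At t r e
  down {r = r} (inside k eq le) = inside k eq (ℕ.≤-trans le (T′≤T (r , k)))
  down (beyond par lt)          = beyond par lt

  up : ∀ {t r e} → ¬ (r ≡ r₀ × e ≡ c) → At t r e → At′ t r e
  up _ (beyond par lt)             = beyond par lt
  up {r = r} away (inside k eq le) = inside k eq (ℕ.≤-trans le (ℕ.≤-reflexive (sym (same (r , k) λ { refl → away (refl , eq) }))))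

  up-i : ∀ {r e} → At i r e → At′ i r e
  up-i (beyond par lt)         = beyond par lt
  up-i {r} (inside k eq le) with (r , k) ≟□ (r₀ , k₀)
  ... | yes refl = inside k eq (ℕ.≤-reflexive (sym T′x))
  ... | no ≢x    = inside k eq (ℕ.≤-trans le (ℕ.≤-reflexive (sym (same (r , k) ≢x))))

  ¬at′-x : ¬ At′ (suc i) r₀ c
  ¬at′-x at = ℕ.<⇒≱ (ℕ.n<1+n i) (ℕ.≤-trans (at-square at) (ℕ.≤-reflexive T′x))

  value-same : ∀ {r e v} → ¬ (r ≡ r₀ × e ≡ c) → (Value T r e v → Value T′ r e v) × (Value T′ r e v → Value T r e v)
  value-same {r} {e} away = to , from
    where
    entry-same : ∀ k → e ≡ col (r , k) → T′ (r , k) ≡ T (r , k)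
    entry-same k eq = same (r , k) λ { refl → away (refl , eq) }
    to : ∀ {v} → Value T r e v → Value T′ r e v
    to (square k eq) = subst (λ v → Value T′ r e [ v ]) (entry-same k eq) (square k eq)
    to (left par lt)  = left par lt
    to (right par lt) = right par lt
    from : ∀ {v} → Value T′ r e v → Value T r e v
    from (square k eq) = subst (λ v → Value T r e [ v ]) (sym (entry-same k eq)) (square k eq)
    from (left par lt)  = left par lt
    from (right par lt) = right par lt

  value-lower : ∀ {r e v} → Value T r e v → ∃[ v′ ] (Value T′ r e v′ × v′ ≤± v)
  value-lower {r} (square k eq) = _ , square k eq , Ext.[ T′≤T (r , k) ]
  value-lower (left par lt)     = _ , left par lt , ⊥±≤ _
  value-lower (right par lt)    = _ , right par lt , _ ≤⊤±

  value-raise : ∀ {r e v} → Value T′ r e v → ∃[ v′ ] (Value T r e v′ × v ≤± v′)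
  value-raise {r} (square k eq) = _ , square k eq , Ext.[ T′≤T (r , k) ]
  value-raise (left par lt)     = _ , left par lt , ⊥±≤ _
  value-raise (right par lt)    = _ , right par lt , _ ≤⊤±

  -- Lowering `x` can only help the comparison when `x` is the lower left corner, and can only hurt
  -- it when `x` is the upper right one, which is excluded here.
  lower-replaced : ∀ {r s e} → ¬ (r ≡ r₀ × e ≡ c) → Replaced T r s e → Replaced T′ r s e
  lower-replaced {r} {s} {e} away u = record { Replaced u hiding (values) ; values = go (Replaced.values u) }
    where
    go : ∃[ x ] ∃[ y ] (Value T s (e -ᶻ 1ℤ) x × Value T r e y × x ≤± y) →
         ∃[ x ] ∃[ y ] (Value T′ s (e -ᶻ 1ℤ) x × Value T′ r e y × x ≤± y)
    go (x , y , vx , vy , x≤y) = let x′ , vx′ , x′≤x = value-lower vx in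
      x′ , y , vx′ , proj₁ (value-same away) vy , ≤±-trans ℕ.≤-trans x′≤x x≤y

  raise-replaced : ∀ {r s e} → ¬ (s ≡ r₀ × e -ᶻ 1ℤ ≡ c) → Replaced T′ r s e → Replaced T r s e
  raise-replaced {r} {s} {e} away u = record { Replaced u hiding (values) ; values = go (Replaced.values u) }
    where
    go : ∃[ x ] ∃[ y ] (Value T′ s (e -ᶻ 1ℤ) x × Value T′ r e y × x ≤± y) →
         ∃[ x ] ∃[ y ] (Value T s (e -ᶻ 1ℤ) x × Value T r e y × x ≤± y)
    go (x , y , vx , vy , x≤y) = let y′ , vy′ , y≤y′ = value-raise vy in
      x , y′ , proj₂ (value-same away) vx , vy′ , ≤±-trans ℕ.≤-trans x≤y y≤y′

  -- The meeting point of the two graphs: from `T` at most the crossing at `c` is lost, from `T′` at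
  -- most the one at `c + 1`.
  Shared : Crossings
  Shared r s e = Replaced T r s e × Replaced T′ r s e

  joins-map : ∀ {U V} → (∀ {r s e} → U r s e → V r s e) → (∀ {r s e} → V r s e → U r s e) →
              Joins (EdgeOf U) ⇔ Joins (EdgeOf V)
  joins-map to from = Eq.map (edge to from) , Eq.map (edge from to)
    where
    edge : ∀ {U V} → (∀ {r s e} → U r s e → V r s e) → (∀ {r s e} → V r s e → U r s e) →
           ∀ {v w} → EdgeOf U v w → EdgeOf V v w
    edge to from (horizontal a b ¬u) = horizontal a b λ where
      (s , inj₁ u) → ¬u (s , inj₁ (from u))
      (s , inj₂ u) → ¬u (s , inj₂ (from u))
    edge to from (verticalˡ u) = verticalˡ (to u)
    edge to from (verticalʳ u) = verticalʳ (to u)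

  c+1-1 : c +ᶻ 1ℤ -ᶻ 1ℤ ≡ c
  c+1-1 = i+1-1≡i c

  c<c+1 : c <ᶻ c +ᶻ 1ℤ
  c<c+1 = i<i+1 c

  c-1<c : c -ᶻ 1ℤ <ᶻ c
  c-1<c = i-1<i c

  c+2 : ℤ
  c+2 = c +ᶻ 1ℤ +ᶻ 1ℤ

  c+1<c+2 : c +ᶻ 1ℤ <ᶻ c+2
  c+1<c+2 = i<i+1 (c +ᶻ 1ℤ)

  between : ∀ {x e} → x <ᶻ e → e <ᶻ x +ᶻ 1ℤ +ᶻ 1ℤ → e ≡ x +ᶻ 1ℤ
  between x<e e<x+2 = ℤ.≤-antisym (<+1⇒≤ e<x+2) (<⇒+1≤ x<e)

  between-1 : ∀ {e} → c -ᶻ 1ℤ <ᶻ e → e <ᶻ c +ᶻ 1ℤ → e ≡ c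
  between-1 c-1<e e<c+1 = ℤ.≤-antisym (<+1⇒≤ e<c+1) (i-1<j⇒i≤j c-1<e)

  at-c+2 : At (suc i) r₀ c+2
  at-c+2 = rightward at-x (ℤ.<⇒≤ (ℤ.<-trans c<c+1 c+1<c+2)) (parity-shift {r₀} {r₀} {c} {c+2} 1ℤ (ring c (+ rowNo r₀)) c-parity)
    where
    ring : ∀ m x → m +ᶻ 1ℤ +ᶻ 1ℤ -ᶻ x ≡ m -ᶻ x +ᶻ 1ℤ *ᶻ + 2
    ring = solve-∀

  parity-left : ∀ {r s e} → r ⋖ s → SameParity s e → SameParity r (e -ᶻ 1ℤ)
  parity-left {r} {s} {e} r⋖s = parity-shift {s} {r} {e} {e -ᶻ 1ℤ} (+ 0)
    (trans (ring e (+ rowNo r)) (cong (λ x → e -ᶻ + x +ᶻ + 0 *ᶻ + 2) (sym r⋖s)))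
    where
    ring : ∀ e x → e -ᶻ 1ℤ -ᶻ x ≡ e -ᶻ (1ℤ +ᶻ x) +ᶻ + 0 *ᶻ + 2
    ring = solve-∀

  parity-right : ∀ {r s e} → r ⋖ s → SameParity s e → SameParity r (e +ᶻ 1ℤ)
  parity-right {r} {s} {e} r⋖s = parity-shift {s} {r} {e} {e +ᶻ 1ℤ} 1ℤ
    (trans (ring e (+ rowNo r)) (cong (λ x → e -ᶻ + x +ᶻ 1ℤ *ᶻ + 2) (sym r⋖s)))
    where
    ring : ∀ e x → e +ᶻ 1ℤ -ᶻ x ≡ e -ᶻ (1ℤ +ᶻ x) +ᶻ 1ℤ *ᶻ + 2
    ring = solve-∀

  parity-below-right : ∀ {r s e} → r ⋖ s → SameParity r e → SameParity s (e +ᶻ 1ℤ)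
  parity-below-right {r} {s} {e} r⋖s = parity-shift {r} {s} {e} {e +ᶻ 1ℤ} (+ 0)
    (trans (cong (λ x → e +ᶻ 1ℤ -ᶻ + x) r⋖s) (ring e (+ rowNo r)))
    where
    ring : ∀ e x → e +ᶻ 1ℤ -ᶻ (1ℤ +ᶻ x) ≡ e -ᶻ x +ᶻ + 0 *ᶻ + 2
    ring = solve-∀

  -- The staircase of no steps. Nothing is known here about the row above at `c - 1`; the guard
  -- `l <ᶻ c` in `roof` is there for this case.
  left-end-x : ∀ {s} → r₀ ⋖ s → ¬ At (suc i) s (c -ᶻ 1ℤ) → LeftEnd s c
  left-end-x r₀⋖s ¬at = record
    { l≤c   = ℤ.≤-refl
    ; at-l  = lower-threshold (ℕ.n≤1+n i) at-x
    ; low   = ¬at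
    ; mid   = λ c<e e≤c _ → contradiction e≤c (ℤ.<⇒≱ c<e)
    ; floor = λ s⋖t → below-x r₀⋖s s⋖t
    ; roof  = λ _ c<c → contradiction c<c (ℤ.<-irrefl refl)
    }

  right-end-x : ∀ {r} → r ⋖ r₀ → At (suc i) r (c +ᶻ 1ℤ) → RightEnd r (c +ᶻ 1ℤ)
  right-end-x r⋖r₀ at = record
    { c<h   = c<c+1
    ; at-h  = at
    ; high  = subst (λ e → ¬ At (2 + i) r₀ e) (sym c+1-1) ¬at-x
    ; mid   = λ c<e e<c+1 → contradiction (<+1⇒≤ e<c+1) (ℤ.<⇒≱ c<e)
    ; roof  = λ {t} t⋖r → subst (λ e → ¬ At i t e) (sym c+1-1) (¬above-x t⋖r r⋖r₀)
    ; floor = λ _ lt → contradiction lt (ℤ.<-irrefl refl)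
    }

  -- The crossing of rows r₀ and s₀ at x disappears.
  module Lowering {s₀} (r₀⋖s₀ : r₀ ⋖ s₀) (at-A : At (suc i) s₀ (c -ᶻ 1ℤ)) (¬at-A : ¬ At (2 + i) s₀ (c -ᶻ 1ℤ)) where

    ¬low-x : ¬ Replaced T′ r₀ s₀ c
    ¬low-x = no-cross {t = suc i} refl (up (λ eqs → ⋖-irrefl (subst (r₀ ⋖_) (proj₁ eqs) r₀⋖s₀)) at-A) ¬at′-x

    removal : Remove (Replaced T) Shared r₀ s₀ c
    removal = record
      { present = cross {t = suc i} r₀⋖s₀ refl at-x ¬at-A
      ; absent  = λ u → ¬low-x (proj₂ u)
      ; weaken  = proj₁
      ; others  = others
      }
      where
      others : ∀ {r s e} → Replaced T r s e → Shared r s e ⊎ (r ≡ r₀ × s ≡ s₀ × e ≡ c)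
      others {r} {s} {e} u with r Fin.≟ r₀ ×-dec e ℤ.≟ c
      ... | yes (refl , refl) = inj₂ (refl , ⋖-functional (Replaced.adjacent u) r₀⋖s₀ , refl)
      ... | no away           = inj₁ (u , lower-replaced away u)

    open Removal replaced-site removal

    from-left-end : ∀ {l} → l <ᶻ c → LeftEnd s₀ l → Preserved
    from-left-end {l} l<c end = remove-barʳ record
      { l<h    = l<c
      ; barˡ   = cross {t = i} r₀⋖s₀ refl at-l low
      ; barʳ   = Remove.present removal
      ; middle = λ {e} l<e e<c u → no-cross {t = suc i} refl
          (mid l<e (ℤ.<⇒≤ e<c) (parity-below {r₀} {s₀} {e} r₀⋖s₀ (Replaced.parity u))) (¬before-x e<c) u
      ; above  = λ {e} {t} l<e e<c u → let t⋖r₀ = Replaced.adjacent (proj₁ u) in no-cross {t = i} refl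
          (rightward at-l (<⇒≤-1 l<e) (parity-below {t} {r₀} {e} t⋖r₀ (Replaced.parity (proj₁ u))))
          (not-before (roof t⋖r₀ l<c) (parity-left {t} {r₀} {c} t⋖r₀ c-parity) (<⇒≤-1 e<c)) (proj₁ u)
      ; below  = λ {e} {t} l<e e<c u → let s₀⋖t = Replaced.adjacent (proj₁ u) in no-cross {t = 2 + i} refl
          (rightward (floor s₀⋖t) (<⇒≤-1 l<e) (parity-below {s₀} {t} {e} s₀⋖t (Replaced.parity (proj₁ u))))
          (not-before ¬at-A (at-parity at-A) (<⇒≤-1 e<c)) (proj₁ u)
      }
      where open LeftEnd end

    module Overlapped {r} (r⋖r₀ : r ⋖ r₀) (at-r : At i r (c -ᶻ 1ℤ)) where

      from-right-end : ∀ {h} → RightEnd r h → Preserved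
      from-right-end {h} end = remove-below {a = r} {l = c -ᶻ 1ℤ} record
        { l<h    = ℤ.<-trans c-1<c c<h
        ; barˡ   = cross {t = i} r⋖r₀ refl at-r (¬before-x (ℤ.<-trans (i-1<i (c -ᶻ 1ℤ)) c-1<c))
        ; barʳ   = cross {t = suc i} r⋖r₀ refl at-h high
        ; middle = λ {e} c-1<e e<h u →
            -- Column `c` itself is excluded by parity; from there on the i + 1 at `x` stands to the
            -- left of or at `e - 1`, above all entries of row `r` before `h`.
            let c<e = ℤ.≤∧≢⇒< (i-1<j⇒i≤j c-1<e) λ { refl → parity-⋖ c r⋖r₀ (Replaced.parity u) c-parity } in
            no-cross {t = suc i} refl
              (rightward at-x (<⇒≤-1 c<e) (parity-below {r} {r₀} {e} r⋖r₀ (Replaced.parity u))) (mid c<e e<h) u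
        ; above  = λ {e} {t} c-1<e e<h u → let t⋖r = Replaced.adjacent (proj₁ u) in no-cross {t = i} refl
            (rightward at-r (<⇒≤-1 c-1<e) (parity-below {t} {r} {e} t⋖r (Replaced.parity (proj₁ u))))
            (not-before (roof t⋖r) (parity-left {t} {r} {h} t⋖r (at-parity at-h)) (<⇒≤-1 e<h)) (proj₁ u)
        ; below  = below
        } c-1<c c<h
        where
        open RightEnd end
        below : ∀ {e t} → c -ᶻ 1ℤ <ᶻ e → e <ᶻ h → ¬ Shared r₀ t e
        below {e} {t} c-1<e e<h u = go (e ℤ.≟ c)
          where
          r₀⋖t : r₀ ⋖ t
          r₀⋖t = Replaced.adjacent (proj₁ u)
          go : ¬ Dec (e ≡ c)
          go (yes refl) = ¬low-x (subst (λ t → Replaced T′ r₀ t c) (⋖-functional r₀⋖t r₀⋖s₀) (proj₂ u))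
          go (no e≢c) = no-cross {t = 2 + i} refl
            (rightward (floor r₀⋖t (ℤ.<-trans c+1<e e<h)) (<⇒≤-1 c+1<e) (parity-below {r₀} {t} {e} r₀⋖t e-parity))
            (not-before high (parity-below {r} {r₀} {h} r⋖r₀ (at-parity at-h)) (<⇒≤-1 e<h)) (proj₁ u)
            where
            e-parity : SameParity r₀ e
            e-parity = Replaced.parity (proj₁ u)
            c<e : c <ᶻ e
            c<e = ℤ.≤∧≢⇒< (i-1<j⇒i≤j c-1<e) (e≢c ∘ sym)
            c+1<e : c +ᶻ 1ℤ <ᶻ e
            c+1<e = ℤ.≤∧≢⇒< (<⇒+1≤ c<e) λ { refl → parity-⋖ (c +ᶻ 1ℤ) r₀⋖t e-parity (parity-below-right {r₀} {t} {c} r₀⋖t c-parity) }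

      next-overlapped : ¬ At (suc i) r (c +ᶻ 1ℤ) → ¬ At (2 + i) s₀ (c +ᶻ 1ℤ) → Preserved
      next-overlapped ¬at-r ¬at-s = remove-barˡ {h = c+2} record
        { l<h    = ℤ.<-trans c<c+1 c+1<c+2
        ; barˡ   = Remove.present removal
        ; barʳ   = cross {t = suc i} r₀⋖s₀ (sym (i+1-1≡i (c +ᶻ 1ℤ))) at-c+2 ¬at-s
        ; middle = λ c<e e<c+2 u → parity-⋖ (c +ᶻ 1ℤ) r₀⋖s₀
            (subst (SameParity r₀) (between c<e e<c+2) (Replaced.parity u)) (parity-below-right {r₀} {s₀} {c} r₀⋖s₀ c-parity)
        ; above  = λ {e} {t} c<e e<c+2 u → no-cross {t = suc i} (sym c+1-1) at-x ¬at-r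
            (subst₂′ (⋖-injective (Replaced.adjacent (proj₁ u)) r⋖r₀) (between c<e e<c+2) (proj₁ u))
        ; below  = λ {e} {t} c<e e<c+2 u → no-cross {t = 2 + i} (sym c+1-1)
            (below-x r₀⋖s₀ (Replaced.adjacent (proj₁ u))) ¬at-s
            (subst (Replaced T s₀ t) (between c<e e<c+2) (proj₁ u))
        }
        where
        subst₂′ : ∀ {t t′ e e′} → t ≡ t′ → e ≡ e′ → Replaced T t r₀ e → Replaced T t′ r₀ e′
        subst₂′ refl refl u = u

    preserved : Preserved
    preserved = unov? (Fin.any? (λ r → (r ⋖? r₀) ×-dec atLeast? T i r (c -ᶻ 1ℤ)))
      where
      unov? : Dec (∃[ r ] (r ⋖ r₀ × At i r (c -ᶻ 1ℤ))) → Preserved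
      unov? (no ¬above) = let l , l<c , end = left-staircase r₀⋖s₀ at-A ¬at-A (λ {t} t⋖r₀ at → ¬above (t , t⋖r₀ , at)) in
        from-left-end l<c end
      unov? (yes (r , r⋖r₀ , at-r)) = next? (atLeast? T (suc i) r (c +ᶻ 1ℤ)) (atLeast? T (2 + i) s₀ (c +ᶻ 1ℤ))
        where
        open Overlapped r⋖r₀ at-r
        next? : Dec (At (suc i) r (c +ᶻ 1ℤ)) → Dec (At (2 + i) s₀ (c +ᶻ 1ℤ)) → Preserved
        -- If `(r , c + 1)` reaches i + 1, rows `r` and r₀ cross there and close the frame.
        -- Otherwise its value is i. Then either `(s₀ , c + 1)` misses i + 2 and rows r₀ and s₀
        -- cross again at `c + 2`, or it supplies the `floor` for the staircase.
        next? (yes at-next) _         = from-right-end (right-end-x r⋖r₀ at-next)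
        next? (no ¬at-next) (no ¬at)  = next-overlapped ¬at-next ¬at
        next? (no ¬at-next) (yes at)  = from-right-end (proj₂ (proj₂ (right-staircase r⋖r₀
          (rightward at-r (ℤ.<⇒≤ (ℤ.<-trans c-1<c c<c+1)) (parity-right {r} {r₀} {c} r⋖r₀ c-parity)) ¬at-next
          λ {t} r₀⋖t → subst (λ t → At (2 + i) t (c +ᶻ 1ℤ)) (⋖-functional r₀⋖s₀ r₀⋖t) at)))

  -- A crossing of rows r₁ and r₀ appears to the right of x.
  module Raising {r₁} (r₁⋖r₀ : r₁ ⋖ r₀) (at-B : At i r₁ (c +ᶻ 1ℤ)) (¬at-B : ¬ At (suc i) r₁ (c +ᶻ 1ℤ)) where

    ¬high-x : ¬ Replaced T r₁ r₀ (c +ᶻ 1ℤ)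
    ¬high-x = no-cross {t = suc i} (sym c+1-1) at-x ¬at-B

    off-x : ∀ {r e} → c <ᶻ e → ¬ (r ≡ r₀ × e ≡ c)
    off-x c<e (_ , refl) = ℤ.<-irrefl refl c<e

    removal : Remove (Replaced T′) Shared r₁ r₀ (c +ᶻ 1ℤ)
    removal = record
      { present = cross {t = i} r₁⋖r₀ (sym c+1-1) (up-i at-B) ¬at′-x
      ; absent  = λ u → ¬high-x (proj₁ u)
      ; weaken  = proj₂
      ; others  = others
      }
      where
      others : ∀ {r s e} → Replaced T′ r s e → Shared r s e ⊎ (r ≡ r₁ × s ≡ r₀ × e ≡ c +ᶻ 1ℤ)
      others {r} {s} {e} u with s Fin.≟ r₀ ×-dec (e -ᶻ 1ℤ) ℤ.≟ c
      ... | yes (refl , e-1≡c) = inj₂ (⋖-injective (Replaced.adjacent u) r₁⋖r₀ , refl , trans (sym (i-1+1≡i e)) (cong (_+ᶻ 1ℤ) e-1≡c))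
      ... | no away            = inj₁ (raise-replaced away u , u)

    open Removal replaced-site removal

    from-right-end : ∀ {h} → c +ᶻ 1ℤ <ᶻ h → RightEnd r₁ h → Preserved
    from-right-end {h} c+1<h end = remove-barˡ {h = h} record
      { l<h    = c+1<h
      ; barˡ   = Remove.present removal
      ; barʳ   = cross {t = suc i} r₁⋖r₀ refl (up (off-x c<h) at-h) (high ∘ down)
      ; middle = λ {e} c+1<e e<h u → no-cross {t = suc i} refl
          (up (off-x (ℤ.<-≤-trans c<c+1 (<⇒≤-1 c+1<e)))
            (rightward at-x (ℤ.≤-trans (ℤ.<⇒≤ c<c+1) (<⇒≤-1 c+1<e)) (parity-below {r₁} {r₀} {e} r₁⋖r₀ (Replaced.parity u))))
          (mid (ℤ.<-trans c<c+1 c+1<e) e<h ∘ down) u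
      ; above  = λ {e} {t} c+1<e e<h u → let t⋖r₁ = Replaced.adjacent (proj₁ u) in no-cross {t = i} refl
          (rightward at-B (<⇒≤-1 c+1<e) (parity-below {t} {r₁} {e} t⋖r₁ (Replaced.parity (proj₁ u))))
          (not-before (roof t⋖r₁) (parity-left {t} {r₁} {h} t⋖r₁ (at-parity at-h)) (<⇒≤-1 e<h)) (proj₁ u)
      ; below  = λ {e} {t} c+1<e e<h u → let r₀⋖t = Replaced.adjacent (proj₁ u) in no-cross {t = 2 + i} refl
          (rightward (floor r₀⋖t c+1<h) (<⇒≤-1 c+1<e) (parity-below {r₀} {t} {e} r₀⋖t (Replaced.parity (proj₁ u))))
          (not-before high (parity-below {r₁} {r₀} {h} r₁⋖r₀ (at-parity at-h)) (<⇒≤-1 e<h)) (proj₁ u)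
      }
      where open RightEnd end

    module Overlapped {s} (r₀⋖s : r₀ ⋖ s) (¬at-s : ¬ At (2 + i) s (c +ᶻ 1ℤ)) where

      s≢r₀ : s ≢ r₀
      s≢r₀ refl = ⋖-irrefl r₀⋖s

      from-left-end : ∀ {l} → LeftEnd s l → Preserved
      from-left-end {l} end = remove-above {b = s} {h = c+2} record
        { l<h    = ℤ.<-trans l<c+1 c+1<c+2
        ; barˡ   = cross {t = i} r₀⋖s refl (up-i at-l) (low ∘ down)
        ; barʳ   = cross {t = suc i} r₀⋖s (sym (i+1-1≡i (c +ᶻ 1ℤ))) (up (off-x (ℤ.<-trans c<c+1 c+1<c+2)) at-c+2) (¬at-s ∘ down)
        ; middle = middle
        ; above  = above
        ; below  = λ {e} {t} l<e e<c+2 u → let s⋖t = Replaced.adjacent (proj₁ u) in no-cross {t = 2 + i} refl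
            (rightward (floor s⋖t) (<⇒≤-1 l<e) (parity-below {s} {t} {e} s⋖t (Replaced.parity (proj₁ u))))
            (not-before ¬at-s (parity-below-right {r₀} {s} {c} r₀⋖s c-parity) (<+1⇒≤ e<c+2)) (proj₁ u)
        } l<c+1 c+1<c+2
        where
        open LeftEnd end
        l<c+1 : l <ᶻ c +ᶻ 1ℤ
        l<c+1 = ℤ.≤-<-trans l≤c c<c+1
        middle : ∀ {e} → l <ᶻ e → e <ᶻ c+2 → ¬ Replaced T′ r₀ s e
        middle {e} l<e e<c+2 u = no-cross {t = suc i} refl
          (up (s≢r₀ ∘ proj₁) (mid l<e e≤c (parity-below {r₀} {s} {e} r₀⋖s (Replaced.parity u)))) (¬at-e (e ℤ.≟ c)) u
          where
          e≤c : e ≤ᶻ c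
          e≤c = <+1⇒≤ (ℤ.≤∧≢⇒< (<+1⇒≤ e<c+2) λ { refl →
            parity-⋖ (c +ᶻ 1ℤ) r₀⋖s (Replaced.parity u) (parity-below-right {r₀} {s} {c} r₀⋖s c-parity) })
          ¬at-e : Dec (e ≡ c) → ¬ At′ (suc i) r₀ e
          ¬at-e (yes refl) = ¬at′-x
          ¬at-e (no e≢c)   = ¬before-x (ℤ.≤∧≢⇒< e≤c e≢c) ∘ down
        above : ∀ {e t} → l <ᶻ e → e <ᶻ c+2 → ¬ Shared t r₀ e
        above {e} {t} l<e e<c+2 u = go (e ℤ.≟ c +ᶻ 1ℤ)
          where
          t⋖r₀ : t ⋖ r₀
          t⋖r₀ = Replaced.adjacent (proj₁ u)
          e-parity : SameParity t e
          e-parity = Replaced.parity (proj₁ u)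
          go : ¬ Dec (e ≡ c +ᶻ 1ℤ)
          go (yes refl)  = ¬high-x (subst (λ t → Replaced T t r₀ (c +ᶻ 1ℤ)) (⋖-injective t⋖r₀ r₁⋖r₀) (proj₁ u))
          go (no e≢c+1) = no-cross {t = i} refl
            (rightward at-l (<⇒≤-1 l<e) (parity-below {t} {r₀} {e} t⋖r₀ e-parity))
            (not-before (roof t⋖r₀ (ℤ.<-trans l<e e<c)) (parity-left {t} {r₀} {c} t⋖r₀ c-parity) (<⇒≤-1 e<c)) (proj₁ u)
            where
            e<c : e <ᶻ c
            e<c = ℤ.≤∧≢⇒< (<+1⇒≤ (ℤ.≤∧≢⇒< (<+1⇒≤ e<c+2) e≢c+1)) λ { refl → parity-⋖ c t⋖r₀ e-parity c-parity }

      previous-overlapped : At (suc i) s (c -ᶻ 1ℤ) → At i r₁ (c -ᶻ 1ℤ) → Preserved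
      previous-overlapped at-s at-r = remove-barʳ {l = c -ᶻ 1ℤ} record
        { l<h    = ℤ.<-trans c-1<c c<c+1
        ; barˡ   = cross {t = i} r₁⋖r₀ refl (up-i at-r) (¬before-x (ℤ.<-trans (i-1<i (c -ᶻ 1ℤ)) c-1<c) ∘ down)
        ; barʳ   = Remove.present removal
        ; middle = λ c-1<e e<c+1 u → parity-⋖ c r₁⋖r₀
            (subst (SameParity r₁) (between-1 c-1<e e<c+1) (Replaced.parity u)) c-parity
        ; above  = λ {e} {t} c-1<e e<c+1 u → no-cross {t = i} refl at-r
            (¬above-x (Replaced.adjacent (proj₁ u)) r₁⋖r₀)
            (subst (Replaced T t r₁) (between-1 c-1<e e<c+1) (proj₁ u))
        ; below  = λ {e} {t} c-1<e e<c+1 u → no-cross {t = suc i} refl (up (s≢r₀ ∘ proj₁) at-s) ¬at′-x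
            (subst₂′ (⋖-functional (Replaced.adjacent (proj₁ u)) r₀⋖s) (between-1 c-1<e e<c+1) (proj₂ u))
        }
        where
        subst₂′ : ∀ {t t′ e e′} → t ≡ t′ → e ≡ e′ → Replaced T′ r₀ t e → Replaced T′ r₀ t′ e′
        subst₂′ refl refl u = u

    preserved : Preserved
    preserved = ov? (Fin.any? (λ s → (r₀ ⋖? s) ×-dec ¬? (atLeast? T (2 + i) s (c +ᶻ 1ℤ))))
      where
      ov? : Dec (∃[ s ] (r₀ ⋖ s × ¬ At (2 + i) s (c +ᶻ 1ℤ))) → Preserved
      ov? (no ¬below) = let h , c+1<h , end = right-staircase r₁⋖r₀ at-B ¬at-B floor in from-right-end c+1<h end
        where
        floor : ∀ {t} → r₀ ⋖ t → At (2 + i) t (c +ᶻ 1ℤ)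
        floor {t} r₀⋖t = Dec.decidable-stable (atLeast? T (2 + i) t (c +ᶻ 1ℤ)) λ ¬at → ¬below (t , r₀⋖t , ¬at)
      ov? (yes (s , r₀⋖s , ¬at-s)) = previous? (atLeast? T (suc i) s (c -ᶻ 1ℤ)) (atLeast? T i r₁ (c -ᶻ 1ℤ))
        where
        open Overlapped r₀⋖s ¬at-s
        previous? : Dec (At (suc i) s (c -ᶻ 1ℤ)) → Dec (At i r₁ (c -ᶻ 1ℤ)) → Preserved
        -- If `(s , c - 1)` misses i + 1, rows r₀ and `s` cross already at `c`. Otherwise its value
        -- is i + 1. Then either `(r₁ , c - 1)` reaches i and rows r₁ and r₀ cross there, or its
        -- failure to do so is the `roof` for the staircase.
        previous? (no ¬at)  _          = from-left-end (left-end-x r₀⋖s ¬at)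
        previous? (yes at)  (yes at-r) = previous-overlapped at at-r
        previous? (yes at)  (no ¬at-r) = from-left-end (proj₂ (proj₂ (left-staircase r₀⋖s at
          (not-before ¬at-s (parity-below-right {r₀} {s} {c} r₀⋖s c-parity) (ℤ.<⇒≤ (ℤ.<-trans c-1<c c<c+1)))
          λ {t} t⋖r₀ → subst (λ t → ¬ At i t (c -ᶻ 1ℤ)) (⋖-injective r₁⋖r₀ t⋖r₀) ¬at-r)))

  -- A crossing with `x` as its upper right corner compares `(s , c - 1)` with i + 1 before and with
  -- i after, so it is lost only when that value is exactly i + 1.
  high⇔shared : Joins (EdgeOf (Replaced T)) ⇔ Joins (EdgeOf Shared)
  high⇔shared = go (Fin.any? (λ s → (r₀ ⋖? s) ×-dec (atLeast? T (suc i) s (c -ᶻ 1ℤ) ×-dec ¬? (atLeast? T (2 + i) s (c -ᶻ 1ℤ)))))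
    where
    go : Dec (∃[ s ] (r₀ ⋖ s × At (suc i) s (c -ᶻ 1ℤ) × ¬ At (2 + i) s (c -ᶻ 1ℤ))) →
         Joins (EdgeOf (Replaced T)) ⇔ Joins (EdgeOf Shared)
    go (yes (s , r₀⋖s , at , ¬at)) = Lowering.preserved r₀⋖s at ¬at
    go (no ¬A) = joins-map (λ u → u , both u) proj₁
      where
      both : ∀ {r s e} → Replaced T r s e → Replaced T′ r s e
      both {r} {s} {e} u = at-x? (r Fin.≟ r₀ ×-dec e ℤ.≟ c)
        where
        at-x? : Dec (r ≡ r₀ × e ≡ c) → Replaced T′ r s e
        at-x? (no away) = lower-replaced away u
        at-x? (yes (refl , refl)) = below? (atLeast? T (suc i) s (c -ᶻ 1ℤ)) (atLeast? T (2 + i) s (c -ᶻ 1ℤ))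
          where
          below? : Dec (At (suc i) s (c -ᶻ 1ℤ)) → Dec (At (2 + i) s (c -ᶻ 1ℤ)) → Replaced T′ r₀ s c
          below? (no ¬at) _        = cross {t = i} (Replaced.adjacent u) refl (up-i (lower-threshold (ℕ.n≤1+n i) at-x)) (¬at ∘ down)
          below? (yes _) (yes at)  = contradiction u (no-cross {t = 2 + i} refl at ¬at-x)
          below? (yes at) (no ¬at) = contradiction (s , Replaced.adjacent u , at , ¬at) ¬A

  -- A crossing with `x` as its lower left corner appears only when the value at `(r , c + 1)` is
  -- exactly i.
  low⇔shared : Joins (EdgeOf (Replaced T′)) ⇔ Joins (EdgeOf Shared)
  low⇔shared = go (Fin.any? (λ r → (r ⋖? r₀) ×-dec (atLeast? T i r (c +ᶻ 1ℤ) ×-dec ¬? (atLeast? T (suc i) r (c +ᶻ 1ℤ)))))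
    where
    go : Dec (∃[ r ] (r ⋖ r₀ × At i r (c +ᶻ 1ℤ) × ¬ At (suc i) r (c +ᶻ 1ℤ))) →
         Joins (EdgeOf (Replaced T′)) ⇔ Joins (EdgeOf Shared)
    go (yes (r , r⋖r₀ , at , ¬at)) = Raising.preserved r⋖r₀ at ¬at
    go (no ¬B) = joins-map (λ u → both u , u) proj₂
      where
      both : ∀ {r s e} → Replaced T′ r s e → Replaced T r s e
      both {r} {s} {e} u = at-x? (s Fin.≟ r₀ ×-dec (e -ᶻ 1ℤ) ℤ.≟ c)
        where
        at-x? : Dec (s ≡ r₀ × e -ᶻ 1ℤ ≡ c) → Replaced T r s e
        at-x? (no away) = raise-replaced away u
        at-x? (yes (refl , e-1≡c)) = subst (Replaced T r r₀) (sym e≡c+1) (above? (atLeast? T i r (c +ᶻ 1ℤ)) (atLeast? T (suc i) r (c +ᶻ 1ℤ)))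
          where
          e≡c+1 : e ≡ c +ᶻ 1ℤ
          e≡c+1 = trans (sym (i-1+1≡i e)) (cong (_+ᶻ 1ℤ) e-1≡c)
          above? : Dec (At i r (c +ᶻ 1ℤ)) → Dec (At (suc i) r (c +ᶻ 1ℤ)) → Replaced T r r₀ (c +ᶻ 1ℤ)
          above? _         (yes at) = cross {t = suc i} (Replaced.adjacent u) (sym c+1-1) at ¬at-x
          above? (yes at)  (no ¬at) = contradiction (r , Replaced.adjacent u , at , ¬at) ¬B
          above? (no ¬at)  (no _)   = contradiction (subst (Replaced T′ r r₀) e≡c+1 u)
            (no-cross {t = i} (sym c+1-1) (up-i (lower-threshold (ℕ.n≤1+n i) at-x)) (¬at ∘ down))

  ψ-invariant : ψ T ⇔ ψ T′
  ψ-invariant =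
    (λ (e≢f , path) → e≢f , from (proj₂ low⇔shared (proj₁ high⇔shared (to path)))) ,
    (λ (e≢f , path) → e≢f , from (proj₂ high⇔shared (proj₁ low⇔shared (to path))))
    where
    to : ∀ {T v w} → Eq.EqClosure (Edge T) v w → Eq.EqClosure (EdgeOf (Replaced T)) v w
    to {T} = Eq.map λ where
      (horizontal a b u) → horizontal a b u
      (verticalˡ u)      → verticalˡ u
      (verticalʳ u)      → verticalʳ u
    from : ∀ {T v w} → Eq.EqClosure (EdgeOf (Replaced T)) v w → Eq.EqClosure (Edge T) v w
    from {T} = Eq.map λ where
      (horizontal a b u) → horizontal a b u
      (verticalˡ u)      → verticalˡ u
      (verticalʳ u)      → verticalʳ u

-- Crystal operators

if-yes : ∀ {A P : Set} (d : Dec P) {x y : A} → P → (if does d then x else y) ≡ x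
if-yes (yes _) p = refl
if-yes (no ¬p) p = contradiction p ¬p

if-no : ∀ {A P : Set} (d : Dec P) {x y : A} → ¬ P → (if does d then x else y) ≡ y
if-no (yes p) ¬p = contradiction p ¬p
if-no (no _)  ¬p = refl

module _ {A : Set} {f g : A → Letter} where
  private
    module F = Brackets f
    module G = Brackets g

  depth-cong : ∀ {d xs} → All (λ x → f x ≡ g x) xs → F.depth d xs ≡ G.depth d xs
  depth-cong []                        = refl
  depth-cong {d} {x ∷ xs} (eq ∷ f≗g) rewrite eq = depth-cong f≗g

  no-underflow-cong : ∀ {d xs} → All (λ x → f x ≡ g x) xs → F.NoUnderflow d xs → G.NoUnderflow d xs
  no-underflow-cong []                                n       = tt
  no-underflow-cong {d} {x ∷ xs} (eq ∷ f≗g) (c , n) rewrite eq = c , no-underflow-cong f≗g n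

module _ {n : ℕ} (μ ν : Vector ℕ n) where
  open Shape μ ν
  open Words μ ν

  module _ (T : Filling) (x : Square) (v : ℕ) where

    update-at : (T [ x ≔ v ]) x ≡ v
    update-at = if-yes (x ≟□ x) refl

    update-off : ∀ {s} → s ≢ x → (T [ x ≔ v ]) s ≡ T s
    update-off {s} = if-no (s ≟□ x)

  in-squares : ∀ x → x ∈ squares
  in-squares (r , k) = subst ((r , k) ∈_) (sym squares-rows)
    (∈-concatMap⁺ rowSquares (lose (Any.reverse⁺ (∈-allFin r)) (∈-tabulate⁺ k)))

  squares-row : ∀ r → ∃[ pre ] ∃[ post ] squares ≡ pre ++ rowSquares r ++ post
  squares-row r with ∈-∃++ (Any.reverse⁺ (∈-allFin r))
  ... | as , bs , eq = concatMap rowSquares as , concatMap rowSquares bs ,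
    trans squares-rows (trans (cong (concatMap rowSquares) eq) (List.concatMap-++ rowSquares as (r ∷ bs)))

  module _ {i : ℕ} {T : Filling} where
    open Brackets (letter i T)

    last-isolated : ∀ {x} → last (proj₂ (foldl step ([] , []) squares)) ≡ just x →
                    letter i T x ≡ opening × IsolatedIn i T x
    last-isolated {x} eq = proj₁ (at _ _ (proj₂ (proj₂ (∈-∃++ (in-squares x))))) , λ u v split → proj₂ (at u v split)
      where
      at : ∀ u v → squares ≡ u ++ x ∷ v → letter i T x ≡ opening × Isolated x u v
      at u v split = leftmost-opening u v (proj₁ (split-unique split)) (proj₂ (split-unique split))
        (trans (cong (λ xs → last (proj₂ (foldl step ([] , []) xs))) (sym split)) eq)

    head-isolated : ∀ {x} → head (proj₁ (foldl step ([] , []) squares)) ≡ just x →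
                    letter i T x ≡ closing × IsolatedIn i T x
    head-isolated {x} eq = proj₁ (at _ _ (proj₂ (proj₂ (∈-∃++ (in-squares x))))) , λ u v split → proj₂ (at u v split)
      where
      at : ∀ u v → squares ≡ u ++ x ∷ v → letter i T x ≡ closing × Isolated x u v
      at u v split = rightmost-closing u v (proj₁ (split-unique split)) (proj₂ (split-unique split))
        (trans (cong (λ xs → head (proj₁ (foldl step ([] , []) xs))) (sym split)) eq)

    -- A nonempty run of openings directly before the isolated square would still be pending when
    -- that square is read.
    no-opening-run : ∀ {r} {k l : Fin (μ r ∸ ν r)} → IsolatedIn i T (r , k) → toℕ l < toℕ k →
      ¬ (∀ j → toℕ l ≤ toℕ j → toℕ j < toℕ k → letter i T (r , j) ≡ opening)
    no-opening-run {r} {k} {l} isolated l<k opens = go (squares-row r)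
      where
      row′ run : List Square
      row′ = rowSquares r
      run = drop (toℕ l) (take (toℕ k) row′)
      length-run : length run ≡ toℕ k ∸ toℕ l
      length-run = length-slice (toℕ l) row′ (ℕ.<⇒≤ (index-≤ k))
      go : ¬ (∃[ pre ] ∃[ post ] squares ≡ pre ++ row′ ++ post)
      go (pre , post , eq) = contradiction
        (ℕ.≤-trans (ℕ.m≤m+n (length run) _) (ℕ.≤-reflexive
          (trans (sym (depth-opening (slice-tabulate (toℕ l) (toℕ k) (r ,_) opens)))
            (trans (sym (depth-++ 0 (pre ++ take (toℕ l) row′) run)) (Isolated.exhausted (isolated _ (drop (suc (toℕ k)) row′ ++ post) split))))))
        (ℕ.<⇒≱ (ℕ.≤-trans (ℕ.m<n⇒0<n∸m l<k) (ℕ.≤-reflexive (sym length-run))))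
        where
        split : squares ≡ ((pre ++ take (toℕ l) row′) ++ run) ++ (r , k) ∷ drop (suc (toℕ k)) row′ ++ post
        split = trans eq (trans
          (cong (λ xs → pre ++ xs ++ post) (trans (split-slice (toℕ l) (toℕ k) row′ (ℕ.<⇒≤ l<k))
            (cong (λ xs → take (toℕ l) row′ ++ run ++ xs) (drop-tabulate-∷ (r ,_) k))))
          (trans (reassociateˡ [] pre (take (toℕ l) row′) run ((r , k) ∷ drop (suc (toℕ k)) row′) post)
            (cong (_++ (r , k) ∷ drop (suc (toℕ k)) row′ ++ post) (sym (List.++-assoc pre (take (toℕ l) row′) run)))))

    no-closing-run : ∀ {r} {k l : Fin (μ r ∸ ν r)} → IsolatedIn i T (r , k) → toℕ k < toℕ l →
      ¬ (∀ j → toℕ k < toℕ j → toℕ j ≤ toℕ l → letter i T (r , j) ≡ closing)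
    no-closing-run {r} {k} {l} isolated k<l closes = go (squares-row r)
      where
      row′ run : List Square
      row′ = rowSquares r
      run = drop (suc (toℕ k)) (take (suc (toℕ l)) row′)
      length-run : length run ≡ toℕ l ∸ toℕ k
      length-run = length-slice (suc (toℕ k)) row′ (index-≤ l)
      go : ¬ (∃[ pre ] ∃[ post ] squares ≡ pre ++ row′ ++ post)
      go (pre , post , eq) = contradiction
        (no-underflow-closing (slice-tabulate (suc (toℕ k)) (suc (toℕ l)) (r ,_) λ j k<j j<l → closes j k<j (s≤s⁻¹ j<l))
          (no-underflow-++ˡ run (Isolated.no-underflow (isolated (pre ++ take (toℕ k) row′) (run ++ drop (suc (toℕ l)) row′ ++ post) split))))
        (ℕ.<⇒≱ (ℕ.≤-trans (ℕ.m<n⇒0<n∸m k<l) (ℕ.≤-reflexive (sym length-run))))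
        where
        drop-run : drop (toℕ k) row′ ≡ (r , k) ∷ run ++ drop (suc (toℕ l)) row′
        drop-run = trans (drop-tabulate-∷ (r ,_) k) (cong ((r , k) ∷_) (drop-slice (suc (toℕ k)) (suc (toℕ l)) row′ (ℕ.m≤n⇒m≤1+n k<l)))
          where
          drop-slice : ∀ {A : Set} k m (xs : List A) → k ≤ m → drop k xs ≡ drop k (take m xs) ++ drop m xs
          drop-slice zero    m       xs       _         = sym (List.take++drop≡id m xs)
          drop-slice (suc k) (suc m) []       _         = refl
          drop-slice (suc k) (suc m) (x ∷ xs) (s≤s k≤m) = drop-slice k m xs k≤m
        split : squares ≡ (pre ++ take (toℕ k) row′) ++ (r , k) ∷ run ++ drop (suc (toℕ l)) row′ ++ post
        split = trans eq (trans
          (cong (λ xs → pre ++ xs ++ post) (trans (sym (List.take++drop≡id (toℕ k) row′)) (cong (take (toℕ k) row′ ++_) drop-run)))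
          (trans (cong (pre ++_) (List.++-assoc (take (toℕ k) row′) _ post))
            (trans (sym (List.++-assoc pre (take (toℕ k) row′) _))
              (cong (λ xs → (pre ++ take (toℕ k) row′) ++ (r , k) ∷ xs) (List.++-assoc run _ post)))))

-- Reducing both operators to the lowering of one square

module Crystal {n : ℕ} (μ ν : Vector ℕ n)
  (μ↓ : IsPartition μ) (μ₃ : NoThreeEqual μ) (ν↓ : IsPartition ν) (ν₃ : NoThreeEqual ν)
  (tableau : Shape.ShuffleTableau μ ν) (i : ℕ) where
  open Shape μ ν
  open ShuffleTableau tableau renaming (entry to T)
  open Values μ ν μ↓ μ₃ ν↓ ν₃ contained
  open Monotone tableau
  open Words μ ν
  open Tableau μ ν μ↓ μ₃ ν↓ ν₃ tableau i

  -- An i + 1 further left would start a run of i + 1 up to the square. As the position two rows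
  -- above the square misses i, so do those above the run; all its members are then openings.
  leftmost-in-row : ∀ {r k} → letter i T (r , k) ≡ opening → IsolatedIn i T (r , k) →
                    ∀ l → toℕ l < toℕ k → T (r , l) ≤ i
  leftmost-in-row {r} {k} op isolated l l<k = ℕ.≮⇒≥ λ i<Tl → no-opening-run μ ν {i} {T} {l = l} isolated l<k λ j l≤j j<k →
    is-opening {r} {j}
      (ℕ.≤-antisym (ℕ.≤-trans (rows (r , j) (r , k) refl (col≤ {r} {j} (ℕ.<⇒≤ j<k))) (ℕ.≤-reflexive Tx))
                   (ℕ.≤-trans i<Tl (rows (r , l) (r , j) refl (col≤ {r} {l} l≤j))))
      λ {t} {s} t⋖s s⋖r at → opening-free {r} {k} Tx free t⋖s s⋖r
        (rightward at (col≤ {r} {j} (ℕ.<⇒≤ j<k)) (parity-above {t} {s} {r} {col (r , k)} t⋖s s⋖r (square-parity (r , k))))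
    where
    Tx : T (r , k) ≡ suc i
    Tx = proj₁ (opening-letter {i} {T} {r , k} op)
    free : ¬ InOverlap i T (r , k)
    free = proj₂ (opening-letter {i} {T} {r , k} op)

  rightmost-in-row : ∀ {r k} → letter i T (r , k) ≡ closing → IsolatedIn i T (r , k) →
                     ∀ l → toℕ k < toℕ l → suc i ≤ T (r , l)
  rightmost-in-row {r} {k} cl isolated l k<l = ℕ.≰⇒> λ Tl≤i → no-closing-run μ ν {i} {T} {l = l} isolated k<l λ j k<j j≤l →
    is-closing {r} {j}
      (ℕ.≤-antisym (ℕ.≤-trans (rows (r , j) (r , l) refl (col≤ {r} {j} j≤l)) Tl≤i)
                   (ℕ.≤-trans (ℕ.≤-reflexive (sym Tx)) (rows (r , k) (r , j) refl (col≤ {r} {k} (ℕ.<⇒≤ k<j)))))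
      λ {s} {u} r⋖s s⋖u → rightward (closing-free {r} {k} Tx free r⋖s s⋖u) (col≤ {r} {k} (ℕ.<⇒≤ k<j))
        (parity-⋖⋖ {r} {s} {u} {col (r , j)} r⋖s s⋖u (square-parity (r , j)))
    where
    Tx : T (r , k) ≡ i
    Tx = proj₁ (closing-letter {i} {T} {r , k} cl)
    free : ¬ InOverlap i T (r , k)
    free = proj₂ (closing-letter {i} {T} {r , k} cl)

  E-invariant : ∀ T′ → E i T ≡ just T′ → ψ T′ ⇔ ψ T
  E-invariant T′ eq = go (raised {i} {T} eq)
    where
    go : ∃[ x ] (T′ ≡ T [ x ≔ i ] × last (proj₂ (foldl (Brackets.step (letter i T)) ([] , []) squares)) ≡ just x) → ψ T′ ⇔ ψ T
    -- `Invariance` goes from the higher filling to the lower one; for `E` the new filling is the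
    -- lower, hence `swap`.
    go (x@(r , k) , refl , last≡) = swap (Invariance.ψ-invariant μ ν μ↓ μ₃ ν↓ ν₃ tableau i r k
      (record { Tx = Tx ; free = free ; leftmost = leftmost-in-row op isolated ; isolated = isolated }) (T [ x ≔ i ]) (update-at μ ν T x i) (λ s → update-off μ ν T x i))
      where
      op : letter i T x ≡ opening
      op = proj₁ (last-isolated μ ν {i} {T} last≡)
      isolated : IsolatedIn i T x
      isolated = proj₂ (last-isolated μ ν {i} {T} last≡)
      Tx : T x ≡ suc i
      Tx = proj₁ (opening-letter {i} {T} {x} op)
      free : ¬ InOverlap i T x
      free = proj₂ (opening-letter {i} {T} {x} op)

  same-column : ∀ {s t} → col s ≡ col t → T s ≡ T t → s ≡ t
  same-column {r , k} {u , l} c≡ T≡ = go (ℕ.<-cmp (toℕ r) (toℕ u))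
    where
    go : Tri (toℕ r < toℕ u) (toℕ r ≡ toℕ u) (toℕ u < toℕ r) → (r , k) ≡ (u , l)
    go (tri< r<u _ _) = contradiction T≡ (ℕ.<⇒≢ (columns (r , k) (u , l) c≡ r<u))
    go (tri> _ _ u<r) = contradiction (sym T≡) (ℕ.<⇒≢ (columns (u , l) (r , k) (sym c≡) u<r))
    go (tri≈ _ r≡u _) = go′ (Fin.toℕ-injective r≡u)
      where
      go′ : r ≡ u → (r , k) ≡ (u , l)
      go′ refl = cong (r ,_) (col-injective {r} {k} {l} c≡)

  module Lowered (r : Fin n) (k : Fin (μ r ∸ ν r)) (cl : letter i T (r , k) ≡ closing) (isolated : IsolatedIn i T (r , k)) where

    x : Square
    x = r , k

    T⁺ : Filling
    T⁺ = T [ x ≔ suc i ]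

    Tx : T x ≡ i
    Tx = proj₁ (closing-letter {i} {T} {x} cl)

    free : ¬ InOverlap i T x
    free = proj₂ (closing-letter {i} {T} {x} cl)

    T⁺x : T⁺ x ≡ suc i
    T⁺x = update-at μ ν T x (suc i)

    T⁺-off : ∀ {s} → s ≢ x → T⁺ s ≡ T s
    T⁺-off = update-off μ ν T x (suc i)

    T≤T⁺ : ∀ s → T s ≤ T⁺ s
    T≤T⁺ s = go (s ≟□ x)
      where
      go : Dec (s ≡ x) → T s ≤ T⁺ s
      go (yes refl) = ℕ.≤-trans (ℕ.≤-reflexive Tx) (ℕ.≤-trans (ℕ.n≤1+n i) (ℕ.≤-reflexive (sym T⁺x)))
      go (no s≢x)   = ℕ.≤-reflexive (sym (T⁺-off s≢x))

    right-of-x : ∀ t → row t ≡ r → col x ≤ᶻ col t → t ≢ x → suc i ≤ T t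
    right-of-x (r , l) refl le t≢x = rightmost-in-row cl isolated l
      (ℕ.≤∧≢⇒< (col≤⁻¹ {r} {k} {l} le) λ eq → t≢x (cong (r ,_) (sym (Fin.toℕ-injective eq))))

    below-x : ∀ t → col x ≡ col t → r Fin.< row t → suc i < T t
    below-x t c≡ r<t = ℕ.≤∧≢⇒< (ℕ.≤-trans (s≤s (ℕ.≤-reflexive (sym Tx))) (columns x t c≡ r<t))
      λ eq → free (proj₁ t , proj₂ t , inj₁ (c≡ , Tx , sym eq))

    tableau⁺ : ShuffleTableau
    tableau⁺ = record
      { contained = contained
      ; entry     = T⁺
      ; positive  = λ s → ℕ.≤-trans (positive s) (T≤T⁺ s)
      ; rows      = rows⁺
      ; columns   = columns⁺
      }
      where
      rows⁺ : ∀ s t → row s ≡ row t → col s ≤ᶻ col t → T⁺ s ≤ T⁺ t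
      rows⁺ s t r≡ c≤ = go (s ≟□ x) (t ≟□ x)
        where
        go : Dec (s ≡ x) → Dec (t ≡ x) → T⁺ s ≤ T⁺ t
        go (no s≢x)   _          = ℕ.≤-trans (ℕ.≤-reflexive (T⁺-off s≢x)) (ℕ.≤-trans (rows s t r≡ c≤) (T≤T⁺ t))
        go (yes refl) (yes refl) = ℕ.≤-refl
        go (yes refl) (no t≢x)   = ℕ.≤-trans (ℕ.≤-reflexive T⁺x) (ℕ.≤-trans (right-of-x t (sym r≡) c≤ t≢x) (T≤T⁺ t))
      columns⁺ : ∀ s t → col s ≡ col t → row s Fin.< row t → T⁺ s < T⁺ t
      columns⁺ s t c≡ r< = go (s ≟□ x)
        where
        go : Dec (s ≡ x) → T⁺ s < T⁺ t
        go (no s≢x)   = ℕ.≤-<-trans (ℕ.≤-reflexive (T⁺-off s≢x)) (ℕ.<-≤-trans (columns s t c≡ r<) (T≤T⁺ t))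
        go (yes refl) = ℕ.≤-<-trans (ℕ.≤-reflexive T⁺x) (ℕ.<-≤-trans (below-x t c≡ r<) (T≤T⁺ t))

    free⁺ : ¬ InOverlap i T⁺ x
    free⁺ (q , l , inj₁ (_ , T⁺x≡i , _))      = ℕ.1+n≢n (trans (sym T⁺x) T⁺x≡i)
    free⁺ (q , l , inj₂ (c≡ , T⁺q≡i , _)) = go ((q , l) ≟□ x)
      where
      go : ¬ Dec ((q , l) ≡ x)
      go (yes refl) = ℕ.1+n≢n (trans (sym T⁺x) T⁺q≡i)
      go (no q≢x)   = q≢x (same-column {q , l} {x} c≡ (trans (trans (sym (T⁺-off q≢x)) T⁺q≡i) (sym Tx)))

    overlap⁺ : ∀ {s} → s ≢ x → InOverlap i T s → InOverlap i T⁺ s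
    overlap⁺ {s} s≢x (q , l , inj₁ (c≡ , Ts , Tq)) = q , l , inj₁ (c≡ , trans (T⁺-off s≢x) Ts , trans (T⁺-off q≢x) Tq)
      where
      q≢x : (q , l) ≢ x
      q≢x refl = ℕ.1+n≢n (trans (sym Tq) Tx)
    overlap⁺ {s} s≢x (q , l , inj₂ (c≡ , Tq , Ts)) = q , l , inj₂ (c≡ , trans (T⁺-off q≢x) Tq , trans (T⁺-off s≢x) Ts)
      where
      q≢x : (q , l) ≢ x
      q≢x refl = free (proj₁ s , proj₂ s , inj₁ (c≡ , Tq , Ts))

    overlap⁻ : ∀ {s} → s ≢ x → InOverlap i T⁺ s → InOverlap i T s
    overlap⁻ {s} s≢x (q , l , inj₁ (c≡ , Ts , Tq)) = q , l , inj₁ (c≡ , trans (sym (T⁺-off s≢x)) Ts , trans (sym (T⁺-off q≢x)) Tq)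
      where
      q≢x : (q , l) ≢ x
      q≢x refl = s≢x (same-column {s} {x} c≡ (trans (trans (sym (T⁺-off s≢x)) Ts) (sym Tx)))
    overlap⁻ {s} s≢x (q , l , inj₂ (c≡ , Tq , Ts)) = q , l , inj₂ (c≡ , trans (sym (T⁺-off q≢x)) Tq , trans (sym (T⁺-off s≢x)) Ts)
      where
      q≢x : (q , l) ≢ x
      q≢x refl = ℕ.1+n≢n (trans (sym T⁺x) Tq)

    -- The square `x` is in no overlap either before or after the change, so the change neither
    -- breaks nor creates an overlap among the other squares.
    letter-same : ∀ {s} → s ≢ x → letter i T s ≡ letter i T⁺ s
    letter-same {s} s≢x = letterOf-⇔ (inWord? i T s) (T s ℕ.≟ suc i) (inWord? i T⁺ s) (T⁺ s ℕ.≟ suc i)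
      ((λ (v , ¬o) → [ inj₁ ∘ to , inj₂ ∘ to ]′ v , ¬o ∘ overlap⁻ s≢x) ,
       (λ (v , ¬o) → [ inj₁ ∘ from , inj₂ ∘ from ]′ v , ¬o ∘ overlap⁺ s≢x))
      (to , from)
      where
      to : ∀ {v} → T s ≡ v → T⁺ s ≡ v
      to = trans (T⁺-off s≢x)
      from : ∀ {v} → T⁺ s ≡ v → T s ≡ v
      from = trans (sym (T⁺-off s≢x))

    -- `Isolated` speaks only of the letters on the two sides of `x`, and these stay the same while
    -- `x` itself turns from a closing into an opening.
    isolated⁺ : IsolatedIn i T⁺ x
    isolated⁺ u v split = record
      { exhausted    = trans (sym (depth-cong {f = letter i T} {letter i T⁺} (All.map letter-same (proj₁ (split-unique split))))) exhausted
      ; no-underflow = no-underflow-cong {f = letter i T} {letter i T⁺} (All.map letter-same (proj₂ (split-unique split))) no-underflow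
      }
      where open Brackets.Isolated (isolated u v split)

    leftmost⁺ : ∀ l → toℕ l < toℕ k → T⁺ (r , l) ≤ i
    leftmost⁺ l l<k = ℕ.≤-trans (ℕ.≤-reflexive (T⁺-off {r , l} l≢k)) (ℕ.≤-trans
      (rows (r , l) x refl (col≤ {r} {l} (ℕ.<⇒≤ l<k))) (ℕ.≤-reflexive Tx))
      where
      l≢k : (r , l) ≢ x
      l≢k refl = ℕ.<-irrefl refl l<k

    ψ-invariant : ψ T⁺ ⇔ ψ T
    ψ-invariant = Invariance.ψ-invariant μ ν μ↓ μ₃ ν↓ ν₃ tableau⁺ i r k
      (record { Tx = T⁺x ; free = free⁺ ; leftmost = leftmost⁺ ; isolated = isolated⁺ }) T Tx
      λ s s≢x → sym (T⁺-off s≢x)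

  F-invariant : ∀ T′ → F i T ≡ just T′ → ψ T′ ⇔ ψ T
  F-invariant T′ eq = go (lowered {i} {T} eq)
    where
    go : ∃[ x ] (T′ ≡ T [ x ≔ suc i ] × head (proj₁ (foldl (Brackets.step (letter i T)) ([] , []) squares)) ≡ just x) → ψ T′ ⇔ ψ T
    go ((r , k) , refl , head≡) = Lowered.ψ-invariant r k (proj₁ (head-isolated μ ν {i} {T} head≡)) (proj₂ (head-isolated μ ν {i} {T} head≡))

proposition4p7 : ∀ {n : ℕ} (μ ν : Vector ℕ n) →
    IsPartition μ → NoThreeEqual μ →
    IsPartition ν → NoThreeEqual ν →
    let open Shape μ ν in
    (T : ShuffleTableau) (i : ℕ) → 1 ≤ i →
    let open ShuffleTableau T in
    (∀ T′ → E i entry ≡ just T′ → ψ T′ ⇔ ψ entry) ×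
    (∀ T′ → F i entry ≡ just T′ → ψ T′ ⇔ ψ entry)
proposition4p7 μ ν μ↓ μ₃ ν↓ ν₃ T i _ = E-invariant , F-invariant
  where open Crystal μ ν μ↓ μ₃ ν↓ ν₃ T i
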